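{- There exists a function $f:\mathbb{N}^2\to\mathbb{N}$ such that the following holds for all $b,k\in\mathbb{N}$. Let $\mathcal{G}$ be a class of graphs closed under taking subgraphs such that every graph in $\mathcal{G}$ has basis number at most $b$, and let $G$ be a graph having a tree-decomposition with adhesion at most $k$ all of whose torsos belong to $\mathcal{G}$. Then $\mathrm{bn}(G)\le f(b,k)$.
   Context: All graphs are finite and simple. Basis number: subsets of $E(G)$ form an $\mathbb{F}_2$-vector space under symmetric difference; an $\mathbb{F}_2$-cycle is a subgraph with all degrees even; these form the cycle space, a cycle basis is a basis of it; the congestion of a family of subgraphs is the maximum over edges $e$ of the number of members containing $e$; $\mathrm{bn}(G)$ is the minimum congestion of a cycle basis. A tree-decomposition of $G$ is a pair $(T,\beta)$ with $T$ a rooted tree and $\beta:V(T)\to 2^{V(G)}$ such that every vertex lies in some bag $\beta(t)$, every edge has both endpoints in some bag, and for each vertex $v$ the nodes whose bags contain $v$ induce a connected subtree. The adhesion of a node $t$ is $\beta(t)\cap\beta(t')$ where $t'$ is the parent of $t$ (empty for the root); the decomposition has adhesion at most $k$ if every adhesion has size at most $k$. The torso of $t$ is the graph obtained from $G[\beta(t)]$ by adding all edges $uv$ for every pair $u,v$ contained in the adhesion of $t$ or in the adhesion of some child of $t$. -}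

module Defs where

open import Data.Nat using (ℕ; zero; suc; _≤_)
open import Data.Nat.Divisibility using (_∣_)
open import Data.Bool using (Bool; true; false; _∧_; _∨_; not; _xor_; if_then_else_)
open import Data.Bool.Properties using (∧-comm; ∧-assoc)
open import Data.Fin using (Fin; zero; suc; toℕ; _≟_)
open import Data.Product using (Σ; _×_; _,_; ∃)
open import Relation.Nullary.Decidable using (⌊_⌋; yes; no)
open import Relation.Binary.PropositionalEquality using (_≡_; refl; sym; cong; cong₂)
open import Function.Definitions using (Injective)

count : ∀ {n} → (Fin n → Bool) → ℕ
count {zero}  p = zero
count {suc n} p = if p zero then suc (count (λ i → p (suc i))) else count (λ i → p (suc i))

anyF : ∀ {n} → (Fin n → Bool) → Bool
anyF {zero}  p = false
anyF {suc n} p = p zero ∨ anyF (λ i → p (suc i))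

elems : ∀ {n} (p : Fin n → Bool) → Fin (count p) → Fin n
elems {suc n} p i with p zero
elems {suc n} p zero    | true  = zero
elems {suc n} p (suc i) | true  = suc (elems (λ j → p (suc j)) i)
elems {suc n} p i       | false = suc (elems (λ j → p (suc j)) i)

Even : ℕ → Set
Even m = 2 ∣ m

record Graph : Set where
  field
    n     : ℕ
    adj   : Fin n → Fin n → Bool
    adj-sym : ∀ u v → adj u v ≡ adj v u
    adj-irrefl : ∀ v → adj v v ≡ false
open Graph public

_⊆G_ : Graph → Graph → Set
H ⊆G G = Σ (Fin (n H) → Fin (n G)) λ φ →
  Injective _≡_ _≡_ φ × (∀ u v → adj H u v ≡ true → adj G (φ u) (φ v) ≡ true)

SubgraphClosed : (Graph → Set) → Set
SubgraphClosed 𝒢 = ∀ G H → 𝒢 G → H ⊆G G → 𝒢 H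

-- a set of edges of G is given by a symmetric Bool-matrix contained in adj G
EdgeSet : ℕ → Set
EdgeSet m = Fin m → Fin m → Bool

IsEdgeSubset : (G : Graph) → EdgeSet (n G) → Set
IsEdgeSubset G S = (∀ u v → S u v ≡ S v u) × (∀ u v → S u v ≡ true → adj G u v ≡ true)

IsF2Cycle : (G : Graph) → EdgeSet (n G) → Set
IsF2Cycle G S = IsEdgeSubset G S × (∀ v → Even (count (λ u → S v u)))

_≈E_ : ∀ {m} → EdgeSet m → EdgeSet m → Set
S ≈E T = ∀ u v → S u v ≡ T u v

emptyE : ∀ {m} → EdgeSet m
emptyE u v = false

sumSel : ∀ {m r} → (Fin r → EdgeSet m) → (Fin r → Bool) → EdgeSet m
sumSel {r = zero}  B c = emptyE
sumSel {r = suc r} B c u v =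
  (c zero ∧ B zero u v) xor sumSel (λ i → B (suc i)) (λ i → c (suc i)) u v

record CycleBasis (G : Graph) : Set where
  field
    r        : ℕ
    member   : Fin r → EdgeSet (n G)
    isCycle  : ∀ i → IsF2Cycle G (member i)
    indep    : ∀ (c : Fin r → Bool) → sumSel member c ≈E emptyE → ∀ i → c i ≡ false
    spanning : ∀ (C : EdgeSet (n G)) → IsF2Cycle G C → Σ (Fin r → Bool) λ c → sumSel member c ≈E C
open CycleBasis public

CongestionAtMost : (G : Graph) → CycleBasis G → ℕ → Set
CongestionAtMost G B q = ∀ u v → adj G u v ≡ true → count (λ i → member B i u v) ≤ q

-- bn(G) ≤ q  (bn is the minimum congestion of a cycle basis)
BnAtMost : Graph → ℕ → Set
BnAtMost G q = Σ (CycleBasis G) λ B → CongestionAtMost G B q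

-- Tree-decompositions
-- The rooted tree T has nodes Fin (suc m); node zero is the root and
-- node (suc i) has parent (parent i), whose index is ≤ i (every finite
-- rooted tree admits such a labelling).

record TreeDecomposition (G : Graph) : Set where
  field
    m         : ℕ
    parent    : Fin m → Fin (suc m)
    parent<   : ∀ i → toℕ (parent i) ≤ toℕ i
    bag       : Fin (suc m) → Fin (n G) → Bool
open TreeDecomposition public

data TreeEdge {G : Graph} (D : TreeDecomposition G) : Fin (suc (m D)) → Fin (suc (m D)) → Set where
  up   : ∀ i → TreeEdge D (suc i) (parent D i)
  down : ∀ i → TreeEdge D (parent D i) (suc i)

data ConnectedIn {G : Graph} (D : TreeDecomposition G) (P : Fin (suc (m D)) → Bool)
     : Fin (suc (m D)) → Fin (suc (m D)) → Set where
  here : ∀ s → P s ≡ true → ConnectedIn D P s s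
  step : ∀ s t u → P s ≡ true → TreeEdge D s t → ConnectedIn D P t u → ConnectedIn D P s u

IsTreeDecomposition : (G : Graph) → TreeDecomposition G → Set
IsTreeDecomposition G D =
  (∀ v → ∃ λ t → bag D t v ≡ true) ×
  (∀ u v → adj G u v ≡ true → ∃ λ t → bag D t u ∧ bag D t v ≡ true) ×
  (∀ v s t → bag D s v ≡ true → bag D t v ≡ true → ConnectedIn D (λ x → bag D x v) s t)

adhesion : ∀ {G} (D : TreeDecomposition G) → Fin (suc (m D)) → Fin (n G) → Bool
adhesion D zero    v = false
adhesion D (suc i) v = bag D (suc i) v ∧ bag D (parent D i) v

AdhesionAtMost : ∀ {G} → TreeDecomposition G → ℕ → Set
AdhesionAtMost D k = ∀ t → count (adhesion D t) ≤ k

private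
  neq : ∀ {m} → Fin m → Fin m → Bool
  neq u v = not ⌊ u ≟ v ⌋

  neq-sym : ∀ {m} (u v : Fin m) → neq u v ≡ neq v u
  neq-sym u v with u ≟ v | v ≟ u
  ... | yes _ | yes _ = refl
  ... | no _  | no _  = refl
  ... | yes p | no q  with q (sym p)
  ... | ()
  neq-sym u v | no q | yes p with q (sym p)
  ... | ()

  neq-refl : ∀ {m} (u : Fin m) → neq u u ≡ false
  neq-refl u with u ≟ u
  ... | yes _ = refl
  ... | no q with q refl
  ... | ()

  ∧-false : ∀ b → b ∧ false ≡ false
  ∧-false true  = refl
  ∧-false false = refl

isChild : ∀ {G} (D : TreeDecomposition G) → Fin (suc (m D)) → Fin (suc (m D)) → Bool
isChild D zero    t = false
isChild D (suc i) t = ⌊ parent D i ≟ t ⌋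

inChildAdhesion : ∀ {G} (D : TreeDecomposition G) → Fin (suc (m D)) → Fin (n G) → Fin (n G) → Bool
inChildAdhesion D t u v = anyF (λ c → isChild D c t ∧ (adhesion D c u ∧ adhesion D c v))

torsoRel : ∀ {G} (D : TreeDecomposition G) → Fin (suc (m D)) → Fin (n G) → Fin (n G) → Bool
torsoRel {G} D t u v =
  adj G u v ∨ ((adhesion D t u ∧ adhesion D t v) ∨ inChildAdhesion D t u v)

private
  anyF-cong : ∀ {k} (p q : Fin k → Bool) → (∀ i → p i ≡ q i) → anyF p ≡ anyF q
  anyF-cong {zero}  p q e = refl
  anyF-cong {suc k} p q e = cong₂ _∨_ (e zero) (anyF-cong (λ i → p (suc i)) (λ i → q (suc i)) (λ i → e (suc i)))

  torsoRel-sym : ∀ {G} (D : TreeDecomposition G) t u v → torsoRel D t u v ≡ torsoRel D t v u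
  torsoRel-sym {G} D t u v =
    cong₂ _∨_ (adj-sym G u v)
      (cong₂ _∨_ (∧-comm (adhesion D t u) (adhesion D t v))
        (anyF-cong _ _ (λ c → cong (isChild D c t ∧_) (∧-comm (adhesion D c u) (adhesion D c v)))))

torso : ∀ {G} (D : TreeDecomposition G) → Fin (suc (m D)) → Graph
torso {G} D t = record
  { n      = count (bag D t)
  ; adj    = λ i j → neq (e i) (e j) ∧ torsoRel D t (e i) (e j)
  ; adj-sym = λ i j → cong₂ _∧_ (neq-sym (e i) (e j)) (torsoRel-sym D t (e i) (e j))
  ; adj-irrefl = λ i → cong (_∧ torsoRel D t (e i) (e i)) (neq-refl (e i))
  }
  where e = elems (bag D t)

{-# OPTIONS --safe #-}
module Submission where

-- All linear algebra is over F₂. Let E c consist of the edges whose topmost bag lies below the node c; a piece is a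
-- component of E c, its terminals are the adhesion vertices in it, and a demand is an even set of terminals, to be
-- routed as the set of odd vertices of an edge set. By induction from the leaves, every family of demands on a piece
-- that crosses each cut of the terminals at most N times can be routed inside the piece, together with a spanning set
-- of its cycles, with total congestion N.
--
-- At a node, view the pieces below it as virtual edges of the torso. Every demand is lifted to a chain of virtual
-- edges, and the lifts, together with generators of the cycle space of the torso (of bounded congestion by hypothesis),
-- are the demands handed down. A cut of a lower piece that no torso cycle crosses is crossed by no generator, and by
-- exactly the lifts of those demands that cross a fixed cut of the terminals. At any other cut, adding to the lifts
-- suitable sums of boundedly many torso cycles makes half of the nonzero demands cross; averaging over all cuts shows
-- that there are at most (2 - 2 / 2 ^ k) N of them, and the difference to N makes room for the generators. Boundedly
-- many torso cycles suffice, since all non-bridges of a path are covered by two elements of the cycle space.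

-- Depth is the obstacle. Every node adds the generators of its own torso to the demands, so a bound
-- that grows by even a constant per level is useless, and the lifts have to give back what the
-- generators consume. Lifting equal demands along one fixed chain gives nothing back, since all of
-- them then cross the same cuts; therefore equal demands are spread over all sums of a fixed list
-- of cycles. The length of this list has to depend on `k` alone, although the number of pieces is
-- unbounded. This works because a word of `k` bits names a cut in every piece simultaneously:
-- `2 ^ k` families of cuts contain every cut of every piece, and for each family a bounded number
-- of cycles per terminal is enough, however long the path from that terminal is.
--
-- The pieces are components, and not everything below a child, because an adhesion set need not be
-- connected below its node, and a demand between two components could not be routed.

open import Defs
open import Data.Bool using (Bool; true; false; _∧_; _∨_; not; _xor_; if_then_else_; T)
open import Data.Bool.Properties using (xor-same; xor-comm; xor-assoc; xor-identityʳ; ∧-comm; ∧-assoc; ∧-zeroʳ; ∧-identityʳ; ∨-zeroʳ; not-involutive; ∧-distribʳ-xor; ∧-distribˡ-xor)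
import Data.Bool.Properties as Bool
open import Data.Empty using (⊥; ⊥-elim)
open import Data.Fin using (Fin; zero; suc; toℕ; _≟_; combine; remQuot; _↑ˡ_; _↑ʳ_; splitAt)
import Data.Fin.Properties as Fin
open import Data.Nat as ℕ using (ℕ; zero; suc; _+_; _*_; _∸_; _^_; _≤_; _<_; z≤n; s≤s; ⌊_/2⌋; ⌈_/2⌉)
import Data.Nat.Properties as ℕ
open import Data.Nat.Divisibility using (_∣_; ∣m+n∣m⇒∣n; ∣-refl; ∣m∣n⇒∣m+n; ∣1⇒≡1; _∣0)
import Data.Nat.Solver as NatSolve
import Algebra.Properties.CommutativeSemigroup ℕ.+-commutativeSemigroup as Interchange
open import Data.Product using (Σ; ∃; _×_; _,_; proj₁; proj₂)
open import Data.Sum using (_⊎_; inj₁; inj₂; [_,_]′)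
open import Data.Unit using (tt)
open import Function using (_∘_; id; case_of_; _⟨_⟩_)
open import Relation.Binary.Construct.Closure.ReflexiveTransitive using (Star; ε; _◅_; _◅◅_; reverse) renaming (map to mapStar)
open import Relation.Binary.PropositionalEquality using (_≡_; _≢_; refl; sym; trans; cong; cong₂; subst; subst₂; module ≡-Reasoning)
open import Relation.Binary.Definitions using (tri<; tri≈; tri>)
open import Relation.Nullary using (¬_; Dec; yes; no; contradiction)
open import Relation.Nullary.Decidable using (⌊_⌋)
open import Data.List using (List; []; _∷_; _++_; map; concatMap; length; lookup)
import Data.List.Properties as List
open import Data.List.Relation.Unary.All as All using (All; []; _∷_)
import Data.List.Relation.Unary.All.Properties as All
open import Data.List.Relation.Unary.Any as Any using (Any; here; there)
import Data.List.Relation.Unary.Any.Properties as Any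
open import Data.List.Membership.Propositional using (_∈_)
import Data.List.Membership.Propositional.Properties as Mem

-- Parities and counting

-- Boolean identities are proved by truth table.
BoolFun : ℕ → Set
BoolFun zero    = Bool
BoolFun (suc k) = Bool → BoolFun k

Agree : ∀ k (f g : BoolFun k) → Set
Agree zero    a b = a ≡ b
Agree (suc k) f g = ∀ x → Agree k (f x) (g x)

agree? : ∀ k (f g : BoolFun k) → Bool
agree? zero    a b = not (a xor b)
agree? (suc k) f g = agree? k (f true) (g true) ∧ agree? k (f false) (g false)

private
  T-∧ : ∀ a {b} → T (a ∧ b) → T a × T b
  T-∧ true t = tt , t

taut : ∀ k (f g : BoolFun k) {_ : T (agree? k f g)} → Agree k f g
taut zero    true  true  = refl
taut zero    false false = refl
taut (suc k) f g {t} true  = taut k _ _ {proj₁ (T-∧ (agree? k (f true) (g true)) t)}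
taut (suc k) f g {t} false = taut k _ _ {proj₂ (T-∧ (agree? k (f true) (g true)) t)}


par : ∀ {n} → (Fin n → Bool) → Bool
par {zero}  f = false
par {suc n} f = f zero xor par (f ∘ suc)

sumℕ : ∀ {n} → (Fin n → ℕ) → ℕ
sumℕ {zero}  f = 0
sumℕ {suc n} f = f zero + sumℕ (f ∘ suc)

par-cong : ∀ {n} {f g : Fin n → Bool} → (∀ i → f i ≡ g i) → par f ≡ par g
par-cong {zero}  h = refl
par-cong {suc n} h = cong₂ _xor_ (h zero) (par-cong (h ∘ suc))

par-xor : ∀ {n} (f g : Fin n → Bool) → par (λ i → f i xor g i) ≡ par f xor par g
par-xor {zero}  f g = refl
par-xor {suc n} f g = trans (cong ((f zero xor g zero) xor_) (par-xor (f ∘ suc) (g ∘ suc)))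
  (taut 4 (λ a b c d → (a xor b) xor (c xor d)) (λ a b c d → (a xor c) xor (b xor d)) (f zero) (g zero) _ _)

par-zero : ∀ {n} (f : Fin n → Bool) → (∀ i → f i ≡ false) → par f ≡ false
par-zero {zero}  f h = refl
par-zero {suc n} f h = trans (cong (_xor par (f ∘ suc)) (h zero)) (par-zero (f ∘ suc) (h ∘ suc))

par-comm : ∀ {m n} (f : Fin m → Fin n → Bool) → par (λ i → par (f i)) ≡ par (λ j → par (λ i → f i j))
par-comm {zero}  {n} f = sym (par-zero {n} _ (λ _ → refl))
par-comm {suc m} {n} f = trans (cong (par (f zero) xor_) (par-comm (f ∘ suc))) (sym (par-xor (f zero) _))

par-∧ˡ : ∀ {n} b (f : Fin n → Bool) → b ∧ par f ≡ par (λ i → b ∧ f i)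
par-∧ˡ true  f = refl
par-∧ˡ {zero}  false f = refl
par-∧ˡ {suc n} false f = par-∧ˡ false (f ∘ suc)

par-∧ʳ : ∀ {n} b (f : Fin n → Bool) → par f ∧ b ≡ par (λ i → f i ∧ b)
par-∧ʳ b f = trans (∧-comm (par f) b) (trans (par-∧ˡ b f) (par-cong (λ i → ∧-comm b (f i))))

sumℕ-+ : ∀ {n} (f g : Fin n → ℕ) → sumℕ (λ i → f i + g i) ≡ sumℕ f + sumℕ g
sumℕ-+ {zero}  f g = refl
sumℕ-+ {suc n} f g = trans (cong (f zero + g zero +_) (sumℕ-+ (f ∘ suc) (g ∘ suc))) (Interchange.interchange (f zero) (g zero) _ _)

dichotomy : ∀ b → b ≡ true ⊎ b ≡ false
dichotomy true  = inj₁ refl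
dichotomy false = inj₂ refl

∧-elim : ∀ {a b} → a ∧ b ≡ true → a ≡ true × b ≡ true
∧-elim {true} {true} _ = refl , refl

∧-intro : ∀ {a b} → a ≡ true → b ≡ true → a ∧ b ≡ true
∧-intro refl refl = refl

∨-elim : ∀ {a b} → a ∨ b ≡ true → a ≡ true ⊎ b ≡ true
∨-elim {true}  _ = inj₁ refl
∨-elim {false} p = inj₂ p

∨-introʳ : ∀ a {b} → b ≡ true → a ∨ b ≡ true
∨-introʳ a refl = ∨-zeroʳ a

∨-introˡ : ∀ {a} b → a ≡ true → a ∨ b ≡ true
∨-introˡ b refl = refl

not-true : ∀ {b} → b ≢ true → b ≡ false
not-true {true}  p = ⊥-elim (p refl)
not-true {false} p = refl

absurd : ∀ {ℓ} {A : Set ℓ} {b} → b ≡ true → b ≡ false → A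
absurd refl ()

same-truth : ∀ {a b} → (a ≡ true → b ≡ true) → (b ≡ true → a ≡ true) → a ≡ b
same-truth {true}  {b}     f g = sym (f refl)
same-truth {false} {true}  f g = g refl
same-truth {false} {false} f g = refl

xor-cancel : ∀ {a b} → a xor b ≡ false → a ≡ b
xor-cancel {true}  {true}  _ = refl
xor-cancel {false} {false} _ = refl

δ : ∀ {n} → Fin n → Fin n → Bool
δ i j = ⌊ i ≟ j ⌋

δ-refl : ∀ {n} (i : Fin n) → δ i i ≡ true
δ-refl i with i ≟ i
... | yes _ = refl
... | no q  = ⊥-elim (q refl)

δ-≢ : ∀ {n} {i j : Fin n} → i ≢ j → δ i j ≡ false
δ-≢ {i = i} {j} q with i ≟ j
... | yes p = ⊥-elim (q p)
... | no _  = refl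

δ-true : ∀ {n} {i j : Fin n} → δ i j ≡ true → i ≡ j
δ-true {i = i} {j} e with i ≟ j
... | yes p = p

δ-sym : ∀ {n} (i j : Fin n) → δ i j ≡ δ j i
δ-sym i j = same-truth (λ e → subst (λ x → δ x i ≡ true) (δ-true e) (δ-refl i)) (λ e → subst (λ x → δ x j ≡ true) (δ-true e) (δ-refl j))

par-only : ∀ {n} (f : Fin n → Bool) j → (∀ i → i ≢ j → f i ≡ false) → par f ≡ f j
par-only f zero    h = trans (cong (f zero xor_) (par-zero (f ∘ suc) (λ i → h (suc i) λ ()))) (xor-identityʳ (f zero))
par-only f (suc j) h rewrite h zero (λ ()) = par-only (f ∘ suc) j (λ i q → h (suc i) (q ∘ Fin.suc-injective))

par-δ : ∀ {n} (f : Fin n → Bool) j → par (λ i → δ i j ∧ f i) ≡ f j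
par-δ f j = trans (par-only _ j (λ i q → cong (_∧ f i) (δ-≢ q))) (cong (_∧ f j) (δ-refl j))

par-δ′ : ∀ {n} (f : Fin n → Bool) j → par (λ i → δ j i ∧ f i) ≡ f j
par-δ′ f j = trans (par-cong (λ i → cong (_∧ f i) (δ-sym j i))) (par-δ f j)

par-witness : ∀ {n} (f : Fin n → Bool) → par f ≡ true → ∃ λ i → f i ≡ true
par-witness {suc n} f e with f zero in eq
... | true  = zero , eq
... | false with par-witness (f ∘ suc) e
...   | i , p = suc i , p

anyF-intro : ∀ {n} (p : Fin n → Bool) i → p i ≡ true → anyF p ≡ true
anyF-intro p zero    e = ∨-introˡ _ e
anyF-intro p (suc i) e = ∨-introʳ (p zero) (anyF-intro (p ∘ suc) i e)

anyF-elim : ∀ {n} (p : Fin n → Bool) → anyF p ≡ true → ∃ λ i → p i ≡ true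
anyF-elim {suc n} p e with p zero in eq
... | true  = zero , eq
... | false with anyF-elim (p ∘ suc) e
...   | i , q = suc i , q

anyF-none : ∀ {n} (p : Fin n → Bool) → anyF p ≡ false → ∀ i → p i ≡ false
anyF-none p e i = not-true (λ q → absurd (anyF-intro p i q) e)

ind : Bool → ℕ
ind b = if b then 1 else 0

ind≤1 : ∀ b → ind b ≤ 1
ind≤1 true  = ℕ.≤-refl
ind≤1 false = z≤n

ind-not : ∀ b → ind b + ind (not b) ≡ 1
ind-not true  = refl
ind-not false = refl

count-sum : ∀ {n} (p : Fin n → Bool) → count p ≡ sumℕ (ind ∘ p)
count-sum {zero}  p = refl
count-sum {suc n} p with p zero
... | true  = cong suc (count-sum (p ∘ suc))
... | false = count-sum (p ∘ suc)

count-cong : ∀ {n} {p q : Fin n → Bool} → (∀ i → p i ≡ q i) → count p ≡ count q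
count-cong {zero}  h = refl
count-cong {suc n} {p} {q} h rewrite h zero | count-cong {p = p ∘ suc} {q ∘ suc} (h ∘ suc) = refl

sumℕ-mono : ∀ {n} {f g : Fin n → ℕ} → (∀ i → f i ≤ g i) → sumℕ f ≤ sumℕ g
sumℕ-mono {zero}  h = z≤n
sumℕ-mono {suc n} h = ℕ.+-mono-≤ (h zero) (sumℕ-mono (h ∘ suc))

ind-mono : ∀ {a b} → (a ≡ true → b ≡ true) → ind a ≤ ind b
ind-mono {true}  h rewrite h refl = ℕ.≤-refl
ind-mono {false} h = z≤n

count-mono : ∀ {n} {p q : Fin n → Bool} → (∀ i → p i ≡ true → q i ≡ true) → count p ≤ count q
count-mono {p = p} {q} h = subst₂ _≤_ (sym (count-sum p)) (sym (count-sum q)) (sumℕ-mono (λ i → ind-mono (h i)))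

count-zero : ∀ {n} (p : Fin n → Bool) → (∀ i → p i ≡ false) → count p ≡ 0
count-zero {zero}  p h = refl
count-zero {suc n} p h rewrite h zero = count-zero (p ∘ suc) (h ∘ suc)

ind-∨ : ∀ {a b c} → (a ≡ true → b ≡ true ⊎ c ≡ true) → ind a ≤ ind b + ind c
ind-∨ {false} h = z≤n
ind-∨ {true} {b} h with h refl
... | inj₁ refl = s≤s z≤n
... | inj₂ refl = ℕ.m≤n+m 1 (ind b)

count-∪ : ∀ {n} {p q r : Fin n → Bool} → (∀ i → p i ≡ true → q i ≡ true ⊎ r i ≡ true) → count p ≤ count q + count r
count-∪ {p = p} {q} {r} h = begin
  count p  ≡⟨ count-sum p ⟩
  sumℕ (ind ∘ p)  ≤⟨ sumℕ-mono (λ i → ind-∨ (h i)) ⟩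
  sumℕ (λ i → ind (q i) + ind (r i))  ≡⟨ sumℕ-+ (ind ∘ q) (ind ∘ r) ⟩
  sumℕ (ind ∘ q) + sumℕ (ind ∘ r)  ≡⟨ sym (cong₂ _+_ (count-sum q) (count-sum r)) ⟩
  count q + count r  ∎
  where open ℕ.≤-Reasoning

count-only : ∀ {n} (p : Fin n → Bool) j → (∀ i → p i ≡ true → i ≡ j) → count p ≤ 1
count-only p zero h with p zero
... | true  = s≤s (ℕ.≤-reflexive (count-zero (p ∘ suc) (λ i → not-true (λ e → case h (suc i) e of λ ()))))
... | false = ℕ.≤-trans (ℕ.≤-reflexive (count-zero (p ∘ suc) (λ i → not-true (λ e → case h (suc i) e of λ ())))) z≤n
count-only p (suc j) h with p zero in eq
... | true  = case h zero eq of λ ()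
... | false = count-only (p ∘ suc) j (λ i e → Fin.suc-injective (h (suc i) e))

count-++ : ∀ a {b} (p : Fin (a + b) → Bool) → count p ≡ count (λ i → p (i ↑ˡ b)) + count (λ i → p (a ↑ʳ i))
count-++ zero    p = refl
count-++ (suc a) p with p zero
... | true  = cong suc (count-++ a (p ∘ suc))
... | false = count-++ a (p ∘ suc)

odd-suc : ∀ m → ¬ (2 ∣ m) → 2 ∣ suc m
odd-suc zero          h = ⊥-elim (h (2 ∣0))
odd-suc (suc zero)    h = ∣-refl
odd-suc (suc (suc m)) h = ∣m∣n⇒∣m+n ∣-refl (odd-suc m (λ d → h (∣m∣n⇒∣m+n ∣-refl d)))

even-suc : ∀ m → 2 ∣ m → ¬ (2 ∣ suc m)
even-suc m d e = case ∣1⇒≡1 (∣m+n∣m⇒∣n (subst (2 ∣_) (ℕ.+-comm 1 m) e) d) of λ ()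

count-parity : ∀ {n} (p : Fin n → Bool) → (par p ≡ false × Even (count p)) ⊎ (par p ≡ true × ¬ Even (count p))
count-parity {zero}  p = inj₁ (refl , 2 ∣0)
count-parity {suc n} p with p zero | count-parity (p ∘ suc)
... | false | r = r
... | true  | inj₁ (e , d) rewrite e = inj₂ (refl , even-suc _ d)
... | true  | inj₂ (e , d) rewrite e = inj₁ (refl , odd-suc _ d)

even⇒par : ∀ {n} (p : Fin n → Bool) → Even (count p) → par p ≡ false
even⇒par p d with count-parity p
... | inj₁ (e , _) = e
... | inj₂ (_ , h) = ⊥-elim (h d)

par⇒even : ∀ {n} (p : Fin n → Bool) → par p ≡ false → Even (count p)
par⇒even p e with count-parity p
... | inj₁ (_ , d) = d
... | inj₂ (e′ , _) = absurd e′ e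

-- Connected components of a finite symmetric relation

Linked : ∀ {n} → (Fin n → Fin n → Bool) → Fin n → Fin n → Set
Linked rel = Star (λ x y → rel x y ≡ true)

Linked-sym : ∀ {n} {rel : Fin n → Fin n → Bool} → (∀ x y → rel x y ≡ rel y x) → ∀ {x y} → Linked rel x y → Linked rel y x
Linked-sym s = reverse (λ {x} {y} e → trans (s y x) e)

-- Each class is named by one of its members, so that two elements are linked exactly if their
-- labels are equal; this makes connectivity a Boolean test on labels.
record Components {n} (rel : Fin n → Fin n → Bool) : Set where
  field
    label  : Fin n → Fin n
    linked : ∀ u → Linked rel u (label u)
    closed : ∀ u v → rel u v ≡ true → label u ≡ label v

  closed* : ∀ {u v} → Linked rel u v → label u ≡ label v
  closed* ε        = refl
  closed* (e ◅ es) = trans (closed _ _ e) (closed* es)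

-- Union-find: a new pair renames the class of `x` to that of `y`. The new label is a function of
-- the old one, so earlier identifications survive.
merge : ∀ {n} (rel : Fin n → Fin n → Bool) → (∀ x y → rel x y ≡ rel y x) →
  ∀ r (f : Fin r → Fin n × Fin n) → (∀ t → Linked rel (proj₁ (f t)) (proj₂ (f t))) →
  Σ (Fin n → Fin n) λ ℓ → (∀ u → Linked rel u (ℓ u)) × (∀ t → ℓ (proj₁ (f t)) ≡ ℓ (proj₂ (f t)))
merge rel rel-sym zero    f h = id , (λ u → ε) , λ ()
merge {n} rel rel-sym (suc r) f h with merge rel rel-sym r (f ∘ suc) (h ∘ suc)
... | ℓ , p , q = ℓ′ , p′ , q′
  where
  x = proj₁ (f zero)
  y = proj₂ (f zero)
  ℓ′ : Fin n → Fin n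
  ℓ′ u = if δ (ℓ u) (ℓ x) then ℓ y else ℓ u
  p′ : ∀ u → Linked rel u (ℓ′ u)
  p′ u with ℓ u ≟ ℓ x
  ... | yes e = p u ◅◅ subst (λ z → Linked rel z (ℓ y)) (sym e) (Linked-sym rel-sym (p x) ◅◅ h zero ◅◅ p y)
  ... | no _  = p u
  q′ : ∀ t → ℓ′ (proj₁ (f t)) ≡ ℓ′ (proj₂ (f t))
  q′ (suc t) = cong (λ z → if δ z (ℓ x) then ℓ y else z) (q t)
  q′ zero rewrite δ-refl (ℓ x) with ℓ y ≟ ℓ x
  ... | yes _ = refl
  ... | no _  = refl

abstract
  components : ∀ {n} (rel : Fin n → Fin n → Bool) → (∀ x y → rel x y ≡ rel y x) → Components rel
  components {n} rel rel-sym = record { label = ℓ ; linked = proj₁ (proj₂ merged) ; closed = closed }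
    where
    -- A pair that is not related is replaced by `(x , x)`, which merges nothing; so `merge` can run
    -- over all `n * n` index pairs.
    pair : Fin n × Fin n → Fin n × Fin n
    pair (x , y) = x , (if rel x y then y else x)

    pair-linked : ∀ z → Linked rel (proj₁ (pair z)) (proj₂ (pair z))
    pair-linked (x , y) with rel x y in eq
    ... | true  = eq ◅ ε
    ... | false = ε

    merged : Σ (Fin n → Fin n) λ ℓ → (∀ u → Linked rel u (ℓ u)) ×
      (∀ t → ℓ (proj₁ (pair (remQuot n t))) ≡ ℓ (proj₂ (pair (remQuot n t))))
    merged = merge rel rel-sym (n * n) (pair ∘ remQuot n) (pair-linked ∘ remQuot n)
    ℓ : Fin n → Fin n
    ℓ = proj₁ merged

    closed : ∀ u v → rel u v ≡ true → ℓ u ≡ ℓ v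
    closed u v e = subst (λ b → ℓ u ≡ ℓ (if b then v else u)) e
      (subst (λ z → ℓ (proj₁ (pair z)) ≡ ℓ (proj₂ (pair z))) (Fin.remQuot-combine u v) (proj₂ (proj₂ merged) (combine u v)))

sumℕ-cong : ∀ {n} {f g : Fin n → ℕ} → (∀ i → f i ≡ g i) → sumℕ f ≡ sumℕ g
sumℕ-cong {zero}  h = refl
sumℕ-cong {suc n} h = cong₂ _+_ (h zero) (sumℕ-cong (h ∘ suc))

sumℕ-0 : ∀ n → sumℕ {n} (λ _ → 0) ≡ 0
sumℕ-0 zero    = refl
sumℕ-0 (suc n) = sumℕ-0 n

sumℕ-comm : ∀ {m n} (f : Fin m → Fin n → ℕ) → sumℕ (λ i → sumℕ (f i)) ≡ sumℕ (λ j → sumℕ (λ i → f i j))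
sumℕ-comm {zero}  {n} f = sym (sumℕ-0 n)
sumℕ-comm {suc m} {n} f = trans (cong (sumℕ (f zero) +_) (sumℕ-comm (f ∘ suc))) (sym (sumℕ-+ (f zero) _))

-- Chains of virtual edges

Sub : ℕ → Set
Sub n = Fin n → Bool

-- The bilinear pairing over F₂. For an even `v`, that is, a demand, it tells whether `v` crosses
-- the cut between `X` and its complement.
dot : ∀ {n} → Sub n → Sub n → Bool
dot v X = par (λ a → v a ∧ X a)

dot-congˡ : ∀ {n} {v w : Sub n} (X : Sub n) → (∀ a → v a ≡ w a) → dot v X ≡ dot w X
dot-congˡ X h = par-cong (λ a → cong (_∧ X a) (h a))

dot-congʳ : ∀ {n} (v : Sub n) {X Y : Sub n} → (∀ a → v a ≡ true → X a ≡ Y a) → dot v X ≡ dot v Y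
dot-congʳ v {X} {Y} h = par-cong λ a → lemma (v a) (h a)
  where
  lemma : ∀ b {x y} → (b ≡ true → x ≡ y) → b ∧ x ≡ b ∧ y
  lemma true  e = e refl
  lemma false e = refl

dot-xor : ∀ {n} (v w X : Sub n) → dot (λ a → v a xor w a) X ≡ dot v X xor dot w X
dot-xor v w X = trans (par-cong (λ a → ∧-distribʳ-xor (X a) (v a) (w a))) (par-xor (λ a → v a ∧ X a) (λ a → w a ∧ X a))

dot-zero : ∀ {n} (v X : Sub n) → (∀ a → v a ≡ false) → dot v X ≡ false
dot-zero v X h = par-zero _ (λ a → cong (_∧ X a) (h a))

dot-const : ∀ {n} (v X : Sub n) b → (∀ a → v a ≡ true → X a ≡ b) → par v ≡ false → dot v X ≡ false
dot-const v X b h e = trans (dot-congʳ v h) (trans (sym (par-∧ʳ b v)) (cong (_∧ b) e))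

dot-δδ : ∀ {n} (x y : Fin n) (X : Sub n) → dot (λ a → δ x a xor δ y a) X ≡ X x xor X y
dot-δδ x y X = trans (dot-xor (δ x) (δ y) X) (cong₂ _xor_ (par-δ′ X x) (par-δ′ X y))

par-δ₁ : ∀ {n} (x : Fin n) → par (δ x) ≡ true
par-δ₁ x = trans (par-cong (λ a → sym (∧-identityʳ (δ x a)))) (par-δ′ (λ _ → true) x)

anyℕ : (ℕ → Bool) → ℕ → Bool
anyℕ P zero    = false
anyℕ P (suc l) = P l ∨ anyℕ P l

anyℕ-intro : ∀ P {l h} → h < l → P h ≡ true → anyℕ P l ≡ true
anyℕ-intro P {suc l} {h} (s≤s h≤l) e with ℕ.m≤n⇒m<n∨m≡n h≤l
... | inj₁ h<l  = ∨-introʳ (P l) (anyℕ-intro P h<l e)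
... | inj₂ refl = ∨-introˡ _ e

anyℕ-elim : ∀ P l → anyℕ P l ≡ true → ∃ λ h → h < l × P h ≡ true
anyℕ-elim P (suc l) e with ∨-elim {P l} e
... | inj₁ p = l , ℕ.≤-refl , p
... | inj₂ q = let (h , h<l , p) = anyℕ-elim P l q in h , ℕ.m≤n⇒m≤1+n h<l , p

largest : ∀ (Q : ℕ → Bool) l → (∃ λ j → j ≤ l × Q j ≡ true × (∀ i → i ≤ l → Q i ≡ true → i ≤ j)) ⊎ (∀ i → i ≤ l → Q i ≡ false)
largest Q l with dichotomy (Q l)
largest Q l       | inj₁ e = inj₁ (l , ℕ.≤-refl , e , λ i i≤l _ → i≤l)
largest Q zero    | inj₂ e = inj₂ λ { .zero z≤n → e }
largest Q (suc l) | inj₂ e with largest Q l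
... | inj₁ (j , j≤l , p , m) = inj₁ (j , ℕ.m≤n⇒m≤1+n j≤l , p , λ i i≤ q → case ℕ.m≤n⇒m<n∨m≡n i≤ of λ { (inj₁ (s≤s i≤l)) → m i i≤l q ; (inj₂ refl) → absurd q e })
... | inj₂ none = inj₂ λ i i≤ → case ℕ.m≤n⇒m<n∨m≡n i≤ of λ { (inj₁ (s≤s i≤l)) → none i i≤l ; (inj₂ refl) → e }

module Chains {n s : ℕ} (A : Fin s → Sub n) where

  Chain : Set
  Chain = Fin s → Sub n

  -- A piece acts as a hyperedge on its terminals: the coordinate `w i` records only the odd
  -- terminals, so it is an edge set of the clique on `A i` modulo the cycles of that clique.
  record IsChain (w : Chain) : Set where
    field
      inside : ∀ i a → w i a ≡ true → A i a ≡ true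
      even   : ∀ i → par (w i) ≡ false
  open IsChain public

  ∂ : Chain → Sub n
  ∂ w a = par (λ i → w i a)

  infixl 6 _⊞_
  _⊞_ : Chain → Chain → Chain
  (w ⊞ w′) i a = w i a xor w′ i a

  𝟎 : Chain
  𝟎 i a = false

  IsCycle : Chain → Set
  IsCycle w = IsChain w × (∀ a → ∂ w a ≡ false)

  record Joins (w : Chain) (x y : Fin n) : Set where
    constructor _,_
    field
      chain    : IsChain w
      boundary : ∀ a → ∂ w a ≡ δ x a xor δ y a
  open Joins public

  ∂-⊞ : ∀ w w′ a → ∂ (w ⊞ w′) a ≡ ∂ w a xor ∂ w′ a
  ∂-⊞ w w′ a = par-xor (λ i → w i a) (λ i → w′ i a)

  ∂-𝟎 : ∀ a → ∂ 𝟎 a ≡ false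
  ∂-𝟎 a = par-zero {s} (λ _ → false) (λ _ → refl)

  ∂-dot : ∀ w S → dot (∂ w) S ≡ par (λ i → dot (w i) S)
  ∂-dot w S = trans (par-cong (λ a → par-∧ʳ (S a) (λ i → w i a))) (par-comm (λ a i → w i a ∧ S a))

  𝟎-chain : IsChain 𝟎
  𝟎-chain = record { inside = λ _ _ () ; even = λ i → par-zero {n} _ (λ _ → refl) }

  ⊞-chain : ∀ {w w′} → IsChain w → IsChain w′ → IsChain (w ⊞ w′)
  ⊞-chain {w} {w′} p q = record
    { inside = λ i a e → case dichotomy (w i a) of λ where
        (inj₁ t) → inside p i a t
        (inj₂ f) → inside q i a (subst (λ b → b xor w′ i a ≡ true) f e)
    ; even = λ i → trans (par-xor (w i) (w′ i)) (cong₂ _xor_ (even p i) (even q i)) }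

  𝟎-cycle : IsCycle 𝟎
  𝟎-cycle = 𝟎-chain , ∂-𝟎

  ⊞-cycle : ∀ {w w′} → IsCycle w → IsCycle w′ → IsCycle (w ⊞ w′)
  ⊞-cycle {w} {w′} (p , p′) (q , q′) = ⊞-chain p q , λ a → trans (∂-⊞ w w′ a) (cong₂ _xor_ (p′ a) (q′ a))

  dot-⊞ : ∀ (w w′ : Chain) i X → dot ((w ⊞ w′) i) X ≡ dot (w i) X xor dot (w′ i) X
  dot-⊞ w w′ i X = dot-xor (w i) (w′ i) X

  dot-𝟎 : ∀ i X → dot (𝟎 i) X ≡ false
  dot-𝟎 i X = dot-zero (𝟎 i) X (λ _ → refl)

  Joins-refl : ∀ x → Joins 𝟎 x x
  Joins-refl x = 𝟎-chain , λ a → trans (∂-𝟎 a) (sym (xor-same (δ x a)))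

  Joins-trans : ∀ {w w′ x y z} → Joins w x y → Joins w′ y z → Joins (w ⊞ w′) x z
  Joins-trans {w} {w′} {x} {y} {z} (p , p′) (q , q′) = ⊞-chain p q , λ a →
    trans (∂-⊞ w w′ a) (trans (cong₂ _xor_ (p′ a) (q′ a)) (taut 3 (λ x y z → (x xor y) xor (y xor z)) (λ x y z → x xor z) (δ x a)
        (δ y a) (δ z a)))

  Joins-cycle : ∀ {w w′ x y} → Joins w x y → Joins w′ x y → IsCycle (w ⊞ w′)
  Joins-cycle {w} {w′} {x} {y} (p , p′) (q , q′) = ⊞-chain p q , λ a →
    trans (∂-⊞ w w′ a) (trans (cong₂ _xor_ (p′ a) (q′ a)) (xor-same (δ x a xor δ y a)))

  -- The virtual edge between `x` and `y` that piece `i` provides.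
  hop : Fin s → Fin n → Fin n → Chain
  hop i x y j a = δ j i ∧ (δ x a xor δ y a)

  hop-chain : ∀ {i x y} → A i x ≡ true → A i y ≡ true → IsChain (hop i x y)
  hop-chain {i} {x} {y} p q = record { inside = ins ; even = ev }
    where
    ins : ∀ j a → hop i x y j a ≡ true → A j a ≡ true
    ins j a e with ∧-elim {δ j i} e
    ... | ji , e′ with δ-true {i = j} ji | dichotomy (δ x a)
    ... | refl | inj₁ t = subst (λ z → A j z ≡ true) (δ-true {i = x} t) p
    ... | refl | inj₂ f = subst (λ z → A j z ≡ true) (δ-true {i = y} (subst (λ b → b xor δ y a ≡ true) f e′)) q
    ev : ∀ j → par (hop i x y j) ≡ false
    ev j = trans (sym (par-∧ˡ (δ j i) (λ a → δ x a xor δ y a)))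
      (trans (cong (δ j i ∧_) (trans (par-xor (δ x) (δ y)) (trans (cong₂ _xor_ (par-δ₁ x) (par-δ₁ y)) refl))) (∧-zeroʳ (δ j i)))

  hop-joins : ∀ {i x y} → A i x ≡ true → A i y ≡ true → Joins (hop i x y) x y
  hop-joins {i} {x} {y} p q = hop-chain p q , λ a → par-δ (λ _ → δ x a xor δ y a) i

  hop-dot : ∀ i x y j X → dot (hop i x y j) X ≡ δ j i ∧ (X x xor X y)
  hop-dot i x y j X = trans (par-cong (λ a → ∧-assoc (δ j i) (δ x a xor δ y a) (X a)))
    (trans (sym (par-∧ˡ (δ j i) (λ a → (δ x a xor δ y a) ∧ X a))) (cong (δ j i ∧_) (dot-δδ x y X)))

  meets : Fin n → Fin n → Bool
  meets x y = anyF (λ i → A i x ∧ A i y)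

  meets-sym : ∀ x y → meets x y ≡ meets y x
  meets-sym x y = same-truth (f x y) (f y x)
    where
    f : ∀ x y → meets x y ≡ true → meets y x ≡ true
    f x y e = let (i , p) = anyF-elim _ e in anyF-intro _ i (trans (∧-comm (A i y) (A i x)) p)

  -- A component of meets is a cut crossed by no coordinate, so it contains both ends of a joining chain.
  joins⇒linked : ∀ {w x y} → Joins w x y → Linked meets x y
  joins⇒linked {w} {x} {y} (p , p′) = linked x ◅◅ subst (λ z → Linked meets z y) (sym same) (Linked-sym meets-sym (linked y))
    where
    open Components (components meets meets-sym)
    S : Sub n
    S a = δ (label a) (label x)
    crossing : ∀ i → dot (w i) S ≡ false
    crossing i with dichotomy (anyF (w i))
    ... | inj₂ none = dot-zero (w i) S (anyF-none (w i) none)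
    ... | inj₁ some with anyF-elim (w i) some
    ... | b , wb = dot-const (w i) S (S b)
      (λ a wa → cong (λ z → δ z (label x)) (closed a b (anyF-intro _ i (∧-intro (inside p i a wa) (inside p i b wb))))) (even p i)
    same : label x ≡ label y
    same = sym (δ-true (sym (xor-cancel {true} {S y} (trans (cong (_xor S y) (sym (δ-refl (label x))))
      (trans (sym (dot-δδ x y S)) (trans (sym (dot-congˡ S p′)) (trans (∂-dot w S) (par-zero _ crossing))))))))

-- Covering the non-bridges of a path by two cycles

-- The set `Xs i` splits the terminals of piece `i` into two sides. Once all moves within a side are
-- contracted, every piece is at most one edge of an ordinary graph, `trace i w` tells whether `w`
-- uses that edge, and cycles of chains become cycles of this graph.
module Cover {n s : ℕ} (A : Fin s → Sub n) (Xs : Fin s → Sub n) where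
  open Chains A

  trace : Fin s → Chain → Bool
  trace i w = dot (w i) (Xs i)

  trace-⊞ : ∀ i w w′ → trace i (w ⊞ w′) ≡ trace i w xor trace i w′
  trace-⊞ i w w′ = dot-⊞ w w′ i (Xs i)

  trace-𝟎 : ∀ i → trace i 𝟎 ≡ false
  trace-𝟎 i = dot-𝟎 i (Xs i)

  crosses : Fin s → Fin n → Fin n → Bool
  crosses i x y = Xs i x xor Xs i y

  -- In the contracted graph, these are the moves that use no edge from `on`; the other edges may be
  -- traversed.
  moves : (Fin s → Bool) → Fin n → Fin n → Bool
  moves on x y = anyF (λ i → (A i x ∧ A i y) ∧ not (on i ∧ crosses i x y))

  free : Fin n → Fin n → Bool
  free = moves (λ _ → true)

  free-intro : ∀ i {x y} → A i x ≡ true → A i y ≡ true → crosses i x y ≡ false → free x y ≡ true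
  free-intro i p q e = anyF-intro _ i (∧-intro (∧-intro p q) (cong not e))

  -- A walk alternating between free moves and crossings v h → y h of pairwise distinct coordinates c h, h < len.
  record Path (w z : Fin n) : Set where
    field
      len      : ℕ
      v y      : ℕ → Fin n
      c        : ℕ → Fin s
      at-v     : ∀ {h} → h < len → A (c h) (v h) ≡ true
      at-y     : ∀ {h} → h < len → A (c h) (y h) ≡ true
      crossing : ∀ {h} → h < len → crosses (c h) (v h) (y h) ≡ true
      next     : ∀ {h} → h < len → Linked free (y h) (v (suc h))
      start    : Linked free w (v 0)
      end      : v len ≡ z
      distinct : ∀ {h h′} → h < len → h′ < len → c h ≡ c h′ → h ≡ h′

  shift : ∀ {w z} (π : Path w z) {h} → h < Path.len π → Path (Path.y π h) z
  shift π {h} h<l = record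
    { len = len ∸ suc h ; v = λ j → v (suc h + j) ; y = λ j → y (suc h + j) ; c = λ j → c (suc h + j)
    ; at-v = at-v ∘ after ; at-y = at-y ∘ after ; crossing = crossing ∘ after
    ; next = λ {j} l → subst (λ t → Linked free (y (suc h + j)) (v t)) (sym (ℕ.+-suc (suc h) j)) (next (after l))
    ; start = subst (λ t → Linked free (y h) (v t)) (sym (ℕ.+-identityʳ (suc h))) (next h<l)
    ; end = trans (cong v (ℕ.m+[n∸m]≡n h<l)) end
    ; distinct = λ p q e → ℕ.+-cancelˡ-≡ (suc h) _ _ (distinct (after p) (after q) e) }
    where
    open Path π
    after : ∀ {j} → j < len ∸ suc h → suc h + j < len
    after {j} l = subst (suc h + j <_) (ℕ.m+[n∸m]≡n h<l) (ℕ.+-monoʳ-< (suc h) l)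

  prepend : ∀ {z} i {x y} → A i x ≡ true → A i y ≡ true → crosses i x y ≡ true →
    (π : Path y z) → (∀ {h} → h < Path.len π → i ≢ Path.c π h) → Path x z
  prepend i {x} {y₀} p q e π new = record
    { len = suc len ; v = λ { zero → x ; (suc h) → v h } ; y = λ { zero → y₀ ; (suc h) → y h } ; c = c′
    ; at-v = λ { {zero} _ → p ; {suc h} (s≤s l) → at-v l }
    ; at-y = λ { {zero} _ → q ; {suc h} (s≤s l) → at-y l }
    ; crossing = λ { {zero} _ → e ; {suc h} (s≤s l) → crossing l }
    ; next = λ { {zero} _ → start ; {suc h} (s≤s l) → next l }
    ; start = ε ; end = end ; distinct = distinct′ }
    where
    open Path π
    c′ : ℕ → Fin s
    c′ zero    = i
    c′ (suc h) = c h
    distinct′ : ∀ {h h′} → h < suc len → h′ < suc len → c′ h ≡ c′ h′ → h ≡ h′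
    distinct′ {zero}  {zero}   _ _ _ = refl
    distinct′ {zero}  {suc h′} _ (s≤s l) eq = ⊥-elim (new l eq)
    distinct′ {suc h} {zero}   (s≤s l) _ eq = ⊥-elim (new l (sym eq))
    distinct′ {suc h} {suc h′} (s≤s l) (s≤s l′) eq = cong suc (distinct l l′ eq)

  restart : ∀ {x y z} → Linked free x y → Path y z → Path x z
  restart f π = record { Path π ; start = f ◅◅ Path.start π }

  -- Loop erasure: if coordinate i is crossed again later, jump directly to that crossing, which is then either
  -- reversed (and both crossings disappear) or repeated (and one of them suffices).
  extend : ∀ {z} i {x y} → A i x ≡ true → A i y ≡ true → Path y z → Path x z
  extend i {x} {y₀} p q π with dichotomy (crosses i x y₀)
  ... | inj₂ e = restart (free-intro i p q e ◅ ε) π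
  ... | inj₁ e with dichotomy (anyℕ (λ h → δ i (Path.c π h)) (Path.len π))
  ... | inj₂ none = prepend i p q e π λ l eq → absurd (anyℕ-intro _ l (subst (λ z → δ i z ≡ true) eq (δ-refl i))) none
  ... | inj₁ some with anyℕ-elim (λ h → δ i (Path.c π h)) (Path.len π) some
  ... | h , h<l , eq with δ-true {i = i} eq
  ... | refl with dichotomy (crosses i x (Path.v π h))
  ... | inj₂ same = prepend i p (at-y h<l) (trans (cong (_xor Xs i (y h)) (xor-cancel {Xs i x} same)) (crossing h<l)) (shift π h<l)
          λ {j} l ceq → contradiction (distinct h<l (after l) ceq) (ℕ.<⇒≢ (ℕ.m≤m+n (suc h) j))
    where
    open Path π
    after : ∀ {j} → j < len ∸ suc h → suc h + j < len
    after {j} l = subst (suc h + j <_) (ℕ.m+[n∸m]≡n h<l) (ℕ.+-monoʳ-< (suc h) l)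
  ... | inj₁ opposite = restart (free-intro i p (at-y h<l) back ◅ ε) (shift π h<l)
    where
    open Path π
    back : crosses i x (y h) ≡ false
    back = trans (taut 3 (λ a b c → a xor c) (λ a b c → (a xor b) xor (b xor c)) (Xs i x) (Xs i (v h)) (Xs i (y h)))
        (cong₂ _xor_ opposite (crossing h<l))

  path : ∀ {x z} → Linked meets x z → x ≡ z ⊎ Path x z
  path ε = inj₁ refl
  path {z = z} (e ◅ es) with anyF-elim _ e
  ... | i , p with path es
  ...   | inj₂ π    = inj₂ (extend i (proj₁ (∧-elim p)) (proj₂ (∧-elim p)) π)
  ...   | inj₁ refl = inj₂ (extend i (proj₁ (∧-elim p)) (proj₂ (∧-elim p)) record
    { len = 0 ; v = λ _ → z ; y = λ _ → z ; c = λ _ → i ; at-v = λ () ; at-y = λ () ; crossing = λ () ; next = λ ()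
    ; start = ε ; end = refl ; distinct = λ () })

  -- The first case of `covers` says that `i` is a bridge. What matters is that two cycles serve a
  -- path of any length, so that the number of correctors below does not depend on the size of the
  -- torso.
  record Covering (a z : Fin n) : Set where
    field
      connect  : Chain
      joins    : Joins connect a z
      ζ₁ ζ₂    : Chain
      ζ₁-cycle : IsCycle ζ₁
      ζ₂-cycle : IsCycle ζ₂
      covers   : ∀ i → trace i connect ≡ true →
        (∀ w → IsCycle w → trace i w ≡ false) ⊎ trace i ζ₁ ≡ true ⊎ trace i ζ₂ ≡ true

  moves-chain : ∀ on {x y} → Linked (moves on) x y → ∃ λ w → Joins w x y × (∀ j → on j ≡ true → trace j w ≡ false)
  moves-chain on {x} ε = 𝟎 , Joins-refl x , λ j _ → trace-𝟎 j
  moves-chain on {x} (_◅_ {j = b} e es) with anyF-elim _ e | moves-chain on es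
  ... | i , p | w , J , t = hop i x b ⊞ w , Joins-trans (hop-joins (proj₁ (∧-elim p₁)) (proj₂ (∧-elim p₁))) J , λ j o →
    trans (trace-⊞ j (hop i x b) w) (cong₂ _xor_ (trans (hop-dot i x b j (Xs j)) (even-side j o)) (t j o))
    where
    p₁ = proj₁ (∧-elim {A i x ∧ A i b} p)
    same : on i ∧ crosses i x b ≡ false
    same = trans (sym (not-involutive _)) (cong not (proj₂ (∧-elim {A i x ∧ A i b} p)))
    even-side : ∀ j → on j ≡ true → δ j i ∧ crosses j x b ≡ false
    even-side j o with j ≟ i
    ... | yes refl = trans (cong (_∧ crosses j x b) (sym o)) same
    ... | no _     = refl

  free-chain : ∀ {x y} → Linked free x y → ∃ λ w → Joins w x y × (∀ j → trace j w ≡ false)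
  free-chain f = let (w , J , t) = moves-chain (λ _ → true) f in w , J , λ j → t j refl

  module Along {a z : Fin n} (π : Path a z) where
    open Path π

    on : Fin s → Bool
    on j = anyℕ (λ h → δ j (c h)) len

    on-c : ∀ {h} → h < len → on (c h) ≡ true
    on-c {h} l = anyℕ-intro _ l (δ-refl (c h))

    -- The contracted graph with the edges of the path deleted. Two positions of the path in one
    -- component of it can be joined while avoiding all edges of the path.
    off : Fin n → Fin n → Bool
    off = moves on

    off-intro : ∀ j {x y} → A j x ≡ true → A j y ≡ true → on j ∧ crosses j x y ≡ false → off x y ≡ true
    off-intro j p q e = anyF-intro _ j (∧-intro (∧-intro p q) (cong not e))

    off-sym : ∀ x y → off x y ≡ off y x
    off-sym x y = same-truth (f x y) (f y x)
      where
      f : ∀ x y → off x y ≡ true → off y x ≡ true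
      f x y e = let (j , p) = anyF-elim _ e in anyF-intro _ j (trans (cong₂ (λ b d → b ∧ not (on j ∧ d)) (∧-comm (A j y) (A j x)) (xor-comm (Xs j y) (Xs j x))) p)

    free⇒off : ∀ {x y} → free x y ≡ true → off x y ≡ true
    free⇒off {x} {y} e with anyF-elim _ e
    ... | i , p with ∧-elim {A i x ∧ A i y} p
    ... | p₁ , p₂ = anyF-intro _ i (∧-intro p₁ (taut′ (on i) p₂))
      where
      taut′ : ∀ b {d} → not d ≡ true → not (b ∧ d) ≡ true
      taut′ true  e = e
      taut′ false e = refl

    open Components (components off off-sym)

    label-free : ∀ {x y} → Linked free x y → label x ≡ label y
    label-free f = closed* (mapStar free⇒off f)

    Within : ℕ → ℕ → Chain → Set
    Within i j w = (∀ k → trace k w ≡ true → ∃ λ h → i ≤ h × h < j × c h ≡ k) × (∀ {h} → i ≤ h → h < j → trace (c h) w ≡ true)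

    segment : ∀ {i j} → i ℕ.≤′ j → j ≤ len → ∃ λ w → Joins w (v i) (v j) × Within i j w
    segment {i} ℕ.≤′-refl _ = 𝟎 , Joins-refl (v i) , (λ k t → absurd t (trace-𝟎 k)) , λ p q → contradiction p (ℕ.<⇒≱ q)
    segment {i} (ℕ.≤′-step {j} l) j<len with segment l (ℕ.<⇒≤ j<len) | free-chain (next j<len)
    ... | w , J , only , all | f , F , none = w ⊞ σ , Joins-trans J (Joins-trans (hop-joins (at-v j<len) (at-y j<len)) F) , only′ , all′
      where
      σ = hop (c j) (v j) (y j) ⊞ f
      σ-trace : ∀ k → trace k σ ≡ δ k (c j)
      σ-trace k = trans (trace-⊞ k (hop (c j) (v j) (y j)) f)
        (trans (cong₂ _xor_ (trans (hop-dot (c j) (v j) (y j) k (Xs k)) (at k)) (none k)) (xor-identityʳ _))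
        where
        at : ∀ k → δ k (c j) ∧ crosses k (v j) (y j) ≡ δ k (c j)
        at k with k ≟ c j
        ... | yes refl = crossing j<len
        ... | no _     = refl
      only′ : ∀ k → trace k (w ⊞ σ) ≡ true → ∃ λ h → i ≤ h × h < suc j × c h ≡ k
      only′ k t with dichotomy (trace k w)
      ... | inj₁ tw = let (h , p , q , e) = only k tw in h , p , ℕ.m≤n⇒m≤1+n q , e
      ... | inj₂ fw = j , ℕ.≤′⇒≤ l , ℕ.≤-refl , sym (δ-true {i = k}
              (trans (sym (σ-trace k)) (trans (cong (_xor trace k σ) (sym fw)) (trans (sym (trace-⊞ k w σ)) t))))
      all′ : ∀ {h} → i ≤ h → h < suc j → trace (c h) (w ⊞ σ) ≡ true
      all′ {h} p (s≤s q) with ℕ.m≤n⇒m<n∨m≡n q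
      ... | inj₁ h<j = trans (trace-⊞ (c h) w σ) (cong₂ _xor_ (all p h<j)
              (trans (σ-trace (c h)) (δ-≢ {i = c h} λ e → ℕ.<⇒≢ h<j (distinct (ℕ.<-trans h<j j<len) j<len e))))
      ... | inj₂ refl = trans (trace-⊞ (c h) w σ) (cong₂ _xor_ (not-true λ t →
              let (h′ , _ , h′<j , e) = only (c h) t in ℕ.<⇒≢ h′<j (distinct (ℕ.<-trans h′<j j<len) j<len e))
              (trans (σ-trace (c h)) (δ-refl (c h))))

    -- An `off` walk has zero trace at all coordinates of the path, so closing the segment from
    -- `v i` to `v j` by such a walk gives a cycle whose trace along the path is exactly this
    -- segment.
    detour : ∀ {i j} → i ≤ j → j ≤ len → label (v i) ≡ label (v j) → ∃ λ w → IsCycle w ×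
      (∀ {h} → h < len → h < i → trace (c h) w ≡ false) × (∀ {h} → i ≤ h → h < j → trace (c h) w ≡ true) ×
          (∀ {h} → h < len → j ≤ h → trace (c h) w ≡ false)
    detour {i} {j} i≤j j≤l eq with segment (ℕ.≤⇒≤′ i≤j) j≤l
      | moves-chain on (linked (v i) ◅◅ subst (λ z → Linked off z (v j)) (sym eq) (Linked-sym off-sym (linked (v j))))
    ... | w , J , only , all | f , F , none = w ⊞ f , Joins-cycle J F , (λ h<l h<i → outside h<l λ p → ℕ.<⇒≱ h<i (proj₁ p)) ,
      (λ p q → trans (trace-⊞ _ w f) (cong₂ _xor_ (all p q) (none _ (on-c (ℕ.<-≤-trans q j≤l))))) ,
      λ h<l j≤h → outside h<l λ p → ℕ.<⇒≱ (proj₂ p) j≤h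
      where
      outside : ∀ {h} → h < len → ¬ (i ≤ h × h < j) → trace (c h) (w ⊞ f) ≡ false
      outside {h} h<l out = trans (trace-⊞ (c h) w f) (cong₂ _xor_ (not-true λ t →
        let (h′ , p , q , e) = only (c h) t ; h≡ = distinct (ℕ.<-≤-trans q j≤l) h<l e in out (subst (λ m → i ≤ m × m < j) h≡ (p , q))) (none _ (on-c h<l)))

    Straddled : ℕ → Set
    Straddled g = ∃ λ i → ∃ λ j → i ≤ g × g < j × j ≤ len × label (v i) ≡ label (v j)

    Reach : ℕ → ℕ → Set
    Reach g f = ∀ i j → i ≤ g → j ≤ len → label (v i) ≡ label (v j) → j ≤ f

    reached : ℕ → Fin n → Bool
    reached g u = anyℕ (λ i → δ (label u) (label (v i))) (suc g)

    reached-intro : ∀ {g i u} → i ≤ g → label u ≡ label (v i) → reached g u ≡ true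
    reached-intro {g} {i} {u} i≤g e = anyℕ-intro _ (s≤s i≤g) (subst (λ z → δ (label u) z ≡ true) e (δ-refl (label u)))

    reached-elim : ∀ {g u} → reached g u ≡ true → ∃ λ i → i ≤ g × label u ≡ label (v i)
    reached-elim {g} {u} e with anyℕ-elim (λ i → δ (label u) (label (v i))) (suc g) e
    ... | i , s≤s i≤g , p = i , i≤g , δ-true p

    -- `f` is the farthest position whose component is met at or before `g`. This maximality is what
    -- keeps every second detour of the greedy sequence disjoint.
    straddled? : ∀ g → (∃ λ f → g < f × f ≤ len × (∃ λ i → i ≤ g × label (v i) ≡ label (v f)) ×
        Reach g f)
      ⊎ Reach g g
    straddled? g with largest (λ j → reached g (v j)) len
    ... | inj₂ none = inj₂ λ i j i≤g j≤l e → absurd (reached-intro i≤g (sym e)) (none j j≤l)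
    ... | inj₁ (f , f≤l , r , max) with g ℕ.<? f | reached-elim r
    ... | yes g<f | i , i≤g , e = inj₁ (f , g<f , f≤l , (i , i≤g , sym e) , λ i j i≤g j≤l e → max j j≤l (reached-intro i≤g (sym e)))
    ... | no g≮f  | _ = inj₂ λ i j i≤g j≤l e → ℕ.≤-trans (max j j≤l (reached-intro i≤g (sym e))) (ℕ.≮⇒≥ g≮f)

    -- If no detour jumps over gap g, the components reached up to v g form a cut whose only crossed coordinate is c g.
    bridge : ∀ {g} → g < len → Reach g g → ∀ w → IsCycle w → trace (c g) w ≡ false
    bridge {g} g<l none w (W , ∂w) = trans (sym at-g) (trans (sym (par-only _ (c g) others))
        (trans (sym (∂-dot w S)) (dot-zero (∂ w) S ∂w)))
      where
      S : Sub n
      S = reached g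

      S-label : ∀ {u u′} → label u ≡ label u′ → S u ≡ S u′
      S-label e = cong (λ z → anyℕ (λ i → δ z (label (v i))) (suc g)) e

      before : ∀ {i} → i ≤ g → S (v i) ≡ true
      before i≤g = reached-intro i≤g refl

      beyond : ∀ {j} → g < j → j ≤ len → S (v j) ≡ false
      beyond g<j j≤l = not-true λ e → let (i , i≤g , p) = reached-elim e in ℕ.<⇒≱ g<j (none i _ i≤g j≤l (sym p))

      -- A terminal on the side of `v j` is a free move away from `v j`; one on the other side is a
      -- free move away from `y j`, which is linked to `v (suc j)`.
      sides : ∀ {j} → j < len → ∀ a → w (c j) a ≡ true → S a ≡ (if crosses (c j) a (v j) then S (v (suc j)) else S (v j))
      sides {j} j<l a wa with dichotomy (crosses (c j) a (v j))
      ... | inj₂ f = trans (S-label (closed _ _ (free⇒off (free-intro (c j) (inside W (c j) a wa) (at-v j<l) f))))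
              (cong (λ b → if b then _ else S (v j)) (sym f))
      ... | inj₁ t = trans (S-label (trans (closed _ _ (free⇒off (free-intro (c j) (inside W (c j) a wa) (at-y j<l)
              (trans (taut 3 (λ x y z → x xor z) (λ x y z → (x xor y) xor (y xor z)) (Xs (c j) a) (Xs (c j) (v j)) (Xs (c j) (y j)))
                  (cong₂ _xor_ t (crossing j<l))))))
              (label-free (next j<l)))) (cong (λ b → if b then S (v (suc j)) else _) (sym t))

      others : ∀ j → j ≢ c g → dot (w j) S ≡ false
      others j j≢ with dichotomy (on j)
      others j j≢ | inj₂ o with dichotomy (anyF (w j))
      ... | inj₂ empty = dot-zero (w j) S (anyF-none (w j) empty)
      ... | inj₁ some = let (b , wb) = anyF-elim (w j) some in dot-const (w j) S (S b)
        (λ a wa → S-label (closed a b (off-intro j (inside W j a wa) (inside W j b wb) (cong (_∧ crosses j a b) o)))) (even W j)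
      others j j≢ | inj₁ o with anyℕ-elim (λ h → δ j (c h)) len o
      ... | h , h<l , e with δ-true {i = j} e
      ... | refl with ℕ.<-cmp h g
      ... | tri≈ _ refl _ = contradiction refl j≢
      ... | tri< h<g _ _ = dot-const (w j) S true (λ a wa → trans (sides h<l a wa)
              (trans (cong₂ (λ p q → if crosses j a (v h) then p else q) (before h<g) (before (ℕ.<⇒≤ h<g)))
                  (Bool.if-eta (crosses j a (v h))))) (even W j)
      ... | tri> _ _ g<h = dot-const (w j) S false (λ a wa → trans (sides h<l a wa)
              (trans (cong₂ (λ p q → if crosses j a (v h) then p else q) (beyond (ℕ.m<n⇒m<1+n g<h) h<l) (beyond g<h (ℕ.<⇒≤ h<l)))
                  (Bool.if-eta (crosses j a (v h))))) (even W j)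

      -- On the terminals in `w (c g)`, the set `S` is the section or its complement, and an even
      -- set has the same parity on both.
      at-g : dot (w (c g)) S ≡ trace (c g) w
      at-g = trans (dot-congʳ (w (c g)) {S} {λ a → Xs (c g) a xor not (Xs (c g) (v g))} (λ a wa → trans (sides g<l a wa)
          (trans (cong₂ (λ p q → if crosses (c g) a (v g) then p else q) (beyond ℕ.≤-refl g<l) (before ℕ.≤-refl))
            (if-not (crosses (c g) a (v g))  ⟨ trans ⟩ taut 2 (λ x y → not (x xor y)) (λ x y → x xor not y) (Xs (c g) a)
                (Xs (c g) (v g))))))
        (trans (par-cong (λ a → ∧-distribˡ-xor (w (c g) a) (Xs (c g) a) (not (Xs (c g) (v g)))))
          (trans (par-xor (λ a → w (c g) a ∧ Xs (c g) a) (λ a → w (c g) a ∧ not (Xs (c g) (v g))))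
            (trans (cong (trace (c g) w xor_) (trans (sym (par-∧ʳ (not (Xs (c g) (v g))) (w (c g))))
                (cong (_∧ not (Xs (c g) (v g))) (even W (c g))))) (xor-identityʳ _))))
        where
        if-not : ∀ b → (if b then false else true) ≡ not b
        if-not true  = refl
        if-not false = refl

    -- ζᵃ and ζᵇ are the sums of the odd and of the even members of a greedy sequence of detours, each reaching as far
    -- as possible; avoidᵃ and avoidᵇ make every second detour disjoint, so that nothing cancels.
    record Greedy (g : ℕ) : Set where
      field
        ζᵃ ζᵇ    : Chain
        ζᵃ-cycle : IsCycle ζᵃ
        ζᵇ-cycle : IsCycle ζᵇ
        covered  : ∀ {h} → g ≤ h → h < len → Straddled h → trace (c h) ζᵃ ≡ true ⊎ trace (c h) ζᵇ ≡ true
        avoidᵃ   : ∀ {h} → h < g → Reach h g →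
                   ∀ {h′} → h′ ≤ h → h′ < len → trace (c h′) ζᵃ ≡ false
        avoidᵇ   : ∀ {h} → h ≤ g → h < len → trace (c h) ζᵇ ≡ false

    greedy : ∀ d g → len ≤ g + d → Greedy g
    greedy zero g l≤g = record
      { ζᵃ = 𝟎 ; ζᵇ = 𝟎 ; ζᵃ-cycle = 𝟎-cycle ; ζᵇ-cycle = 𝟎-cycle
      ; covered = λ g≤h h<l _ → contradiction (ℕ.≤-trans (subst (len ≤_) (ℕ.+-identityʳ g) l≤g) g≤h) (ℕ.<⇒≱ h<l)
      ; avoidᵃ = λ _ _ {h′} _ _ → trace-𝟎 (c h′) ; avoidᵇ = λ {h} _ _ → trace-𝟎 (c h) }
    greedy (suc d) g l≤g+d with straddled? g
    ... | inj₂ none = record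
      { ζᵃ = ζᵃ ; ζᵇ = ζᵇ ; ζᵃ-cycle = ζᵃ-cycle ; ζᵇ-cycle = ζᵇ-cycle
      ; covered = λ g≤h h<l S → case ℕ.m≤n⇒m<n∨m≡n g≤h of λ where
          (inj₁ g<h)  → covered g<h h<l S
          (inj₂ refl) → let (i , j , i≤g , g<j , j≤l , e) = S in contradiction (none i j i≤g j≤l e) (ℕ.<⇒≱ g<j)
      ; avoidᵃ = λ h<g m → avoidᵃ (ℕ.m<n⇒m<1+n h<g) (λ i j p q e → ℕ.m≤n⇒m≤1+n (m i j p q e))
      ; avoidᵇ = λ h≤g → avoidᵇ (ℕ.m≤n⇒m≤1+n h≤g) }
      where open Greedy (greedy d (suc g) (subst (len ≤_) (ℕ.+-suc g d) l≤g+d))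
    ... | inj₁ (f , g<f , f≤l , (i , i≤g , e) , max) with detour (ℕ.≤-trans i≤g (ℕ.<⇒≤ g<f)) f≤l e
    -- The two chains of the recursive call swap roles. Its `ζᵇ` has zero trace on all gaps up to
    -- `f`, and `D` is odd only on gaps before `f`, so adding `D` cancels nothing.
    ... | D , D-cycle , low , mid , high = record
      { ζᵃ = D ⊞ ζᵇ ; ζᵇ = ζᵃ ; ζᵃ-cycle = ⊞-cycle D-cycle ζᵇ-cycle ; ζᵇ-cycle = ζᵃ-cycle
      ; covered = covered′ ; avoidᵃ = avoidᵃ′ ; avoidᵇ = λ h≤g h<l → avoidᵃ g<f max h≤g h<l }
      where
      open Greedy (greedy d f (ℕ.≤-trans (subst (len ≤_) (ℕ.+-suc g d) l≤g+d) (ℕ.+-monoˡ-≤ d g<f)))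
      covered′ : ∀ {h} → g ≤ h → h < len → Straddled h → trace (c h) (D ⊞ ζᵇ) ≡ true ⊎ trace (c h) ζᵃ ≡ true
      covered′ {h} g≤h h<l S with h ℕ.<? f
      ... | yes h<f = inj₁ (trans (trace-⊞ (c h) D ζᵇ) (cong₂ _xor_ (mid (ℕ.≤-trans i≤g g≤h) h<f) (avoidᵇ (ℕ.<⇒≤ h<f) h<l)))
      ... | no h≮f with covered (ℕ.≮⇒≥ h≮f) h<l S
      ... | inj₁ t = inj₂ t
      ... | inj₂ t = inj₁ (trans (trace-⊞ (c h) D ζᵇ) (cong₂ _xor_ (high h<l (ℕ.≮⇒≥ h≮f)) t))
      avoidᵃ′ : ∀ {h} → h < g → Reach h g → ∀ {h′} → h′ ≤ h → h′ < len → trace (c h′) (D ⊞ ζᵇ) ≡ false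
      avoidᵃ′ {h} h<g m {h′} h′≤h h′<l = trans (trace-⊞ (c h′) D ζᵇ)
          (cong₂ _xor_ (low h′<l (ℕ.≤-<-trans h′≤h h<i)) (avoidᵇ (ℕ.≤-trans (ℕ.≤-trans h′≤h (ℕ.<⇒≤ h<g)) (ℕ.<⇒≤ g<f)) h′<l))
        where
        -- If `i ≤ h`, then `Reach h g` would force `f ≤ g`, because `v i` and `v f` lie in one
        -- component.
        h<i : h < i
        h<i = ℕ.≰⇒> λ i≤h → ℕ.<⇒≱ g<f (m i f i≤h f≤l e)

    covering : Covering a z
    covering with segment (ℕ.≤⇒≤′ {0} {len} z≤n) ℕ.≤-refl | free-chain start
    ... | w , J , only , all | f , F , none = record
      { connect = f ⊞ w ; joins = subst (Joins (f ⊞ w) a) end (Joins-trans F J)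
      ; ζ₁ = ζᵃ ; ζ₂ = ζᵇ ; ζ₁-cycle = ζᵃ-cycle ; ζ₂-cycle = ζᵇ-cycle ; covers = covers }
      where
      open Greedy (greedy len 0 ℕ.≤-refl)
      covers : ∀ k → trace k (f ⊞ w) ≡ true → (∀ w → IsCycle w → trace k w ≡ false) ⊎ trace k ζᵃ ≡ true ⊎ trace k ζᵇ ≡ true
      covers k t with only k (trans (trans (cong (_xor trace k w) (sym (none k))) (sym (trace-⊞ k f w))) t)
      ... | h , _ , h<l , refl with straddled? h
      ... | inj₂ no-jump = inj₁ (bridge h<l no-jump)
      ... | inj₁ (j , h<j , j≤l , (i , i≤h , e) , _) = inj₂ (covered z≤n h<l (i , j , i≤h , h<j , j≤l , e))

  cover : ∀ {w a z} → Joins w a z → Covering a z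
  cover {a = a} J with path (joins⇒linked J)
  ... | inj₂ π    = Along.covering π
  ... | inj₁ refl = record { connect = 𝟎 ; joins = Joins-refl a ; ζ₁ = 𝟎 ; ζ₂ = 𝟎 ; ζ₁-cycle = 𝟎-cycle ; ζ₂-cycle = 𝟎-cycle
                           ; covers = λ i t → absurd t (trace-𝟎 i) }

-- Balanced families of codes

countL : ∀ {ℓ} {X : Set ℓ} → (X → Bool) → List X → ℕ
countL p []       = 0
countL p (x ∷ xs) = ind (p x) + countL p xs

countL-++ : ∀ {ℓ} {X : Set ℓ} (p : X → Bool) xs ys → countL p (xs ++ ys) ≡ countL p xs + countL p ys
countL-++ p []       ys = refl
countL-++ p (x ∷ xs) ys = trans (cong (ind (p x) +_) (countL-++ p xs ys)) (sym (ℕ.+-assoc (ind (p x)) _ _))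

countL-map : ∀ {ℓ ℓ′} {X : Set ℓ} {Y : Set ℓ′} (p : Y → Bool) (f : X → Y) xs → countL p (map f xs) ≡ countL (p ∘ f) xs
countL-map p f []       = refl
countL-map p f (x ∷ xs) = cong (ind (p (f x)) +_) (countL-map p f xs)

countL-lookup : ∀ {ℓ} {X : Set ℓ} (p : X → Bool) xs → count (p ∘ lookup xs) ≡ countL p xs
countL-lookup p []       = refl
countL-lookup p (x ∷ xs) with p x
... | true  = cong suc (countL-lookup p xs)
... | false = countL-lookup p xs

concatF : ∀ {ℓ n} {X : Set ℓ} → (Fin n → List X) → List X
concatF {n = zero}  f = []
concatF {n = suc n} f = f zero ++ concatF (f ∘ suc)

countL-concatF : ∀ {ℓ n} {X : Set ℓ} (p : X → Bool) (f : Fin n → List X) → countL p (concatF f) ≡ sumℕ (λ i → countL p (f i))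
countL-concatF {n = zero}  p f = refl
countL-concatF {n = suc n} p f = trans (countL-++ p (f zero) _) (cong (countL p (f zero) +_) (countL-concatF p (f ∘ suc)))

length-concatF : ∀ {ℓ n} {X : Set ℓ} (f : Fin n → List X) → length (concatF f) ≡ sumℕ (λ i → length (f i))
length-concatF {n = zero}  f = refl
length-concatF {n = suc n} f = trans (List.length-++ (f zero)) (cong (length (f zero) +_) (length-concatF (f ∘ suc)))

All-concatF : ∀ {ℓ ℓ′ n} {X : Set ℓ} {P : X → Set ℓ′} (f : Fin n → List X) → (∀ i → All P (f i)) → All P (concatF f)
All-concatF {n = zero}  f h = []
All-concatF {n = suc n} f h = All.++⁺ (h zero) (All-concatF (f ∘ suc) (h ∘ suc))

Any-concatF : ∀ {ℓ ℓ′ n} {X : Set ℓ} {P : X → Set ℓ′} (f : Fin n → List X) i → Any P (f i) → Any P (concatF f)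
Any-concatF f zero    h = Any.++⁺ˡ h
Any-concatF f (suc i) h = Any.++⁺ʳ (f zero) (Any-concatF (f ∘ suc) i h)

All-concatMap : ∀ {ℓ ℓ′ ℓ″} {X : Set ℓ} {Y : Set ℓ′} {P : Y → Set ℓ″} (f : X → List Y) xs → (∀ x → All P (f x)) → All P (concatMap f xs)
All-concatMap f []       h = []
All-concatMap f (x ∷ xs) h = All.++⁺ (h x) (All-concatMap f xs h)

length-concatMap≤ : ∀ {ℓ ℓ′} {X : Set ℓ} {Y : Set ℓ′} (f : X → List Y) b xs → (∀ x → length (f x) ≤ b) → length
    (concatMap f xs) ≤ length xs * b
length-concatMap≤ f b []       h = z≤n
length-concatMap≤ f b (x ∷ xs) h = ℕ.≤-trans (ℕ.≤-reflexive (List.length-++ (f x))) (ℕ.+-mono-≤ (h x) (length-concatMap≤ f b xs h))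

sumℕ-only≤ : ∀ {n} (p : Sub n) (f : Fin n → ℕ) c → (∀ i → f i ≤ c) → (∀ i → p i ≡ false → f i ≡ 0) → sumℕ f ≤ count p * c
sumℕ-only≤ {zero}  p f c h z = z≤n
sumℕ-only≤ {suc n} p f c h z with p zero in eq
... | true  = ℕ.+-mono-≤ (h zero) (sumℕ-only≤ (p ∘ suc) (f ∘ suc) c (h ∘ suc) (z ∘ suc))
... | false rewrite z zero eq = sumℕ-only≤ (p ∘ suc) (f ∘ suc) c (h ∘ suc) (z ∘ suc)

idx : ∀ {n} → Sub n → Fin n → ℕ
idx p zero    = 0
idx p (suc a) = ind (p zero) + idx (p ∘ suc) a

idx<count : ∀ {n} (p : Sub n) a → p a ≡ true → idx p a < count p
idx<count p zero e rewrite e = s≤s z≤n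
idx<count p (suc a) e with p zero
... | true  = s≤s (idx<count (p ∘ suc) a e)
... | false = idx<count (p ∘ suc) a e

idx-injective : ∀ {n} (p : Sub n) {a b} → p a ≡ true → p b ≡ true → idx p a ≡ idx p b → a ≡ b
idx-injective p {zero}  {zero}  _ _ _ = refl
idx-injective p {zero}  {suc b} e _ eq rewrite e = case eq of λ ()
idx-injective p {suc a} {zero}  _ e eq rewrite e = case eq of λ ()
idx-injective p {suc a} {suc b} e e′ eq = cong suc (idx-injective (p ∘ suc) e e′ (ℕ.+-cancelˡ-≡ (ind (p zero)) _ _ eq))

Code : Set
Code = ℕ → Bool

cons : Bool → Code → Code
cons b c zero    = b
cons b c (suc r) = c r

codes : ℕ → List Code
codes zero    = (λ _ → false) ∷ []
codes (suc k) = map (cons false) (codes k) ++ map (cons true) (codes k)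

length-codes : ∀ k → length (codes k) ≡ 2 ^ k
length-codes zero    = refl
length-codes (suc k) = trans (List.length-++ (map (cons false) (codes k)))
  (trans (cong₂ _+_ (List.length-map _ (codes k)) (List.length-map _ (codes k)))
      (cong₂ _+_ (length-codes k) (trans (length-codes k) (sym (ℕ.+-identityʳ _)))))

codes-complete : ∀ k (f : Code) → Any (λ c → ∀ r → r < k → c r ≡ f r) (codes k)
codes-complete zero    f = here (λ r ())
codes-complete (suc k) f with dichotomy (f 0)
... | inj₂ e = Any.++⁺ˡ (Any.map⁺ (Any.map (λ h → λ { zero _ → sym e ; (suc r) (s≤s l) → h r l }) (codes-complete k (f ∘ suc))))
... | inj₁ e = Any.++⁺ʳ (map (cons false) (codes k)) (Any.map⁺
        (Any.map (λ h → λ { zero _ → sym e ; (suc r) (s≤s l) → h r l }) (codes-complete k (f ∘ suc))))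

flipAt : ℕ → Code → Code
flipAt zero    c zero    = not (c 0)
flipAt zero    c (suc r) = c (suc r)
flipAt (suc k) c zero    = c 0
flipAt (suc k) c (suc r) = flipAt k (c ∘ suc) r

flipAt-at : ∀ k c → flipAt k c k ≡ not (c k)
flipAt-at zero    c = refl
flipAt-at (suc k) c = flipAt-at k (c ∘ suc)

flipAt-other : ∀ k c r → r ≢ k → flipAt k c r ≡ c r
flipAt-other zero    c zero    h = ⊥-elim (h refl)
flipAt-other zero    c (suc r) h = refl
flipAt-other (suc k) c zero    h = refl
flipAt-other (suc k) c (suc r) h = flipAt-other k (c ∘ suc) r (h ∘ cong suc)

countL-complement : ∀ {ℓ} {X : Set ℓ} (p q : X → Bool) xs → (∀ x → q x ≡ not (p x)) → countL p xs + countL q xs ≡ length xs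
countL-complement p q []       h = refl
countL-complement p q (x ∷ xs) h = trans (Interchange.interchange (ind (p x)) _ (ind (q x)) _)
  (cong₂ _+_ (trans (cong (λ b → ind (p x) + ind b) (h x)) (ind-not (p x))) (countL-complement p q xs h))

-- Flipping bit `r` exchanges the words that satisfy `φ` with those that do not. In the induction,
-- the two halves of the list are complementary if `r` is the first bit, and otherwise each half is
-- balanced by itself.
codes-balanced : ∀ {k r} (φ : Code → Bool) → (∀ {c c′} → (∀ j → c j ≡ c′ j) → φ c ≡ φ c′) → r < k →
  (∀ c → φ (flipAt r c) ≡ not (φ c)) → length (codes k) ≤ 2 * countL φ (codes k)
codes-balanced {suc k} {r} φ ext r<k flips = begin
  length (codes (suc k))  ≡⟨ length-codes (suc k) ⟩
  2 * 2 ^ k  ≡⟨ cong (2 *_) (sym (length-codes k)) ⟩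
  2 * length (codes k)  ≤⟨ ℕ.*-monoʳ-≤ 2 (halves r r<k flips) ⟩
  2 * (countL (φ ∘ cons false) (codes k) + countL (φ ∘ cons true) (codes k))  ≡⟨ cong (2 *_) (sym split) ⟩
  2 * countL φ (codes (suc k))  ∎
  where
  open ℕ.≤-Reasoning
  split : countL φ (codes (suc k)) ≡ countL (φ ∘ cons false) (codes k) + countL (φ ∘ cons true) (codes k)
  split = trans (countL-++ φ (map (cons false) (codes k)) _) (cong₂ _+_ (countL-map φ (cons false) (codes k))
      (countL-map φ (cons true) (codes k)))
  halves : ∀ r → r < suc k → (∀ c → φ (flipAt r c) ≡ not (φ c)) → length (codes k) ≤ countL (φ ∘ cons false) (codes k) + countL
      (φ ∘ cons true) (codes k)
  halves zero    _ flips = ℕ.≤-reflexive (sym (countL-complement _ _ (codes k) λ c →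
    trans (ext (λ { zero → refl ; (suc r) → refl })) (flips (cons false c))))
  halves (suc r) (s≤s r<k) flips = ℕ.*-cancelˡ-≤ 2 (begin
    2 * length (codes k)  ≡⟨ cong (length (codes k) +_) (ℕ.+-identityʳ _) ⟩
    length (codes k) + length (codes k)  ≤⟨ ℕ.+-mono-≤ (rec false) (rec true) ⟩
    2 * countL (φ ∘ cons false) (codes k) + 2 * countL (φ ∘ cons true) (codes k) ≡⟨ sym
        (ℕ.*-distribˡ-+ 2 (countL (φ ∘ cons false) (codes k)) _) ⟩
    2 * (countL (φ ∘ cons false) (codes k) + countL (φ ∘ cons true) (codes k))  ∎)
    where
    rec : ∀ b → length (codes k) ≤ 2 * countL (φ ∘ cons b) (codes k)
    rec b = codes-balanced (φ ∘ cons b) (λ h → ext (λ { zero → refl ; (suc j) → h j })) r<k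
      (λ c → trans (ext (λ { zero → refl ; (suc j) → refl })) (flips (cons b c)))

select : ∀ {n} → Sub n → Code → Sub n
select p c a = p a ∧ c (idx p a)

encode : ∀ {n} → Sub n → Sub n → Code
encode p X r = anyF (λ a → (p a ∧ ⌊ idx p a ℕ.≟ r ⌋) ∧ X a)

encode-idx : ∀ {n} (p X : Sub n) a → p a ≡ true → encode p X (idx p a) ≡ X a
encode-idx p X a pa = same-truth to from
  where
  to : encode p X (idx p a) ≡ true → X a ≡ true
  to e with anyF-elim _ e
  ... | b , q with ∧-elim {p b ∧ ⌊ idx p b ℕ.≟ idx p a ⌋} q
  ... | q₁ , Xb with ∧-elim {p b} q₁
  ... | pb , i with idx p b ℕ.≟ idx p a
  ... | yes eq = subst (λ z → X z ≡ true) (idx-injective p pb pa eq) Xb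
  from : X a ≡ true → encode p X (idx p a) ≡ true
  from Xa = anyF-intro _ a (∧-intro (∧-intro pa same) Xa)
    where
    same : ⌊ idx p a ℕ.≟ idx p a ⌋ ≡ true
    same with idx p a ℕ.≟ idx p a
    ... | yes _ = refl
    ... | no ne = ⊥-elim (ne refl)

abstract
  select-complete : ∀ {n} k (p X : Sub n) → count p ≤ k → Any (λ c → ∀ a → p a ≡ true → select p c a ≡ X a) (codes k)
  select-complete k p X le = Any.map (λ {c} h a pa → trans (cong₂ _∧_ pa (h (idx p a) (ℕ.<-≤-trans (idx<count p a pa) le)))
      (encode-idx p X a pa)) (codes-complete k (encode p X))

-- Adding to or removing from the selected set one fixed element `b` of `v` changes the parity.
dot-balanced : ∀ {n} k (p v : Sub n) → count p ≤ k → (∀ a → v a ≡ true → p a ≡ true) → anyF v ≡ true →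
  length (codes k) ≤ 2 * countL (λ c → dot v (select p c)) (codes k)
dot-balanced k p v le v⊆p nonzero with anyF-elim v nonzero
... | b , vb = codes-balanced (λ c → dot v (select p c)) (λ h → dot-congʳ v (λ a _ → cong (p a ∧_) (h (idx p a))))
  (ℕ.<-≤-trans (idx<count p b (v⊆p b vb)) le) flips
  where
  flips : ∀ c → dot v (select p (flipAt (idx p b) c)) ≡ not (dot v (select p c))
  flips c = trans (dot-congʳ v {select p (flipAt (idx p b) c)} {λ a → select p c a xor δ b a} pointwise)
    (trans (par-cong (λ a → ∧-distribˡ-xor (v a) (select p c a) (δ b a))) (trans (par-xor (λ a → v a ∧ select p c a) (λ a → v a ∧ δ b a))
      (trans (cong (dot v (select p c) xor_) (trans (par-cong (λ a → ∧-comm (v a) (δ b a))) (trans (par-δ′ v b) vb)))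
          (xor-true (dot v (select p c))))))
    where
    xor-true : ∀ x → x xor true ≡ not x
    xor-true true  = refl
    xor-true false = refl
    pointwise : ∀ a → v a ≡ true → select p (flipAt (idx p b) c) a ≡ select p c a xor δ b a
    pointwise a va with b ≟ a
    ... | yes refl rewrite v⊆p b vb = trans (flipAt-at (idx p b) c) (sym (xor-true _))
    ... | no b≢a   = trans (cong (p a ∧_) (flipAt-other (idx p b) c (idx p a)
            (λ e → b≢a (idx-injective p (v⊆p b vb) (v⊆p a va) (sym e))))) (sym (xor-identityʳ _))

-- Spreading consecutive ranks evenly by their binary digits

countN : (ℕ → Bool) → ℕ → ℕ
countN P zero    = 0
countN P (suc n) = ind (P 0) + countN (P ∘ suc) n

countN-cong : ∀ {P Q} n → (∀ r → P r ≡ Q r) → countN P n ≡ countN Q n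
countN-cong zero    h = refl
countN-cong (suc n) h = cong₂ _+_ (cong ind (h 0)) (countN-cong n (h ∘ suc))

odd : ℕ → Bool
odd zero          = false
odd (suc zero)    = true
odd (suc (suc n)) = odd n

-- The inner product of the list with the binary digits of `r`, lowest digit first.
bits : List Bool → ℕ → Bool
bits []       r = false
bits (b ∷ bs) r = (b ∧ odd r) xor bits bs ⌊ r /2⌋

alternating : ∀ (Q : ℕ → Bool) n → 2 * countN (λ r → odd r xor Q ⌊ r /2⌋) n ≤ suc n
alternating Q zero          = z≤n
alternating Q (suc zero)    = ℕ.*-monoʳ-≤ 2 (subst (_≤ 1) (sym (ℕ.+-identityʳ _)) (ind≤1 (Q 0)))
alternating Q (suc (suc n)) = begin
  2 * (ind (Q 0) + (ind (not (Q 0)) + rest))  ≡⟨ cong (2 *_) (trans (sym (ℕ.+-assoc (ind (Q 0)) _ rest)) (cong (_+ rest) (ind-not (Q 0)))) ⟩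
  2 * suc rest  ≡⟨ ℕ.*-suc 2 rest ⟩
  2 + 2 * rest  ≤⟨ ℕ.+-monoʳ-≤ 2 (alternating (Q ∘ suc) n) ⟩
  suc (suc (suc n))  ∎
  where
  open ℕ.≤-Reasoning
  rest = countN (λ r → odd r xor Q (suc ⌊ r /2⌋)) n

doubling : ∀ (Q : ℕ → Bool) n → countN (λ r → Q ⌊ r /2⌋) n ≤ 2 * countN Q ⌈ n /2⌉
doubling Q zero          = z≤n
doubling Q (suc zero)    = ℕ.m≤m+n _ _
doubling Q (suc (suc n)) = begin
  ind (Q 0) + (ind (Q 0) + countN (λ r → Q (suc ⌊ r /2⌋)) n)  ≤⟨ ℕ.+-monoʳ-≤ (ind (Q 0)) (ℕ.+-monoʳ-≤ (ind (Q 0)) (doubling (Q ∘ suc) n)) ⟩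
  ind (Q 0) + (ind (Q 0) + 2 * rest)  ≡⟨ solve 2 (λ x y → x :+ (x :+ con 2 :* y) := con 2 :* (x :+ y)) refl (ind (Q 0)) rest ⟩
  2 * (ind (Q 0) + rest)  ∎
  where
  open ℕ.≤-Reasoning
  open NatSolve.+-*-Solver
  rest = countN (Q ∘ suc) ⌈ n /2⌉

2*⌈n/2⌉≤ : ∀ n → 2 * ⌈ n /2⌉ ≤ suc n
2*⌈n/2⌉≤ zero          = z≤n
2*⌈n/2⌉≤ (suc zero)    = ℕ.≤-refl
2*⌈n/2⌉≤ (suc (suc n)) = ℕ.≤-trans (ℕ.≤-reflexive (ℕ.*-suc 2 ⌈ n /2⌉)) (ℕ.+-monoʳ-≤ 2 (2*⌈n/2⌉≤ n))

-- If the first true entry is at position `j`, the value depends only on the quotient of `r` by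
-- `2 ^ j` and changes with the lowest digit of this quotient; so only the last, incomplete block is
-- unbalanced. The `suc` on the left pays for the rounding in `⌈ n /2⌉` during the induction.
bits-balanced : ∀ b bs → Any (_≡ true) bs → ∀ n → suc (2 * countN (λ r → b xor bits bs r) n) ≤ n + 2 ^ length bs
bits-balanced b (true ∷ bs) _ n = begin
  suc (2 * countN (λ r → b xor (odd r xor bits bs ⌊ r /2⌋)) n)  ≡⟨ cong (λ z → suc (2 * z))
      (countN-cong n λ r → taut 3 (λ x y z → x xor (y xor z)) (λ x y z → y xor (x xor z)) b (odd r) (bits bs ⌊ r /2⌋)) ⟩
  suc (2 * countN (λ r → odd r xor (b xor bits bs ⌊ r /2⌋)) n)  ≤⟨ s≤s (alternating (λ r → b xor bits bs r) n) ⟩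
  suc (suc n)  ≡⟨ ℕ.+-comm 2 n ⟩
  n + 2  ≤⟨ ℕ.+-monoʳ-≤ n (ℕ.*-monoʳ-≤ 2 (ℕ.m^n>0 2 (length bs))) ⟩
  n + 2 ^ suc (length bs)  ∎
  where open ℕ.≤-Reasoning
bits-balanced b (false ∷ bs) (there h) n = ℕ.≤-pred (begin
  2 + 2 * countN (λ r → b xor bits bs ⌊ r /2⌋) n  ≤⟨ ℕ.+-monoʳ-≤ 2 (ℕ.*-monoʳ-≤ 2 (doubling (λ r → b xor bits bs r) n)) ⟩
  2 + 2 * (2 * countN (λ r → b xor bits bs r) ⌈ n /2⌉)  ≡⟨ sym (ℕ.*-suc 2 _) ⟩
  2 * suc (2 * countN (λ r → b xor bits bs r) ⌈ n /2⌉)  ≤⟨ ℕ.*-monoʳ-≤ 2 (bits-balanced b bs h ⌈ n /2⌉) ⟩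
  2 * (⌈ n /2⌉ + 2 ^ length bs)  ≡⟨ ℕ.*-distribˡ-+ 2 ⌈ n /2⌉ _ ⟩
  2 * ⌈ n /2⌉ + 2 * 2 ^ length bs  ≤⟨ ℕ.+-monoˡ-≤ _ (2*⌈n/2⌉≤ n) ⟩
  suc (n + 2 ^ suc (length bs))  ∎)
  where open ℕ.≤-Reasoning

-- Number of u′ < u of the same type as u, counted from the initial values κ.
rank : ∀ {m t} → (Fin m → Fin t) → (Fin t → ℕ) → Fin m → ℕ
rank ty κ zero    = κ (ty zero)
rank ty κ (suc u) = rank (ty ∘ suc) (λ t → ind (δ t (ty zero)) + κ t) u

-- The elements of type `t` receive consecutive ranks, beginning with `κ t`.
rank-count : ∀ {m t} (ty : Fin m → Fin t) κ t (P : ℕ → Bool) →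
  count (λ u → δ t (ty u) ∧ P (rank ty κ u)) ≡ countN (λ r → P (κ t + r)) (count (λ u → δ t (ty u)))
rank-count {zero}  ty κ t P = refl
rank-count {suc m} ty κ t P with t ≟ ty zero | rank-count (ty ∘ suc) (λ t → ind (δ t (ty zero)) + κ t) t P
... | no t≢    | ih = ih
... | yes refl | ih rewrite ℕ.+-identityʳ (κ t) with P (κ t)
...   | true  = cong suc (trans ih (countN-cong (count (λ u → δ t (ty (suc u)))) (λ r → cong P (sym (ℕ.+-suc (κ t) r)))))
...   | false = trans ih (countN-cong (count (λ u → δ t (ty (suc u)))) (λ r → cong P (sym (ℕ.+-suc (κ t) r))))

count-by-type : ∀ {m t} (ty : Fin m → Fin t) (p : Fin m → Bool) → count p ≡ sumℕ (λ t → count (λ u → δ t (ty u) ∧ p u))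
count-by-type ty p = trans (count-sum p) (trans (sumℕ-cong (λ u → sym (fiber (ty u) (p u))))
    (trans (sumℕ-comm (λ u t → ind (δ t (ty u) ∧ p u)))
  (sumℕ-cong (λ t → sym (count-sum (λ u → δ t (ty u) ∧ p u))))))
  where
  fiber : ∀ {n} (j : Fin n) b → sumℕ (λ i → ind (δ i j ∧ b)) ≡ ind b
  fiber j true  = trans (sym (count-sum (λ i → δ i j ∧ true))) (trans (count-cong (λ i → ∧-identityʳ (δ i j))) (singleton j))
    where
    singleton : ∀ {n} (j : Fin n) → count (λ i → δ i j) ≡ 1
    singleton {suc n} zero = cong suc (count-zero {n} (λ i → δ (suc i) zero) (λ i → δ-≢ {i = suc i} {zero} λ ()))
    singleton (suc j) = trans (count-cong (λ i → same-truth (λ e → subst (λ z → δ z j ≡ true)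
        (sym (Fin.suc-injective (δ-true {i = suc i} {suc j} e))) (δ-refl j))
        (λ e → subst (λ z → δ (suc i) (suc z) ≡ true) (δ-true e) (δ-refl (suc i))))) (singleton j)
  fiber j false = trans (sym (count-sum (λ i → δ i j ∧ false))) (count-zero _ (λ i → ∧-zeroʳ (δ i j)))

-- Lifting demands

sumList : ∀ {ℓ} {X : Set ℓ} → (X → ℕ) → List X → ℕ
sumList g []       = 0
sumList g (x ∷ xs) = g x + sumList g xs

sum-swap : ∀ {ℓ m} {X : Set ℓ} (q : Fin m → X → Bool) xs → sumℕ (λ u → countL (q u) xs) ≡ sumList (λ x → count (λ u → q u x)) xs
sum-swap {m = m} q []       = sumℕ-0 m
sum-swap         q (x ∷ xs) = trans (sumℕ-+ (λ u → ind (q u x)) _) (cong₂ _+_ (sym (count-sum (λ u → q u x))) (sum-swap q xs))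

sumList-bound : ∀ {ℓ} {X : Set ℓ} (g : X → ℕ) N xs → (∀ x → g x ≤ N) → sumList g xs ≤ length xs * N
sumList-bound g N []       h = z≤n
sumList-bound g N (x ∷ xs) h = ℕ.+-mono-≤ (h x) (sumList-bound g N xs h)

sumList-gap : ∀ {ℓ} {X : Set ℓ} (g : X → ℕ) N xs → (∀ x → g x ≤ N) → Any (λ x → g x ≡ 0) xs → sumList g xs + N ≤ length xs * N
sumList-gap g N (x ∷ xs) h (here e)  rewrite e = ℕ.≤-trans (ℕ.≤-reflexive (ℕ.+-comm _ N)) (ℕ.+-monoʳ-≤ N (sumList-bound g N xs h))
sumList-gap g N (x ∷ xs) h (there a) = ℕ.≤-trans (ℕ.≤-reflexive (ℕ.+-assoc (g x) _ N)) (ℕ.+-mono-≤ (h x) (sumList-gap g N xs h a))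

count*≤ : ∀ {m} (p : Fin m → Bool) K (f : Fin m → ℕ) → (∀ i → p i ≡ true → K ≤ 2 * f i) → count p * K ≤ 2 * sumℕ f
count*≤ {zero}  p K f h = z≤n
count*≤ {suc m} p K f h with p zero in eq
... | true  = ℕ.≤-trans (ℕ.+-mono-≤ (h zero eq) (count*≤ (p ∘ suc) K (f ∘ suc) (h ∘ suc)))
        (ℕ.≤-reflexive (sym (ℕ.*-distribˡ-+ 2 (f zero) _)))
... | false = ℕ.≤-trans (count*≤ (p ∘ suc) K (f ∘ suc) (h ∘ suc)) (ℕ.*-monoʳ-≤ 2 (ℕ.m≤n+m _ (f zero)))

twice-sum≤ : ∀ {m} (f g : Fin m → ℕ) c → (∀ i → 2 * f i ≤ g i + c) → 2 * sumℕ f ≤ sumℕ g + m * c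
twice-sum≤ {zero}  f g c h = z≤n
twice-sum≤ {suc m} f g c h = begin
  2 * (f zero + sumℕ (f ∘ suc))  ≡⟨ ℕ.*-distribˡ-+ 2 (f zero) _ ⟩
  2 * f zero + 2 * sumℕ (f ∘ suc)  ≤⟨ ℕ.+-mono-≤ (h zero) (twice-sum≤ (f ∘ suc) (g ∘ suc) c (h ∘ suc)) ⟩
  (g zero + c) + (sumℕ (g ∘ suc) + m * c)  ≡⟨ Interchange.interchange (g zero) c _ _ ⟩
  (g zero + sumℕ (g ∘ suc)) + (c + m * c)  ∎
  where open ℕ.≤-Reasoning

-- Averaging over all subsets X of p: a nonzero v u is odd on half of them, and no v u is odd on the empty one.
average : ∀ {n m} k (p : Sub n) (v : Fin m → Sub n) N → count p ≤ k → (∀ u a → v u a ≡ true → p a ≡ true) →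
  (∀ X → count (λ u → dot (v u) X) ≤ N) → count (λ u → anyF (v u)) * 2 ^ k + 2 * N ≤ 2 * (2 ^ k * N)
average k p v N le v⊆p h = begin
  count (λ u → anyF (v u)) * 2 ^ k + 2 * N  ≤⟨ ℕ.+-monoˡ-≤ (2 * N) (count*≤ _ (2 ^ k) _ λ u nz →
    ℕ.≤-trans (ℕ.≤-reflexive (sym (length-codes k))) (dot-balanced k p (v u) le (v⊆p u) nz)) ⟩
  2 * sumℕ (λ u → countL (λ c → dot (v u) (select p c)) (codes k)) + 2 * N  ≡⟨ cong (λ z → 2 * z + 2 * N)
      (sum-swap (λ u c → dot (v u) (select p c)) (codes k)) ⟩
  2 * sumList g (codes k) + 2 * N  ≡⟨ sym (ℕ.*-distribˡ-+ 2 (sumList g (codes k)) N) ⟩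
  2 * (sumList g (codes k) + N)  ≤⟨ ℕ.*-monoʳ-≤ 2 (sumList-gap g N (codes k) (λ c → h (select p c)) empty) ⟩
  2 * (length (codes k) * N)  ≡⟨ cong (λ z → 2 * (z * N)) (length-codes k) ⟩
  2 * (2 ^ k * N)  ∎
  where
  open ℕ.≤-Reasoning
  g : Code → ℕ
  g c = count (λ u → dot (v u) (select p c))
  empty : Any (λ c → g c ≡ 0) (codes k)
  empty = Any.map (λ {c} e → count-zero _ λ u → trans (dot-congʳ (v u) {select p c} {λ _ → false} (λ a va → e a (v⊆p u a va)))
    (par-zero _ (λ a → ∧-zeroʳ (v u a)))) (select-complete k p (λ _ → false) le)

-- A bound for 2 ^ length ζs below, the rounding error for the demands of one type.
slack : ℕ → ℕ
slack k = 2 ^ (2 ^ k * (k * 3))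

-- Write `N` for this number. Half of the nonzero demands are at most `N - N / 2 ^ k` by `average`.
-- So `N / 2 ^ k` has to pay for half of the rounding errors, `slack k` for each of `2 ^ k` types,
-- and for `β` generators; the value chosen is twice what is required.
load : ℕ → ℕ → ℕ
load k β = 2 ^ k * (2 ^ k * slack k + 2 * β)

load-bound : ∀ k β {F U} → 2 * F ≤ U + 2 ^ k * slack k → U * 2 ^ k + 2 * load k β ≤ 2 * (2 ^ k * load k β) → F + β ≤ load k β
load-bound k β {F} {U} h₁ h₂ = ℕ.*-cancelˡ-≤ 2 (ℕ.*-cancelˡ-≤ K {{ℕ.m^n≢0 2 k}} (ℕ.+-cancelʳ-≤ (2 * N) _ _ (begin
  K * (2 * (F + β)) + 2 * N  ≡⟨ solve 4 (λ K F β N → K :* (con 2 :* (F :+ β)) :+ con 2 :* N := K :* (con 2 :* F) :+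
      (K :* (con 2 :* β) :+ con 2 :* N)) refl K F β N ⟩
  K * (2 * F) + (K * (2 * β) + 2 * N)  ≤⟨ ℕ.+-monoˡ-≤ _ (ℕ.*-monoʳ-≤ K h₁) ⟩
  K * (U + K * slack k) + (K * (2 * β) + 2 * N)  ≡⟨ solve 5 (λ K U S β N → K :* (U :+ K :* S) :+ (K :* (con 2 :* β) :+ con 2 :* N)
                                                          := (U :* K :+ con 2 :* N) :+ (K :* (K :* S :+ con 2 :* β))) refl K U
                                                              (slack k) β N ⟩
  (U * K + 2 * N) + N  ≤⟨ ℕ.+-mono-≤ h₂ (ℕ.m≤m+n N (N + 0)) ⟩
  2 * (K * N) + 2 * N  ≡⟨ cong (_+ 2 * N) (solve 2 (λ K N → con 2 :* (K :* N) := K :* (con 2 :* N)) refl K N) ⟩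
  K * (2 * N) + 2 * N  ∎)))
  where
  open ℕ.≤-Reasoning
  open NatSolve.+-*-Solver
  K = 2 ^ k
  N = load k β

module Lift {n s : ℕ} (A : Fin s → Sub n) (k : ℕ) (sizes : ∀ i → count (A i) ≤ k) (D : Sub n) (sizeD : count D ≤ k)
  (connected : ∀ {a b} → D a ≡ true → D b ≡ true → ∃ λ w → Chains.Joins A w a b) where
  open Chains A

  scale : Bool → Chain → Chain
  scale b w i a = b ∧ w i a

  scale-chain : ∀ b {w} → (b ≡ true → IsChain w) → IsChain (scale b w)
  scale-chain true  W = W refl
  scale-chain false W = 𝟎-chain

  scale-cycle : ∀ b {w} → IsCycle w → IsCycle (scale b w)
  scale-cycle true  W = W
  scale-cycle false W = 𝟎-cycle

  scale-dot : ∀ b w i X → dot (scale b w i) X ≡ b ∧ dot (w i) X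
  scale-dot true  w i X = refl
  scale-dot false w i X = dot-𝟎 i X

  -- The digits of `r` choose which cycles are added. At a fixed cut the parity of this sum is given
  -- by `bits`, so that successive ranks are balanced as soon as a single cycle of the list crosses
  -- the cut.
  bitsum : List Chain → ℕ → Chain
  bitsum []       r = 𝟎
  bitsum (ζ ∷ ζs) r = scale (odd r) ζ ⊞ bitsum ζs ⌊ r /2⌋

  bitsum-cycle : ∀ {ζs} → All IsCycle ζs → ∀ r → IsCycle (bitsum ζs r)
  bitsum-cycle []       r = 𝟎-cycle
  bitsum-cycle (Z ∷ Zs) r = ⊞-cycle (scale-cycle (odd r) Z) (bitsum-cycle Zs ⌊ r /2⌋)

  bitsum-dot : ∀ ζs r i X → dot (bitsum ζs r i) X ≡ bits (map (λ ζ → dot (ζ i) X) ζs) r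
  bitsum-dot []       r i X = dot-𝟎 i X
  bitsum-dot (ζ ∷ ζs) r i X = trans (dot-⊞ (scale (odd r) ζ) (bitsum ζs ⌊ r /2⌋) i X)
    (cong₂ _xor_ (trans (scale-dot (odd r) ζ i X) (∧-comm (odd r) _)) (bitsum-dot ζs ⌊ r /2⌋ i X))

  Uncrossed : Fin s → Sub n → Set
  Uncrossed i X = ∀ w → IsCycle w → dot (w i) X ≡ false

  Crossed : Fin s → Sub n → List Chain → Set
  Crossed i X = Any (λ ζ → dot (ζ i) X ≡ true)

  -- In the first case of `bounded` no generator crosses the cut, since generators are cycles, and
  -- the lifts may use the whole load. In the second case there is room for `β` generators.
  record Lifting {m} (v : Fin m → Sub n) (β : ℕ) : Set where
    field
      lift       : Fin m → Chain
      lift-chain : ∀ u → IsChain (lift u)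
      lift-∂     : ∀ u a → ∂ (lift u) a ≡ v u a
      bounded    : ∀ i X → (count (λ u → dot (lift u i) X) ≤ load k β × Uncrossed i X)
                         ⊎ count (λ u → dot (lift u i) X) + β ≤ load k β

  module Rooted (a₀ : Fin n) (D₀ : D a₀ ≡ true) where

    base : Fin n → Chain
    base a with dichotomy (D a)
    ... | inj₁ d = proj₁ (connected d D₀)
    ... | inj₂ _ = 𝟎

    base-joins : ∀ {a} → D a ≡ true → Joins (base a) a a₀
    base-joins {a} d with dichotomy (D a)
    ... | inj₁ d′ = proj₂ (connected d′ D₀)
    ... | inj₂ f  = absurd d f

    sections : Code → Fin s → Sub n
    sections c i = select (A i) c

    covering : ∀ c {a} → D a ≡ true → Cover.Covering A (sections c) a a₀
    covering c d = Cover.cover A (sections c) (base-joins d)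

    -- The chain `base a` is chosen once, whereas `connect` depends on the code. Their sum is a
    -- cycle and takes care of cuts that `base a` crosses but `connect` does not.
    correctors : ∀ c a → D a ≡ true ⊎ D a ≡ false → List Chain
    correctors c a (inj₂ _) = []
    correctors c a (inj₁ d) = (base a ⊞ connect) ∷ ζ₁ ∷ ζ₂ ∷ []
      where open Cover.Covering (covering c d)

    correctors-cycle : ∀ c a d → All IsCycle (correctors c a d)
    correctors-cycle c a (inj₂ _) = []
    correctors-cycle c a (inj₁ d) = Joins-cycle (base-joins d) joins ∷ ζ₁-cycle ∷ ζ₂-cycle ∷ []
      where open Cover.Covering (covering c d)

    correctorsOf : Code → List Chain
    correctorsOf c = concatF (λ a → correctors c a (dichotomy (D a)))

    ζs : List Chain
    ζs = concatMap correctorsOf (codes k)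

    ζs-cycle : All IsCycle ζs
    ζs-cycle = All-concatMap _ (codes k) λ c → All-concatF _ λ a → correctors-cycle c a (dichotomy (D a))

    length-ζs : length ζs ≤ 2 ^ k * (k * 3)
    length-ζs = ℕ.≤-trans (length-concatMap≤ correctorsOf (k * 3) (codes k) λ c → begin
      length (correctorsOf c)  ≡⟨ length-concatF (λ a → correctors c a (dichotomy (D a))) ⟩
      sumℕ (λ a → length (correctors c a (dichotomy (D a))))  ≤⟨ sumℕ-only≤ D _ 3 (λ a → three c a (dichotomy (D a)))
          (λ a f → none c a f (dichotomy (D a))) ⟩
      count D * 3  ≤⟨ ℕ.*-monoˡ-≤ 3 sizeD ⟩
      k * 3  ∎) (ℕ.≤-reflexive (cong (_* (k * 3)) (length-codes k)))
      where
      open ℕ.≤-Reasoning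
      three : ∀ c a d → length (correctors c a d) ≤ 3
      three c a (inj₁ _) = ℕ.≤-refl
      three c a (inj₂ _) = z≤n
      none : ∀ c a → D a ≡ false → ∀ d → length (correctors c a d) ≡ 0
      none c a f (inj₁ d) = absurd d f
      none c a f (inj₂ _) = refl

    -- On `A i` the cut is the section of some code. If `connect` for this code does not cross it,
    -- `base a ⊞ connect` does. If `connect` crosses it, the covering offers a cycle that crosses it
    -- too, or else `i` is a bridge.
    corrected : ∀ {a} → D a ≡ true → ∀ i X → dot (base a i) X ≡ true →
      Uncrossed i X ⊎ Crossed i X ζs
    corrected {a} d i X odd-base = gather (codes k) (Any.map (λ {c} → outcome c) (select-complete k (A i) X (sizes i)))
      where
      Outcome : Code → Set
      Outcome c = Uncrossed i X ⊎ Crossed i X (correctorsOf c)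
      outcome : ∀ c → (∀ b → A i b ≡ true → select (A i) c b ≡ X b) → Outcome c
      outcome c agrees = conclude (dichotomy (D a)) refl
        where
        transfer : ∀ {w} → IsChain w → dot (w i) (sections c i) ≡ dot (w i) X
        transfer {w} W = dot-congʳ (w i) (λ b wb → agrees b (inside W i b wb))
        conclude : ∀ d → dichotomy (D a) ≡ d → Outcome c
        conclude (inj₂ f) _ = absurd d f
        conclude (inj₁ d) eq = finish (dichotomy (dot (connect i) X))
          where
          open Cover.Covering (covering c d)
          embed : Crossed i X (correctors c a (inj₁ d)) → Outcome c
          embed h = inj₂ (Any-concatF (λ a → correctors c a (dichotomy (D a))) a (subst (λ z → Crossed i X (correctors c a z)) (sym eq) h))
          finish : dot (connect i) X ≡ true ⊎ dot (connect i) X ≡ false → Outcome c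
          finish (inj₂ f) = embed (here (trans (dot-⊞ (base a) connect i X) (cong₂ _xor_ odd-base f)))
          finish (inj₁ t) with covers i (trans (transfer (chain joins)) t)
          ... | inj₁ none      = inj₁ λ w W → trans (sym (transfer (proj₁ W))) (none w W)
          ... | inj₂ (inj₁ t₁) = embed (there (here (trans (sym (transfer (proj₁ ζ₁-cycle))) t₁)))
          ... | inj₂ (inj₂ t₂) = embed (there (there (here (trans (sym (transfer (proj₁ ζ₂-cycle))) t₂))))
      gather : ∀ cs → Any Outcome cs → Uncrossed i X ⊎
        Crossed i X (concatMap correctorsOf cs)
      gather (c ∷ cs) (here (inj₁ none)) = inj₁ none
      gather (c ∷ cs) (here (inj₂ any))  = inj₂ (Any.++⁺ˡ any)
      gather (c ∷ cs) (there h) with gather cs h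
      ... | inj₁ none = inj₁ none
      ... | inj₂ any  = inj₂ (Any.++⁺ʳ (correctorsOf c) any)

    combination : Sub n → Chain
    combination v i b = par (λ a → v a ∧ base a i b)

    combination-chain : ∀ {v} → (∀ a → v a ≡ true → D a ≡ true) → IsChain (combination v)
    combination-chain {v} v⊆D = record
      { inside = λ i b e → let (a , p) = par-witness (λ a → v a ∧ base a i b) e ; (va , q) = ∧-elim p in
          inside (chain (base-joins (v⊆D a va))) i b q
      ; even = λ i → trans (par-comm (λ b a → v a ∧ base a i b)) (par-zero _ λ a → trans (sym (par-∧ˡ (v a) (base a i))) (term i a)) }
      where
      term : ∀ i a → v a ∧ par (base a i) ≡ false
      term i a with dichotomy (v a)
      ... | inj₁ va = trans (cong (_∧ par (base a i)) va) (even (chain (base-joins (v⊆D a va))) i)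
      ... | inj₂ f  = cong (_∧ par (base a i)) f

    -- Every `a` in `v` contributes itself and `a₀`; as `v` is even, the copies of `a₀` cancel.
    combination-∂ : ∀ {v} → (∀ a → v a ≡ true → D a ≡ true) → par v ≡ false → ∀ b → ∂ (combination v) b ≡ v b
    combination-∂ {v} v⊆D even-v b = begin
      par (λ i → par (λ a → v a ∧ base a i b))  ≡⟨ par-comm (λ i a → v a ∧ base a i b) ⟩
      par (λ a → par (λ i → v a ∧ base a i b))  ≡⟨ par-cong (λ a → sym (par-∧ˡ (v a) (λ i → base a i b))) ⟩
      par (λ a → v a ∧ ∂ (base a) b)  ≡⟨ par-cong term ⟩
      par (λ a → (v a ∧ δ a b) xor (v a ∧ δ a₀ b))  ≡⟨ par-xor (λ a → v a ∧ δ a b) (λ a → v a ∧ δ a₀ b) ⟩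
      par (λ a → v a ∧ δ a b) xor par (λ a → v a ∧ δ a₀ b)  ≡⟨ cong₂ _xor_ (trans (par-cong (λ a → ∧-comm (v a) (δ a b))) (par-δ v b))
          (trans (sym (par-∧ʳ (δ a₀ b) v)) (cong (_∧ δ a₀ b) even-v)) ⟩
      v b xor false  ≡⟨ xor-identityʳ (v b) ⟩
      v b  ∎
      where
      open ≡-Reasoning
      term : ∀ a → v a ∧ ∂ (base a) b ≡ (v a ∧ δ a b) xor (v a ∧ δ a₀ b)
      term a with dichotomy (v a)
      ... | inj₁ va = trans (cong (v a ∧_) (boundary (base-joins (v⊆D a va)) b)) (∧-distribˡ-xor (v a) (δ a b) (δ a₀ b))
      ... | inj₂ f  = trans (cong (_∧ ∂ (base a) b) f) (sym (cong (λ z → (z ∧ δ a b) xor (z ∧ δ a₀ b)) f))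

    combination-dot : ∀ v i X → dot (combination v i) X ≡ dot v (λ a → dot (base a i) X)
    combination-dot v i X = begin
      par (λ b → par (λ a → v a ∧ base a i b) ∧ X b)  ≡⟨ par-cong (λ b → par-∧ʳ (X b) (λ a → v a ∧ base a i b)) ⟩
      par (λ b → par (λ a → (v a ∧ base a i b) ∧ X b))  ≡⟨ par-comm (λ b a → (v a ∧ base a i b) ∧ X b) ⟩
      par (λ a → par (λ b → (v a ∧ base a i b) ∧ X b))  ≡⟨ par-cong
          (λ a → trans (par-cong (λ b → ∧-assoc (v a) (base a i b) (X b))) (sym (par-∧ˡ (v a) (λ b → base a i b ∧ X b)))) ⟩
      par (λ a → v a ∧ dot (base a i) X)  ∎
      where open ≡-Reasoning

    rooted-lifting : ∀ {m} (v : Fin m → Sub n) β → (∀ u a → v u a ≡ true → D a ≡ true) → (∀ u → par (v u) ≡ false) →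
      (∀ X → count (λ u → dot (v u) X) ≤ load k β) → Lifting v β
    rooted-lifting {m} v β v⊆D v-even v-load = record { lift = lift ; lift-chain = lift-chain ; lift-∂ = lift-∂ ; bounded = bounded }
      where
      -- Demands of one type are the same subset of `D`, so their lifts differ only in the sum of
      -- correctors.
      type : Fin m → Fin (length (codes k))
      type u = Any.index (select-complete k D (v u) sizeD)

      shape : Fin (length (codes k)) → Sub n
      shape t = select D (lookup (codes k) t)

      shape-type : ∀ u a → shape (type u) a ≡ v u a
      shape-type u a with dichotomy (D a)
      ... | inj₁ d = Any.lookup-index (select-complete k D (v u) sizeD) a d
      ... | inj₂ f = trans (cong (_∧ lookup (codes k) (type u) (idx D a)) f) (sym (not-true λ e → absurd (v⊆D u a e) f))

      nonzero : Fin (length (codes k)) → Bool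
      nonzero t = anyF (shape t)

      unscaled : Fin m → Chain
      unscaled u = combination (shape (type u)) ⊞ bitsum ζs (rank type (λ _ → 0) u)

      -- Zero demands have to lift to zero: `average` bounds only the number of nonzero demands, and
      -- arbitrarily many zero demands with correctors would overload the cuts.
      lift : Fin m → Chain
      lift u = scale (nonzero (type u)) (unscaled u)

      type⊆D : ∀ t a → shape t a ≡ true → D a ≡ true
      type⊆D t a e = proj₁ (∧-elim e)

      lift-chain : ∀ u → IsChain (lift u)
      lift-chain u = scale-chain (nonzero (type u)) λ _ → ⊞-chain (combination-chain (type⊆D (type u))) (proj₁ (bitsum-cycle ζs-cycle _))

      lift-∂ : ∀ u a → ∂ (lift u) a ≡ v u a
      lift-∂ u a with dichotomy (nonzero (type u))
      ... | inj₂ f = trans (par-zero (λ i → lift u i a) (λ i → cong (_∧ unscaled u i a) f))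
              (trans (sym (anyF-none (shape (type u)) f a)) (shape-type u a))
      ... | inj₁ t = trans (par-cong (λ i → cong (_∧ unscaled u i a) t))
              (trans (∂-⊞ (combination (shape (type u))) (bitsum ζs (rank type (λ _ → 0) u)) a)
        (trans (cong₂ _xor_ (combination-∂ (type⊆D (type u)) (trans (par-cong (shape-type u)) (v-even u)) a)
            (proj₂ (bitsum-cycle ζs-cycle (rank type (λ _ → 0) u)) a))
          (trans (xor-identityʳ _) (shape-type u a))))

      module _ (i : Fin s) (X : Sub n) where
        hits : List Bool
        hits = map (λ ζ → dot (ζ i) X) ζs

        value : Fin (length (codes k)) → ℕ → Bool
        value t r = nonzero t ∧ (dot (combination (shape t) i) X xor bits hits r)

        lift-dot : ∀ u → dot (lift u i) X ≡ value (type u) (rank type (λ _ → 0) u)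
        lift-dot u = trans (scale-dot (nonzero (type u)) (combination (shape (type u)) ⊞ bitsum ζs _) i X)
          (cong (nonzero (type u) ∧_) (trans (dot-⊞ (combination (shape (type u))) (bitsum ζs _) i X)
            (cong (dot (combination (shape (type u)) i) X xor_) (bitsum-dot ζs _ i X))))

        covered-bound : Crossed i X ζs → count (λ u → dot (lift u i) X) + β ≤ load k β
        covered-bound hit = load-bound k β twice (subst (λ z → z * 2 ^ k + 2 * load k β ≤ 2 * (2 ^ k * load k β))
            (count-cong λ u → sym (nonzero-type u)) (average k D v (load k β) sizeD v⊆D v-load))
          where
          open ℕ.≤-Reasoning
          nonzero-type : ∀ u → nonzero (type u) ≡ anyF (v u)
          nonzero-type u = same-truth
            (λ e → let (a , p) = anyF-elim (shape (type u)) e in anyF-intro (v u) a (trans (sym (shape-type u a)) p))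
            (λ e → let (a , p) = anyF-elim (v u) e in anyF-intro (shape (type u)) a (trans (shape-type u a) p))
          of-type : Fin (length (codes k)) → ℕ
          of-type t = count (λ u → δ t (type u) ∧ dot (lift u i) X)
          nonzero-of-type : Fin (length (codes k)) → ℕ
          nonzero-of-type t = count (λ u → δ t (type u) ∧ nonzero (type u))
          hits-true : Any (_≡ true) hits
          hits-true = Any.map⁺ hit
          of-type-count : ∀ t → of-type t ≡ countN (value t) (count (λ u → δ t (type u)))
          of-type-count t = trans (count-cong at-type) (rank-count type (λ _ → 0) t (value t))
            where
            at-type : ∀ u → δ t (type u) ∧ dot (lift u i) X ≡ δ t (type u) ∧ value t (rank type (λ _ → 0) u)
            at-type u with t ≟ type u
            ... | yes refl = lift-dot u
            ... | no _     = refl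
          countN-zero : ∀ l → countN (λ _ → false) l ≡ 0
          countN-zero zero    = refl
          countN-zero (suc l) = countN-zero l
          per-type : ∀ t → 2 * of-type t ≤ nonzero-of-type t + slack k
          per-type t with dichotomy (nonzero t)
          ... | inj₂ f = subst (λ z → 2 * z ≤ nonzero-of-type t + slack k) (sym (trans (of-type-count t)
                (trans (countN-cong (count (λ u → δ t (type u))) (λ r → cong (_∧ (dot (combination (shape t) i) X xor bits hits r)) f))
                    (countN-zero (count (λ u → δ t (type u))))))) z≤n
          ... | inj₁ nz = begin
            2 * of-type t  ≡⟨ cong (2 *_) (trans (of-type-count t) (countN-cong size (λ r → cong (_∧ (dot (combination (shape t) i) X xor bits hits r)) nz))) ⟩
            2 * countN (λ r → dot (combination (shape t) i) X xor bits hits r) size ≤⟨ ℕ.≤-trans (ℕ.n≤1+n _)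
                (bits-balanced (dot (combination (shape t) i) X) hits hits-true size) ⟩
            size + 2 ^ length hits  ≤⟨ ℕ.+-mono-≤ (count-mono {p = λ u → δ t (type u)} {q = λ u → δ t (type u) ∧ nonzero
                (type u)} λ u e → ∧-intro e (subst (λ z → nonzero z ≡ true) (δ-true {i = t} e) nz))
                                                                                     (ℕ.^-monoʳ-≤ 2 (ℕ.≤-trans (ℕ.≤-reflexive (List.length-map _ ζs)) length-ζs)) ⟩
            nonzero-of-type t + slack k  ∎
            where size = count (λ u → δ t (type u))
          twice : 2 * count (λ u → dot (lift u i) X) ≤ count (λ u → nonzero (type u)) + 2 ^ k * slack k
          twice = begin
            2 * count (λ u → dot (lift u i) X)  ≡⟨ cong (2 *_) (count-by-type type (λ u → dot (lift u i) X)) ⟩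
            2 * sumℕ of-type  ≤⟨ twice-sum≤ of-type nonzero-of-type (slack k) per-type ⟩
            sumℕ nonzero-of-type + length (codes k) * slack k ≡⟨ cong₂ _+_ (sym (count-by-type type (λ u → nonzero (type u)))) (cong (_* slack k) (length-codes k)) ⟩
            count (λ u → nonzero (type u)) + 2 ^ k * slack k ∎

        module _ (miss : ¬ Crossed i X ζs) where
          bits-miss : ∀ r → bits hits r ≡ false
          bits-miss = go ζs miss
            where
            go : ∀ zs → ¬ Crossed i X zs → ∀ r → bits (map (λ ζ → dot (ζ i) X) zs) r ≡ false
            go []       _ r = refl
            go (z ∷ zs) h r = cong₂ _xor_ (cong (_∧ odd r) (not-true (h ∘ here))) (go zs (h ∘ there) ⌊ r /2⌋)

          uncovered-dot : ∀ u → dot (lift u i) X ≡ dot (v u) (λ a → dot (base a i) X)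
          uncovered-dot u = trans (lift-dot u) (trans (cong (λ z → nonzero (type u) ∧ (dot (combination (shape (type u)) i) X xor z))
              (bits-miss (rank type (λ _ → 0) u)))
            (trans (cong (nonzero (type u) ∧_) (trans (xor-identityʳ _) (combination-dot (shape (type u)) i X)))
                (trans unscale (dot-congˡ (λ a → dot (base a i) X) (shape-type u)))))
            where
            full : Bool
            full = dot (shape (type u)) (λ a → dot (base a i) X)
            unscale : nonzero (type u) ∧ full ≡ full
            unscale with dichotomy (nonzero (type u))
            ... | inj₁ t = cong (_∧ full) t
            ... | inj₂ f = trans (cong (_∧ full) f) (sym (dot-zero (shape (type u)) _ (anyF-none (shape (type u)) f)))

      bounded : ∀ i X → (count (λ u → dot (lift u i) X) ≤ load k β × Uncrossed i X) ⊎ count (λ u → dot (lift u i) X) + β ≤ load k β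
      bounded i X with Any.any? (λ ζ → dot (ζ i) X Bool.≟ true) ζs
      ... | yes hit = inj₂ (covered-bound i X hit)
      ... | no miss with dichotomy (anyF (λ a → D a ∧ dot (base a i) X))
      -- Some base chain crosses the cut although no corrector does; by `corrected` this happens
      -- only at a bridge. The lifts that cross are those of demands crossing the set of all `a`
      -- whose base chain crosses.
      ... | inj₁ some with anyF-elim _ some
      ... | a , p with corrected (proj₁ (∧-elim {D a} p)) i X (proj₂ (∧-elim {D a} p))
      ... | inj₁ none = inj₁ (subst (_≤ load k β) (sym (count-cong (uncovered-dot i X miss))) (v-load _) , none)
      ... | inj₂ any  = contradiction any miss
      -- No base chain from a terminal and no corrector crosses the cut, hence no lift does, and
      -- `β ≤ load k β` is enough.
      bounded i X | no miss | inj₂ none = inj₂ (subst (λ z → z + β ≤ load k β)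
          (sym (count-zero (λ u → dot (lift u i) X) λ u → trans (uncovered-dot i X miss u) (vanish u))) β≤load)
        where
        vanish : ∀ u → dot (v u) (λ a → dot (base a i) X) ≡ false
        vanish u = trans (dot-congʳ (v u) {_} {λ _ → false} λ a va → trans (cong (_∧ dot (base a i) X) (sym (v⊆D u a va)))
            (anyF-none _ none a))
          (par-zero _ (λ a → ∧-zeroʳ (v u a)))
        β≤load : β ≤ load k β
        β≤load = load-bound k β {0} {0} z≤n (ℕ.*-monoʳ-≤ 2 (ℕ.m≤n*m (load k β) (2 ^ k) {{ℕ.m^n≢0 2 k}}))

  lifting : ∀ {m} (v : Fin m → Sub n) β → (∀ u a → v u a ≡ true → D a ≡ true) → (∀ u → par (v u) ≡ false) →
    (∀ X → count (λ u → dot (v u) X) ≤ load k β) → Lifting v β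
  lifting {m} v β v⊆D v-even v-load with dichotomy (anyF D)
  ... | inj₁ some = let (a₀ , D₀) = anyF-elim D some in Rooted.rooted-lifting a₀ D₀ v β v⊆D v-even v-load
  ... | inj₂ none = record
    { lift = λ _ → 𝟎 ; lift-chain = λ _ → 𝟎-chain
    ; lift-∂ = λ u a → trans (∂-𝟎 a) (sym (not-true λ e → absurd (v⊆D u a e) (anyF-none D none a)))
    ; bounded = λ i X → inj₂ (subst (λ z → z + β ≤ load k β) (sym (count-zero {m} (λ u → dot (𝟎 i) X) (λ u → dot-𝟎 i X)))
        (load-bound k β {0} {0} z≤n (ℕ.*-monoʳ-≤ 2 (ℕ.m≤n*m (load k β) (2 ^ k) {{ℕ.m^n≢0 2 k}})))) }

-- Routing demands through pieces

-- Edge sets and chains are both matrices, so one notion of span serves for both.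
Mat : ℕ → ℕ → Set
Mat p q = Fin p → Fin q → Bool

infixl 6 _⊕_
_⊕_ : ∀ {p q} → Mat p q → Mat p q → Mat p q
(S ⊕ R) u v = S u v xor R u v

data Span {p q} (Zs : List (Mat p q)) : Mat p q → Set where
  span-zero : ∀ {S} → (∀ u v → S u v ≡ false) → Span Zs S
  span-add  : ∀ {S S′ Z} → Z ∈ Zs → Span Zs S′ → (∀ u v → S u v ≡ Z u v xor S′ u v) → Span Zs S

span-resp : ∀ {p q} {Zs : List (Mat p q)} {S S′} → (∀ u v → S u v ≡ S′ u v) → Span Zs S → Span Zs S′
span-resp e (span-zero z)    = span-zero (λ u v → trans (sym (e u v)) (z u v))
span-resp e (span-add i σ h) = span-add i σ (λ u v → trans (sym (e u v)) (h u v))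

span-⊕ : ∀ {p q} {Zs : List (Mat p q)} {S S′} → Span Zs S → Span Zs S′ → Span Zs (S ⊕ S′)
span-⊕ {S′ = S′} (span-zero z) τ = span-resp (λ u v → cong (_xor S′ u v) (sym (z u v))) τ
span-⊕ {S′ = S′} (span-add {S′ = S″} {Z} i σ h) τ = span-add i (span-⊕ σ τ)
    (λ u v → trans (cong (_xor S′ u v) (h u v)) (xor-assoc (Z u v) (S″ u v) (S′ u v)))

span-member : ∀ {p q} {Zs : List (Mat p q)} {Z} → Z ∈ Zs → Span Zs Z
span-member {Z = Z} i = span-add i (span-zero {S = λ _ _ → false} (λ _ _ → refl)) (λ u v → sym (xor-identityʳ (Z u v)))

span-trans : ∀ {p q} {Zs Ys : List (Mat p q)} {S} → (∀ {Z} → Z ∈ Zs → Span Ys Z) → Span Zs S → Span Ys S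
span-trans f (span-zero z)    = span-zero z
span-trans f (span-add i σ h) = span-resp (λ u v → sym (h u v)) (span-⊕ (f i) (span-trans f σ))

span-⊆ : ∀ {p q} {Zs Ys : List (Mat p q)} {S} → (∀ {Z} → Z ∈ Zs → Z ∈ Ys) → Span Zs S → Span Ys S
span-⊆ f = span-trans (span-member ∘ f)

span-par : ∀ {p q r} {Zs : List (Mat p q)} (f : Fin r → Mat p q) → (∀ i → Span Zs (f i)) → Span Zs (λ u v → par (λ i → f i u v))
span-par {r = zero}  f h = span-zero (λ u v → refl)
span-par {r = suc r} f h = span-⊕ (h zero) (span-par (f ∘ suc) (h ∘ suc))

handshake : ∀ {n} (S : EdgeSet n) → (∀ u v → S u v ≡ S v u) → (∀ u → S u u ≡ false) → par (λ u → par (S u)) ≡ false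
handshake {zero}  S symm irr = refl
handshake {suc n} S symm irr = begin
  (S zero zero xor row) xor par (λ u → S (suc u) zero xor par (λ v → S (suc u) (suc v)))  ≡⟨ cong₂ (λ x y → (x xor row) xor y) (irr zero)
      (trans (par-xor (λ u → S (suc u) zero) _) (cong₂ _xor_ (par-cong (λ u → symm (suc u) zero))
          (handshake (λ u v → S (suc u) (suc v)) (λ u v → symm (suc u) (suc v)) (irr ∘ suc)))) ⟩
  row xor (row xor false)  ≡⟨ taut 1 (λ x → x xor (x xor false)) (λ x → false) row ⟩
  false  ∎
  where
  open ≡-Reasoning
  row = par (λ v → S zero (suc v))

module _ {n : ℕ} where

  deg : EdgeSet n → Sub n
  deg S u = par (S u)

  record Within (E S : EdgeSet n) : Set where
    constructor within
    field
      symmetric : ∀ u v → S u v ≡ S v u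
      subset    : ∀ u v → S u v ≡ true → E u v ≡ true
  open Within public

  Cycle : EdgeSet n → EdgeSet n → Set
  Cycle E S = Within E S × (∀ u → deg S u ≡ false)

  within-⊕ : ∀ {E S R} → Within E S → Within E R → Within E (S ⊕ R)
  within-⊕ {E} {S} {R} p q = within (λ u v → cong₂ _xor_ (symmetric p u v) (symmetric q u v)) λ u v e → case dichotomy (S u v) of λ where
    (inj₁ t) → subset p u v t
    (inj₂ f) → subset q u v (subst (λ b → b xor R u v ≡ true) f e)

  within-par : ∀ {E r} (f : Fin r → EdgeSet n) → (∀ i → Within E (f i)) → Within E (λ u v → par (λ i → f i u v))
  within-par f h = within (λ u v → par-cong (λ i → symmetric (h i) u v)) λ u v e → let (i , p) = par-witness (λ i → f i u v) e in subset (h i) u v p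

  within-⊆ : ∀ {E F S} → (∀ u v → E u v ≡ true → F u v ≡ true) → Within E S → Within F S
  within-⊆ h p = within (symmetric p) (λ u v e → h u v (subset p u v e))

  record Realization (N : ℕ) (E : EdgeSet n) {m} (v : Fin m → Sub n) : Set where
    field
      route        : Fin m → EdgeSet n
      route-within : ∀ u → Within E (route u)
      route-deg    : ∀ u a → deg (route u) a ≡ v u a
      cycles       : List (EdgeSet n)
      cycles-cycle : All (Cycle E) cycles
      cycles-span  : ∀ S → Cycle E S → Span cycles S
      congestion   : ∀ a b → count (λ u → route u a b) + countL (λ Z → Z a b) cycles ≤ N

  -- The same N bounds the number of demands crossing any cut and the resulting congestion, so that nothing is lost
  -- when the demands of a piece are handed down to its parts.
  Realizable : ℕ → EdgeSet n → Sub n → Set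
  Realizable N E D = ∀ {m} (v : Fin m → Sub n) → (∀ u a → v u a ≡ true → D a ≡ true) → (∀ u → par (v u) ≡ false) →
    (∀ X → count (λ u → dot (v u) X) ≤ N) → Realization N E v

  record Pieces {s : ℕ} (k β : ℕ) (E : EdgeSet n) (D : Sub n) (Es : Fin s → EdgeSet n) (A : Fin s → Sub n) : Set where
    open Chains A
    field
      sizes       : ∀ i → count (A i) ≤ k
      sizeD       : count D ≤ k
      irreflexive : ∀ u → E u u ≡ false
      Es-sym      : ∀ i u v → Es i u v ≡ Es i v u
      owner       : ∀ u v → E u v ≡ true → ∃ λ i → Es i u v ≡ true
      Es⊆E        : ∀ i u v → Es i u v ≡ true → E u v ≡ true
      disjoint    : ∀ i j u v → Es i u v ≡ true → Es j u v ≡ true → i ≡ j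
      attach      : ∀ i u v → Es i u v ≡ true → D u ≡ true ⊎ (∃ λ j → ∃ λ w → j ≢ i × Es j u w ≡ true) → A i u ≡ true
      linking     : ∀ {a b} → D a ≡ true → D b ≡ true → ∃ λ R → Within E R × (∀ c → deg R c ≡ δ a c xor δ b c)
      gens        : List Chain
      gens-cycle  : All IsCycle gens
      gens-span   : ∀ w → IsCycle w → Span gens w
      gens-load   : ∀ i X → countL (λ g → dot (g i) X) gens ≤ β

  module Assemble {s k β E D Es A} (pieces : Pieces {s} k β E D Es A) (realize : ∀ i → Realizable (load k β) (Es i) (A i)) where
    open Pieces pieces
    open Chains A

    restrict : EdgeSet n → Fin s → EdgeSet n
    restrict S i u v = S u v ∧ Es i u v

    restrict-within : ∀ {S} → Within E S → ∀ i → Within (Es i) (restrict S i)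
    restrict-within p i = within (λ u v → cong₂ _∧_ (symmetric p u v) (Es-sym i u v)) (λ u v e → proj₂ (∧-elim e))

    restrict-sum : ∀ {S} → Within E S → ∀ u v → par (λ i → restrict S i u v) ≡ S u v
    restrict-sum {S} p u v with dichotomy (S u v)
    ... | inj₂ f = trans (par-zero _ (λ i → cong (_∧ Es i u v) f)) (sym f)
    ... | inj₁ t with owner u v (subset p u v t)
    ... | i , e = trans (par-only _ i (λ j j≢i → trans (cong (S u v ∧_) (not-true λ e′ → j≢i (disjoint j i u v e′ e))) (∧-zeroʳ (S u v))))
      (trans (cong (S u v ∧_) e) (∧-identityʳ (S u v)))

    -- The passage from edge sets to chains. Its kernel consists of the sums of cycles inside single
    -- pieces, and these are supplied by the realizations of the pieces.
    degs : EdgeSet n → Chain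
    degs S i = deg (restrict S i)

    degs-∂ : ∀ {S} → Within E S → ∀ a → ∂ (degs S) a ≡ deg S a
    degs-∂ {S} p a = trans (par-comm (λ i v → restrict S i a v)) (par-cong (restrict-sum p a))

    -- Evenness is the handshake lemma in each piece. A vertex that is odd in piece `i` lies in `D`,
    -- or its total degree is even, and then it is odd in a second piece as well; in both cases
    -- `attach` makes it a terminal.
    degs-chain : ∀ {S} → Within E S → (∀ a → deg S a ≡ true → D a ≡ true) → IsChain (degs S)
    degs-chain {S} p deg⊆D = record { inside = ins ; even = λ i → handshake (restrict S i) (symmetric (restrict-within p i))
        (λ u → not-true λ e → absurd (subset p u u (proj₁ (∧-elim e))) (irreflexive u)) }
      where
      ins : ∀ i a → degs S i a ≡ true → A i a ≡ true
      ins i a e with par-witness (restrict S i a) e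
      ... | u , q = attach i a u (proj₂ (∧-elim q)) (case dichotomy (D a) of λ where
          (inj₁ d) → inj₁ d
          (inj₂ f) → inj₂ (other f))
        where
        other : D a ≡ false → ∃ λ j → ∃ λ w → j ≢ i × Es j a w ≡ true
        other f with dichotomy (anyF (λ j → not (δ j i) ∧ degs S j a))
        ... | inj₁ some = let (j , r) = anyF-elim (λ j → not (δ j i) ∧ degs S j a) some ; (j≢ , r′) = ∧-elim r ; (w , r″) = par-witness (restrict S j a) r′ in
            j , w , (λ j≡i → absurd (trans (cong (λ z → not (δ z i)) (sym j≡i)) j≢) (cong not (δ-refl i))) , proj₂ (∧-elim {S a w} r″)
        ... | inj₂ none = absurd (deg⊆D a (trans (sym (degs-∂ p a)) (trans (par-only _ i
            (λ j j≢i → trans (cong (_∧ degs S j a) (cong not (sym (δ-≢ j≢i)))) (anyF-none (λ j → not (δ j i) ∧ degs S j a) none j))) e))) f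

    degs-cycle : ∀ {S} → Cycle E S → IsCycle (degs S)
    degs-cycle (p , z) = degs-chain p (λ a e → absurd e (z a)) , λ a → trans (degs-∂ p a) (z a)

    connected : ∀ {a b} → D a ≡ true → D b ≡ true → ∃ λ w → Joins w a b
    connected {a} {b} da db with linking da db
    ... | R , W , e = degs R , (degs-chain W ends , λ c → trans (degs-∂ W c) (e c))
      where
      ends : ∀ c → deg R c ≡ true → D c ≡ true
      ends c r with dichotomy (δ a c)
      ... | inj₁ t = subst (λ z → D z ≡ true) (δ-true t) da
      ... | inj₂ f = subst (λ z → D z ≡ true) (δ-true (trans (sym (cong (_xor δ b c) f)) (trans (sym (e c)) r))) db

    module _ {m} (v : Fin m → Sub n) (v⊆D : ∀ u a → v u a ≡ true → D a ≡ true) (v-even : ∀ u → par (v u) ≡ false)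
             (v-load : ∀ X → count (λ u → dot (v u) X) ≤ load k β) where
      open Lift.Lifting (Lift.lifting A k sizes D sizeD connected v β v⊆D v-even v-load)

      G : ℕ
      G = length gens

      chains : Fin (m + G) → Chain
      chains u = [ lift , lookup gens ]′ (splitAt m u)

      chains-chain : ∀ u → IsChain (chains u)
      chains-chain u with splitAt m u
      ... | inj₁ u′ = lift-chain u′
      ... | inj₂ j  = proj₁ (All.lookup gens-cycle (Mem.∈-lookup j))

      chainsˡ : ∀ u → chains (u ↑ˡ G) ≡ lift u
      chainsˡ u = cong [ lift , lookup gens ]′ (Fin.splitAt-↑ˡ m u G)

      chainsʳ : ∀ j → chains (m ↑ʳ j) ≡ lookup gens j
      chainsʳ j = cong [ lift , lookup gens ]′ (Fin.splitAt-↑ʳ m G j)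

      chains-load : ∀ i X → count (λ u → dot (chains u i) X) ≤ load k β
      chains-load i X = ℕ.≤-trans (ℕ.≤-reflexive (trans (count-++ m (λ u → dot (chains u i) X))
          (cong₂ _+_ (count-cong (λ u → cong (λ w → dot (w i) X) (chainsˡ u)))
            (trans (count-cong (λ j → cong (λ w → dot (w i) X) (chainsʳ j))) (countL-lookup (λ g → dot (g i) X) gens))))) total
        where
        vanish : ∀ gs → All IsCycle gs → (∀ w → IsCycle w → dot (w i) X ≡ false) → countL (λ g → dot (g i) X) gs ≡ 0
        vanish []       []       h = refl
        vanish (g ∷ gs) (Z ∷ Zs) h rewrite h g Z = vanish gs Zs h
        total : count (λ u → dot (lift u i) X) + countL (λ g → dot (g i) X) gens ≤ load k β
        total with bounded i X
        ... | inj₂ le = ℕ.≤-trans (ℕ.+-monoʳ-≤ _ (gens-load i X)) le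
        ... | inj₁ (le , none) rewrite vanish gens gens-cycle none = subst (_≤ load k β) (sym (ℕ.+-identityʳ _)) le

      module Child (i : Fin s) = Realization (realize i (λ u → chains u i) (λ u → inside (chains-chain u) i)
          (λ u → even (chains-chain u) i) (chains-load i))

      routes : Fin (m + G) → EdgeSet n
      routes u a b = par (λ i → Child.route i u a b)

      routes-within : ∀ u → Within E (routes u)
      routes-within u = within-par (λ i → Child.route i u) (λ i → within-⊆ (Es⊆E i) (Child.route-within i u))

      routes-deg : ∀ u a → deg (routes u) a ≡ ∂ (chains u) a
      routes-deg u a = trans (par-comm (λ b i → Child.route i u a b)) (par-cong (λ i → Child.route-deg i u a))

      alone : ∀ {i a b} → Es i a b ≡ true → ∀ {j} → j ≢ i → Es j a b ≡ false
      alone {i} {a} {b} e {j} j≢i = not-true (λ e′ → j≢i (disjoint j i a b e′ e))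

      outside : ∀ {j a b} → Es j a b ≡ false → ∀ u → Child.route j u a b ≡ false
      outside {j} {a} {b} f u = not-true (λ e → absurd (subset (Child.route-within j u) a b e) f)

      routes-restrict : ∀ u i a b → restrict (routes u) i a b ≡ Child.route i u a b
      routes-restrict u i a b with dichotomy (Es i a b)
      ... | inj₂ f = trans (cong (routes u a b ∧_) f) (trans (∧-zeroʳ (routes u a b)) (sym (outside {i} f u)))
      ... | inj₁ e = trans (cong (routes u a b ∧_) e) (trans (∧-identityʳ _) (par-only _ i (λ j j≢i → outside {j} (alone e j≢i) u)))

      all-cycles : List (EdgeSet n)
      all-cycles = concatF (λ j → routes (m ↑ʳ j) ∷ []) ++ concatF Child.cycles

      own∈ : ∀ j → routes (m ↑ʳ j) ∈ all-cycles
      own∈ j = Any.++⁺ˡ (Any-concatF (λ j → routes (m ↑ʳ j) ∷ []) j (here refl))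

      child∈ : ∀ i {Z} → Z ∈ Child.cycles i → Z ∈ all-cycles
      child∈ i z = Any.++⁺ʳ (concatF (λ j → routes (m ↑ʳ j) ∷ [])) (Any-concatF Child.cycles i z)

      gens-routed : ∀ j i a → degs (routes (m ↑ʳ j)) i a ≡ lookup gens j i a
      gens-routed j i a = trans (par-cong (routes-restrict (m ↑ʳ j) i a))
          (trans (Child.route-deg i (m ↑ʳ j) a) (cong (λ w → w i a) (chainsʳ j)))

      -- Subtracting the routes of the generators that add up to `degs S` leaves an edge set in the
      -- kernel of `degs`, whose restriction to each piece is a cycle there.
      spanned : ∀ {w} → Span gens w → ∀ S → Within E S → (∀ i a → degs S i a ≡ w i a) → Span all-cycles S
      spanned (span-zero z) S p e = span-resp (restrict-sum p)
        (span-par (restrict S) (λ i → span-⊆ (child∈ i) (Child.cycles-span i (restrict S i)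
            (restrict-within p i , λ a → trans (e i a) (z i a)))))
      spanned {w} (span-add {S′ = w′} {g} g∈ σ h) S p e = span-add (own∈ j)
          (spanned σ (S ⊕ routes (m ↑ʳ j)) (within-⊕ p (routes-within _)) rest)
          (λ u v → taut 2 (λ x y → x) (λ x y → y xor (x xor y)) (S u v) (routes (m ↑ʳ j) u v))
        where
        j = Any.index g∈
        rest : ∀ i a → degs (S ⊕ routes (m ↑ʳ j)) i a ≡ w′ i a
        rest i a = trans (par-cong (λ b → ∧-distribʳ-xor (Es i a b) (S a b) (routes (m ↑ʳ j) a b)))
            (trans (par-xor (λ b → restrict S i a b) (restrict (routes (m ↑ʳ j)) i a))
          (trans (cong₂ _xor_ (trans (e i a) (h i a)) (trans (gens-routed j i a) (cong (λ y → y i a) (sym (Any.lookup-index g∈)))))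
            (taut 2 (λ x y → (x xor y) xor x) (λ x y → y) (g i a) (w′ i a))))

      -- An edge lies in at most one piece, and the congestion bound of that piece already counts
      -- the lifts, the generators and the cycles of the piece together.
      total-load : ∀ a b → count (λ u → routes (u ↑ˡ G) a b) + countL (λ Z → Z a b) all-cycles ≤ load k β
      total-load a b = ℕ.≤-trans (ℕ.≤-reflexive (begin
        count (λ u → routes (u ↑ˡ G) a b) + countL at all-cycles  ≡⟨ cong (count (λ u → routes (u ↑ˡ G) a b) +_)
            (trans (countL-++ at (concatF (λ j → routes (m ↑ʳ j) ∷ [])) (concatF Child.cycles)) (cong₂ _+_
              (trans (countL-concatF at (λ j → routes (m ↑ʳ j) ∷ []))
                  (trans (sumℕ-cong {G} (λ j → ℕ.+-identityʳ (ind (routes (m ↑ʳ j) a b))))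
                  (sym (count-sum {G} (λ j → routes (m ↑ʳ j) a b)))))
              (countL-concatF at Child.cycles))) ⟩
        count (λ u → routes (u ↑ˡ G) a b) + (count (λ j → routes (m ↑ʳ j) a b) + sumℕ (λ i → countL at (Child.cycles i)))  ≡⟨ sym
            (ℕ.+-assoc (count (λ u → routes (u ↑ˡ G) a b)) _ _) ⟩
        (count (λ u → routes (u ↑ˡ G) a b) + count (λ j → routes (m ↑ʳ j) a b)) + sumℕ (λ i → countL at (Child.cycles i))  ≡⟨ cong
            (_+ sumℕ (λ i → countL at (Child.cycles i))) (sym (count-++ m (λ u → routes u a b))) ⟩
        count (λ u → routes u a b) + sumℕ (λ i → countL at (Child.cycles i))  ∎)) split
        where
        open ≡-Reasoning
        at : EdgeSet n → Bool
        at Z = Z a b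
        empty : ∀ i → Es i a b ≡ false → countL at (Child.cycles i) ≡ 0
        empty i f = go (Child.cycles i) (Child.cycles-cycle i)
          where
          go : ∀ Zs → All (Cycle (Es i)) Zs → countL at Zs ≡ 0
          go []       []       = refl
          go (Z ∷ Zs) (c ∷ cs) rewrite not-true {Z a b} (λ e → absurd (subset (proj₁ c) a b e) f) = go Zs cs
        split : count (λ u → routes u a b) + sumℕ (λ i → countL at (Child.cycles i)) ≤ load k β
        split with dichotomy (anyF (λ i → Es i a b))
        ... | inj₂ none = ℕ.≤-trans (ℕ.≤-reflexive (cong₂ _+_
                (count-zero (λ u → routes u a b) (λ u → par-zero _ (λ i → outside {i} (anyF-none _ none i) u)))
              (trans (sumℕ-cong (λ i → empty i (anyF-none _ none i))) (sumℕ-0 s)))) z≤n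
        ... | inj₁ some with anyF-elim (λ i → Es i a b) some
        ... | i , e = ℕ.≤-trans (ℕ.+-mono-≤ (ℕ.≤-reflexive (count-cong
                (λ u → par-only _ i (λ j j≢i → outside {j} (alone e j≢i) u)))) sum-only) (Child.congestion i a b)
          where
          sum-only : sumℕ (λ i → countL at (Child.cycles i)) ≤ countL at (Child.cycles i)
          sum-only = ℕ.≤-trans (sumℕ-only≤ (λ j → δ j i) (λ j → countL at (Child.cycles j) ) _ bound none)
              (ℕ.≤-trans (ℕ.*-monoˡ-≤ (countL at (Child.cycles i)) (count-only (λ j → δ j i) i (λ j → δ-true)))
                  (ℕ.≤-reflexive (ℕ.*-identityˡ _)))
            where
            none : ∀ j → δ j i ≡ false → countL at (Child.cycles j) ≡ 0
            none j f = empty j (alone e (λ j≡i → absurd (trans (cong (λ z → δ z i) j≡i) (δ-refl i)) f))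
            bound : ∀ j → countL at (Child.cycles j) ≤ countL at (Child.cycles i)
            bound j with j ≟ i
            ... | yes refl = ℕ.≤-refl
            ... | no j≢i   = ℕ.≤-trans (ℕ.≤-reflexive (empty j (alone e j≢i))) z≤n

      assembled : Realization (load k β) E v
      assembled = record
        { route        = λ u → routes (u ↑ˡ G)
        ; route-within = λ u → routes-within (u ↑ˡ G)
        ; route-deg    = λ u a → trans (routes-deg (u ↑ˡ G) a) (trans (cong (λ w → ∂ w a) (chainsˡ u)) (lift-∂ u a))
        ; cycles       = all-cycles
        ; cycles-cycle = All.++⁺ (All-concatF _ λ j → (routes-within (m ↑ʳ j) , λ a → trans (routes-deg (m ↑ʳ j) a)
                           (trans (cong (λ w → ∂ w a) (chainsʳ j)) (proj₂ (All.lookup gens-cycle (Mem.∈-lookup j)) a))) ∷ [])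
                           (All-concatF Child.cycles λ i → All.map (λ (p , z) → within-⊆ (Es⊆E i) p , z) (Child.cycles-cycle i))
        ; cycles-span  = λ S S-cycle → spanned (gens-span (degs S) (degs-cycle S-cycle)) S (proj₁ S-cycle) (λ _ _ → refl)
        ; congestion   = total-load }

  assemble : ∀ {s k β E D Es A} → Pieces {s} k β E D Es A → (∀ i → Realizable (load k β) (Es i) (A i)) → Realizable (load k β) E D
  assemble pieces realize = Assemble.assembled pieces realize

-- Generators of bounded congestion from the torso

count≤1 : ∀ {n} (p : Fin n → Bool) → (∀ i j → p i ≡ true → p j ≡ true → i ≡ j) → count p ≤ 1
count≤1 p h with dichotomy (anyF p)
... | inj₁ some = let (j , e) = anyF-elim p some in count-only p j (λ i e′ → h i j e′ e)
... | inj₂ none = ℕ.≤-trans (ℕ.≤-reflexive (count-zero p (anyF-none p none))) z≤n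

count-⋃ : ∀ {m l} (p : Fin m → Bool) (q : Fin m → Fin l → Bool) → (∀ u → p u ≡ true → ∃ λ t → q u t ≡ true) → count p ≤ sumℕ
    (λ t → count (λ u → q u t))
count-⋃ {l = zero}  p q h = ℕ.≤-reflexive (count-zero p (λ u → not-true λ e → case proj₁ (h u e) of λ ()))
count-⋃ {l = suc l} p q h = ℕ.≤-trans (count-∪ {q = λ u → q u zero} {r = λ u → anyF (λ t → q u (suc t))} split)
    (ℕ.+-monoʳ-≤ (count (λ u → q u zero)) (count-⋃ _ (λ u t → q u (suc t)) (λ u → anyF-elim (λ t → q u (suc t)))))
  where
  split : ∀ u → p u ≡ true → q u zero ≡ true ⊎ anyF (λ t → q u (suc t)) ≡ true
  split u e with h u e
  ... | zero  , t = inj₁ t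
  ... | suc i , t = inj₂ (anyF-intro _ i t)

count-injective : ∀ {n l} (p : Sub n) (e : Fin l → Fin n) → (∀ {α β} → e α ≡ e β → α ≡ β) → count (p ∘ e) ≤ count p
count-injective p e inj = begin
  count (p ∘ e)  ≡⟨ count-by-type e (p ∘ e) ⟩
  sumℕ (λ a → count (λ α → δ a (e α) ∧ p (e α)))  ≤⟨ sumℕ-mono fibre ⟩
  sumℕ (ind ∘ p)  ≡⟨ sym (count-sum p) ⟩
  count p  ∎
  where
  open ℕ.≤-Reasoning
  fibre : ∀ a → count (λ α → δ a (e α) ∧ p (e α)) ≤ ind (p a)
  fibre a with dichotomy (p a)
  ... | inj₁ t = subst (λ z → count (λ α → δ a (e α) ∧ p (e α)) ≤ ind z) (sym t)
        (count≤1 (λ α → δ a (e α) ∧ p (e α)) (λ α β h h′ → inj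
            (trans (sym (δ-true (proj₁ (∧-elim {δ a (e α)} h)))) (δ-true (proj₁ (∧-elim {δ a (e β)} h′))))))
  ... | inj₂ f = ℕ.≤-trans (ℕ.≤-reflexive (count-zero _ λ α → not-true λ h → absurd
          (subst (λ z → p z ≡ true) (sym (δ-true (proj₁ (∧-elim {δ a (e α)} h)))) (proj₂ (∧-elim {δ a (e α)} h))) f)) z≤n

sumSel-par : ∀ {m r} (B : Fin r → EdgeSet m) c u v → sumSel B c u v ≡ par (λ i → c i ∧ B i u v)
sumSel-par {r = zero}  B c u v = refl
sumSel-par {r = suc r} B c u v = cong ((c zero ∧ B zero u v) xor_) (sumSel-par (B ∘ suc) (c ∘ suc) u v)

links : ∀ {p q} → List (Mat p q) → List (Mat p q)
links []           = []
links (w ∷ [])     = []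
links (w ∷ x ∷ xs) = (w ⊕ x) ∷ links (x ∷ xs)

first : ∀ {p q} → List (Mat p q) → Mat p q
first []      u v = false
first (w ∷ _)     = w

links-span : ∀ {p q} (ws : List (Mat p q)) {w} → w ∈ ws → Span (links ws) (w ⊕ first ws)
links-span (w ∷ ws)     (here refl) = span-zero (λ u v → xor-same (w u v))
links-span (w ∷ x ∷ xs) {y} (there y∈) = span-resp (λ u v → taut 3 (λ y x w → (y xor x) xor (w xor x)) (λ y x w → y xor w) (y u v)
    (x u v) (w u v))
  (span-⊕ (span-⊆ there (links-span (x ∷ xs) y∈)) (span-member (here refl)))

links-all : ∀ {p q ℓ} {P : Mat p q → Set ℓ} → ∀ ws → (∀ {w x} → w ∈ ws → x ∈ ws → P (w ⊕ x)) → All P (links ws)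
links-all []           h = []
links-all (w ∷ [])     h = []
links-all (w ∷ x ∷ xs) h = h (here refl) (there (here refl)) ∷ links-all (x ∷ xs) (λ y∈ z∈ → h (there y∈) (there z∈))

links-count : ∀ {p q} (φ : Mat p q → Bool) → (∀ w x → φ (w ⊕ x) ≡ φ w xor φ x) → ∀ ws → countL φ (links ws) ≤ 2 * countL φ ws
links-count φ add []       = z≤n
links-count φ add (w ∷ ws) = ℕ.≤-trans (go w ws) (ℕ.≤-trans (ℕ.+-monoˡ-≤ (2 * countL φ ws) (ℕ.m≤n*m (ind (φ w)) 2))
    (ℕ.≤-reflexive (sym (ℕ.*-distribˡ-+ 2 (ind (φ w)) _))))
  where
  ind-xor : ∀ a b → ind (a xor b) ≤ ind a + ind b
  ind-xor true  true  = z≤n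
  ind-xor true  false = ℕ.≤-refl
  ind-xor false b     = ℕ.≤-refl
  go : ∀ w ws → countL φ (links (w ∷ ws)) ≤ ind (φ w) + 2 * countL φ ws
  go w []       = z≤n
  go w (x ∷ xs) = begin
    ind (φ (w ⊕ x)) + countL φ (links (x ∷ xs))  ≤⟨ ℕ.+-mono-≤
        (subst (λ z → ind z ≤ ind (φ w) + ind (φ x)) (sym (add w x)) (ind-xor (φ w) (φ x))) (go x xs) ⟩
    (ind (φ w) + ind (φ x)) + (ind (φ x) + 2 * countL φ xs)  ≡⟨ solve 3
        (λ a b c → (a :+ b) :+ (b :+ con 2 :* c) := a :+ con 2 :* (b :+ c)) refl (ind (φ w)) (ind (φ x)) (countL φ xs) ⟩
    ind (φ w) + 2 * (ind (φ x) + countL φ xs)  ∎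
    where
    open ℕ.≤-Reasoning
    open NatSolve.+-*-Solver

ahead : ∀ {n} → Fin n → Fin n → Bool
ahead α β = ⌊ toℕ α ℕ.<? toℕ β ⌋

ahead-xor : ∀ {n} {α β : Fin n} → α ≢ β → ahead α β xor ahead β α ≡ true
ahead-xor {α = α} {β} α≢β with toℕ α ℕ.<? toℕ β | toℕ β ℕ.<? toℕ α
... | yes p | yes q = contradiction q (ℕ.<-asym p)
... | yes p | no q  = refl
... | no p  | yes q = refl
... | no p  | no q  = contradiction (Fin.toℕ-injective (ℕ.≤-antisym (ℕ.≮⇒≥ q) (ℕ.≮⇒≥ p))) α≢β

-- At one cut of a piece only the at most `k * k` ordered pairs of its terminals matter. Each pair
-- is used by at most `b` basis cycles and, in comparisons of parallel virtual edges, at most twice.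
ownLoad : ℕ → ℕ → ℕ
ownLoad k b = k * (k * b) + k * (k * 2)

module Gens {n s : ℕ} (A : Fin s → Sub n) (k : ℕ) (sizes : ∀ i → count (A i) ≤ k)
  {l : ℕ} (e : Fin l → Fin n) (e-inj : ∀ {α β} → e α ≡ e β → α ≡ β) (A⊆e : ∀ i a → A i a ≡ true → ∃ λ α → e α ≡ a) where
  open Chains A

  both : Fin s → Fin l → Fin l → Bool
  both i α β = A i (e α) ∧ A i (e β)

  both-comm : ∀ i α β → both i α β ≡ both i β α
  both-comm i α β = ∧-comm (A i (e α)) (A i (e β))

  adjacent : Fin l → Fin l → Bool
  adjacent α β = not (δ α β) ∧ anyF (λ i → both i α β)

  anyF-cong : ∀ {t} {p q : Fin t → Bool} → (∀ i → p i ≡ q i) → anyF p ≡ anyF q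
  anyF-cong {zero}  h = refl
  anyF-cong {suc t} h = cong₂ _∨_ (h zero) (anyF-cong (h ∘ suc))

  K : Graph
  K = record
    { n = l ; adj = adjacent
    ; adj-sym = λ α β → cong₂ (λ x y → not x ∧ y) (δ-sym α β) (anyF-cong (λ i → both-comm i α β))
    ; adj-irrefl = λ α → cong (λ x → not x ∧ anyF (λ i → both i α α)) (δ-refl α) }

  provider : Fin l → Fin l → Fin s → List Chain
  provider α β i = if both i α β then hop i (e α) (e β) ∷ [] else []

  providers : Fin l → Fin l → List Chain
  providers α β = concatF (provider α β)

  rep : Fin l → Fin l → Chain
  rep α β = first (providers α β)

  providers-join : ∀ α β → All (λ w → Joins w (e α) (e β)) (providers α β)
  providers-join α β = All-concatF (provider α β) go
    where
    go : ∀ i → All (λ w → Joins w (e α) (e β)) (provider α β i)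
    go i with both i α β in eq
    ... | true  = hop-joins (proj₁ (∧-elim eq)) (proj₂ (∧-elim {A i (e α)} eq)) ∷ []
    ... | false = []

  provider∈ : ∀ {α β} i → both i α β ≡ true → hop i (e α) (e β) ∈ providers α β
  provider∈ {α} {β} i eq = Any-concatF (provider α β) i (subst (λ z → hop i (e α) (e β) ∈ (if z then hop i (e α) (e β) ∷ [] else []))
      (sym eq) (here refl))

  first-All : ∀ {P : Chain → Set} ws {w} → w ∈ ws → All P ws → P (first ws)
  first-All (w ∷ ws) _ (p ∷ _) = p

  rep-joins : ∀ {α β} → adjacent α β ≡ true → Joins (rep α β) (e α) (e β)
  rep-joins {α} {β} adj = let (i , q) = anyF-elim (λ i → both i α β) (proj₂ (∧-elim {not (δ α β)} adj)) in first-All (providers α β) (provider∈ i q) (providers-join α β)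

  rep-chain : ∀ α β → IsChain (rep α β)
  rep-chain α β with providers α β | providers-join α β
  ... | []    | _     = 𝟎-chain
  ... | _ ∷ _ | J ∷ _ = chain J

  providers-count : ∀ α β i X → countL (λ w → dot (w i) X) (providers α β) ≤ ind (both i α β)
  providers-count α β i X = begin
    countL φ (providers α β)  ≡⟨ countL-concatF φ (provider α β) ⟩
    sumℕ (λ j → countL φ (provider α β j))  ≤⟨ sumℕ-only≤ (λ j → δ j i) _ (ind (both i α β)) bound zeros ⟩
    count (λ j → δ j i) * ind (both i α β)  ≤⟨ ℕ.*-monoˡ-≤ (ind (both i α β)) (count-only (λ j → δ j i) i (λ j → δ-true)) ⟩
    1 * ind (both i α β)  ≡⟨ ℕ.*-identityˡ _ ⟩
    ind (both i α β)  ∎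
    where
    open ℕ.≤-Reasoning
    φ : Chain → Bool
    φ w = dot (w i) X
    zeros : ∀ j → δ j i ≡ false → countL φ (provider α β j) ≡ 0
    zeros j f with both j α β
    ... | false = refl
    ... | true rewrite trans (hop-dot j (e α) (e β) i X) (cong (_∧ (X (e α) xor X (e β))) (trans (δ-sym i j) f)) = refl
    bound : ∀ j → countL φ (provider α β j) ≤ ind (both i α β)
    bound j with j ≟ i
    ... | no j≢i = ℕ.≤-trans (ℕ.≤-reflexive (zeros j (δ-≢ j≢i))) z≤n
    ... | yes refl with both j α β
    ...   | false = z≤n
    ...   | true  = subst (_≤ 1) (sym (ℕ.+-identityʳ _)) (ind≤1 (φ (hop j (e α) (e β))))

  -- Each edge of `M` becomes the hop of one fixed piece that provides it; `ahead` takes only one of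
  -- its two orientations.
  Θ : EdgeSet l → Chain
  Θ M i a = par (λ α → par (λ β → (ahead α β ∧ M α β) ∧ rep α β i a))

  par-chain : ∀ {t} (f : Fin t → Chain) → (∀ i → IsChain (f i)) → IsChain (λ i a → par (λ j → f j i a))
  par-chain f h = record
    { inside = λ i a p → let (j , q) = par-witness (λ j → f j i a) p in inside (h j) i a q
    ; even = λ i → trans (par-comm (λ a j → f j i a)) (par-zero _ (λ j → even (h j) i)) }

  mask-chain : ∀ b {w} → IsChain w → IsChain (λ i a → b ∧ w i a)
  mask-chain true  W = W
  mask-chain false W = 𝟎-chain

  Θ-chain : ∀ M → IsChain (Θ M)
  Θ-chain M = par-chain _ λ α → par-chain _ λ β → mask-chain (ahead α β ∧ M α β) (rep-chain α β)

  Θ-⊕ : ∀ M M′ i a → Θ (M ⊕ M′) i a ≡ (Θ M ⊞ Θ M′) i a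
  Θ-⊕ M M′ i a = trans (par-cong (λ α → trans (par-cong (λ β →
      taut 4 (λ x y z w → (x ∧ (y xor z)) ∧ w) (λ x y z w → ((x ∧ y) ∧ w) xor ((x ∧ z) ∧ w)) (ahead α β) (M α β) (M′ α β) (rep α β i a)))
      (par-xor (λ β → (ahead α β ∧ M α β) ∧ rep α β i a) _)))
    (par-xor (λ α → par (λ β → (ahead α β ∧ M α β) ∧ rep α β i a)) _)

  Θ-zero : ∀ {M} → (∀ α β → M α β ≡ false) → ∀ i a → Θ M i a ≡ false
  Θ-zero {M} z i a = par-zero _ λ α → par-zero _ λ β → cong (_∧ rep α β i a) (trans (cong (ahead α β ∧_) (z α β)) (∧-zeroʳ (ahead α β)))

  Θ-cong : ∀ {M M′} → (∀ α β → M α β ≡ M′ α β) → ∀ i a → Θ M i a ≡ Θ M′ i a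
  Θ-cong h i a = par-cong λ α → par-cong λ β → cong (λ z → (ahead α β ∧ z) ∧ rep α β i a) (h α β)

  Θ-∂ : ∀ {M} → Within adjacent M → ∀ a → ∂ (Θ M) a ≡ par (λ α → δ (e α) a ∧ deg M α)
  Θ-∂ {M} W a = begin
    par (λ i → par (λ α → par (λ β → half α β ∧ rep α β i a)))  ≡⟨ par-comm (λ i α → par (λ β → half α β ∧ rep α β i a)) ⟩
    par (λ α → par (λ i → par (λ β → half α β ∧ rep α β i a)))  ≡⟨ par-cong (λ α → par-comm (λ i β → half α β ∧ rep α β i a)) ⟩
    par (λ α → par (λ β → par (λ i → half α β ∧ rep α β i a)))  ≡⟨ par-cong
        (λ α → par-cong (λ β → trans (sym (par-∧ˡ (half α β) (λ i → rep α β i a))) (ends α β))) ⟩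
    par (λ α → par (λ β → (half α β ∧ δ (e α) a) xor (half α β ∧ δ (e β) a))) ≡⟨ par-cong (λ α → par-xor (λ β → half α β ∧ δ (e α) a) _) ⟩
    par (λ α → par (λ β → half α β ∧ δ (e α) a) xor par (λ β → half α β ∧ δ (e β) a)) ≡⟨ par-xor
        (λ α → par (λ β → half α β ∧ δ (e α) a)) _ ⟩
    par (λ α → par (λ β → half α β ∧ δ (e α) a)) xor par (λ α → par (λ β → half α β ∧ δ (e β) a)) ≡⟨ cong
        (par (λ α → par (λ β → half α β ∧ δ (e α) a)) xor_) (par-comm (λ α β → half α β ∧ δ (e β) a)) ⟩
    par (λ α → par (λ β → half α β ∧ δ (e α) a)) xor par (λ α → par (λ β → half β α ∧ δ (e α) a)) ≡⟨ sym
        (par-xor (λ α → par (λ β → half α β ∧ δ (e α) a)) _) ⟩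
    par (λ α → par (λ β → half α β ∧ δ (e α) a) xor par (λ β → half β α ∧ δ (e α) a)) ≡⟨ par-cong
        (λ α → sym (par-xor (λ β → half α β ∧ δ (e α) a) _)) ⟩
    par (λ α → par (λ β → (half α β ∧ δ (e α) a) xor (half β α ∧ δ (e α) a))) ≡⟨ par-cong
        (λ α → trans (par-cong (merge-both α)) (sym (par-∧ˡ (δ (e α) a) (M α)))) ⟩
    par (λ α → δ (e α) a ∧ deg M α)  ∎
    where
    open ≡-Reasoning
    half : Fin l → Fin l → Bool
    half α β = ahead α β ∧ M α β
    ends : ∀ α β → half α β ∧ ∂ (rep α β) a ≡ (half α β ∧ δ (e α) a) xor (half α β ∧ δ (e β) a)
    ends α β with dichotomy (half α β)
    ... | inj₁ t = trans (cong (half α β ∧_) (boundary (rep-joins (subset W α β (proj₂ (∧-elim {ahead α β} t)))) a))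
            (∧-distribˡ-xor (half α β) (δ (e α) a) (δ (e β) a))
    ... | inj₂ f = trans (cong (_∧ ∂ (rep α β) a) f) (sym (cong (λ z → (z ∧ δ (e α) a) xor (z ∧ δ (e β) a)) f))
    merge-both : ∀ α β → (half α β ∧ δ (e α) a) xor (half β α ∧ δ (e α) a) ≡ δ (e α) a ∧ M α β
    merge-both α β with dichotomy (M α β)
    ... | inj₂ f = trans (cong₂ (λ x y → ((ahead α β ∧ x) ∧ δ (e α) a) xor ((ahead β α ∧ y) ∧ δ (e α) a)) f (trans (symmetric W β α) f))
          (trans (taut 3 (λ x y d → ((x ∧ false) ∧ d) xor ((y ∧ false) ∧ d)) (λ x y d → d ∧ false) (ahead α β) (ahead β α) (δ (e α) a))
              (cong (δ (e α) a ∧_) (sym f)))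
    ... | inj₁ t = trans (cong₂ (λ x y → ((ahead α β ∧ x) ∧ δ (e α) a) xor ((ahead β α ∧ y) ∧ δ (e α) a)) t (trans (symmetric W β α) t))
          (trans (taut 3 (λ x y d → ((x ∧ true) ∧ d) xor ((y ∧ true) ∧ d)) (λ x y d → d ∧ (x xor y)) (ahead α β) (ahead β α) (δ (e α) a))
            (cong (δ (e α) a ∧_) (trans (ahead-xor α≢β) (sym t))))
      where
      α≢β : α ≢ β
      α≢β refl = absurd (subset W α α t) (adj-irrefl K α)

  module WithBasis (b : ℕ) (bn : BnAtMost K b) where
    basis : CycleBasis K
    basis = proj₁ bn

    basis-within : ∀ μ → Within adjacent (member basis μ)
    basis-within μ = within (proj₁ (proj₁ (isCycle basis μ))) (proj₂ (proj₁ (isCycle basis μ)))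

    basis-deg : ∀ μ α → deg (member basis μ) α ≡ false
    basis-deg μ α = even⇒par (member basis μ α) (proj₂ (isCycle basis μ) α)

    -- gens₂ identifies the parallel virtual edges that different pieces provide for the same pair; as only consecutive
    -- ones are compared, each occurs at most twice.
    gens₁ gens₂ gens : List Chain
    gens₁ = concatF (λ μ → Θ (member basis μ) ∷ [])
    gens₂ = concatF (λ α → concatF (λ β → links (providers α β)))
    gens  = gens₁ ++ gens₂

    gens-cycle : All IsCycle gens
    gens-cycle = All.++⁺
      (All-concatF _ λ μ → (Θ-chain (member basis μ) , λ a → trans (Θ-∂ (basis-within μ) a)
        (par-zero _ λ α → trans (cong (δ (e α) a ∧_) (basis-deg μ α)) (∧-zeroʳ (δ (e α) a)))) ∷ [])
      (All-concatF _ λ α → All-concatF _ λ β → links-all (providers α β) λ w∈ x∈ →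
        Joins-cycle (All.lookup (providers-join α β) w∈) (All.lookup (providers-join α β) x∈))

    gens-load : ∀ i X → countL (λ g → dot (g i) X) gens ≤ ownLoad k b
    gens-load i X = ℕ.≤-trans (ℕ.≤-reflexive (countL-++ φ gens₁ gens₂)) (ℕ.+-mono-≤ first-load second-load)
      where
      open ℕ.≤-Reasoning
      φ : Chain → Bool
      φ w = dot (w i) X
      few : count (A i ∘ e) ≤ k
      few = ℕ.≤-trans (count-injective (A i) e e-inj) (sizes i)
      pair-load : ∀ (f : Fin l → Fin l → ℕ) c → (∀ α β → f α β ≤ c) → (∀ α β → both i α β ≡ false → f α β ≡ 0) → sumℕ
          (λ α → sumℕ (f α)) ≤ k * (k * c)
      pair-load f c bound zeros = ℕ.≤-trans (sumℕ-only≤ (A i ∘ e) _ (k * c)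
          (λ α → ℕ.≤-trans (sumℕ-only≤ (A i ∘ e) (f α) c (bound α) (λ β h → zeros α β (trans (cong (A i (e α) ∧_) h) (∧-zeroʳ _))))
              (ℕ.*-monoˡ-≤ c few))
          (λ α h → trans (sumℕ-cong (λ β → zeros α β (cong (_∧ A i (e β)) h))) (sumℕ-0 l))) (ℕ.*-monoˡ-≤ (k * c) few)
      second-load : countL φ gens₂ ≤ k * (k * 2)
      second-load = begin
        countL φ gens₂  ≡⟨ trans (countL-concatF φ (λ α → concatF (λ β → links (providers α β))))
            (sumℕ-cong (λ α → countL-concatF φ (λ β → links (providers α β)))) ⟩
        sumℕ (λ α → sumℕ (λ β → countL φ (links (providers α β))))  ≤⟨ sumℕ-mono
            (λ α → sumℕ-mono (λ β → ℕ.≤-trans (links-count φ (λ w x → dot-⊞ w x i X) (providers α β))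
            (ℕ.*-monoʳ-≤ 2 (providers-count α β i X)))) ⟩
        sumℕ (λ α → sumℕ (λ β → 2 * ind (both i α β)))  ≤⟨ pair-load (λ α β → 2 * ind (both i α β)) 2
            (λ α β → ℕ.*-monoʳ-≤ 2 (ind≤1 (both i α β))) (λ α β f → cong (λ z → 2 * ind z) f) ⟩
        k * (k * 2)  ∎
      hit : Fin (r basis) → Fin l → Fin l → Bool
      hit μ α β = (ahead α β ∧ member basis μ α β) ∧ dot (rep α β i) X
      Θ-dot : ∀ μ → φ (Θ (member basis μ)) ≡ par (λ α → par (hit μ α))
      Θ-dot μ = trans (par-cong (λ a → trans (par-∧ʳ (X a) (λ α → par (λ β → (ahead α β ∧ member basis μ α β) ∧ rep α β i a)))
          (par-cong (λ α → par-∧ʳ (X a) (λ β → (ahead α β ∧ member basis μ α β) ∧ rep α β i a)))))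
        (trans (par-comm (λ a α → par (λ β → ((ahead α β ∧ member basis μ α β) ∧ rep α β i a) ∧ X a))) (par-cong λ α →
          trans (par-comm (λ a β → ((ahead α β ∧ member basis μ α β) ∧ rep α β i a) ∧ X a)) (par-cong λ β →
            trans (par-cong (λ a → ∧-assoc (ahead α β ∧ member basis μ α β) (rep α β i a) (X a)))
                (sym (par-∧ˡ (ahead α β ∧ member basis μ α β) (λ a → rep α β i a ∧ X a))))))
      first-φ : ∀ ws → φ (first ws) ≡ true → countL φ ws ≢ 0
      first-φ []       t _ = absurd t (dot-𝟎 i X)
      first-φ (w ∷ ws) t z = case subst (λ q → ind q + countL φ ws ≡ 0) t z of λ ()
      rep-zero : ∀ α β → both i α β ≡ false → dot (rep α β i) X ≡ false
      rep-zero α β f = not-true λ t → first-φ (providers α β) t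
          (ℕ.n≤0⇒n≡0 (subst (λ z → countL φ (providers α β) ≤ ind z) f (providers-count α β i X)))
      first-load : countL φ gens₁ ≤ k * (k * b)
      first-load = begin
        countL φ gens₁  ≡⟨ trans (countL-concatF φ (λ μ → Θ (member basis μ) ∷ []))
            (trans (sumℕ-cong (λ μ → ℕ.+-identityʳ (ind (φ (Θ (member basis μ)))))) (sym (count-sum (λ μ → φ (Θ (member basis μ)))))) ⟩
        count (λ μ → φ (Θ (member basis μ)))  ≤⟨ count-⋃ _ (λ μ α → par (hit μ α)) (λ μ t → par-witness _ (trans (sym (Θ-dot μ)) t)) ⟩
        sumℕ (λ α → count (λ μ → par (hit μ α)))  ≤⟨ sumℕ-mono (λ α → count-⋃ _ (λ μ β → hit μ α β) (λ μ t → par-witness (hit μ α) t)) ⟩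
        sumℕ (λ α → sumℕ (λ β → count (λ μ → hit μ α β)))  ≤⟨ pair-load _ b bound
            (λ α β f → count-zero (λ μ → hit μ α β) (λ μ → trans (cong ((ahead α β ∧ member basis μ α β) ∧_) (rep-zero α β f))
            (∧-zeroʳ _))) ⟩
        k * (k * b)  ∎
        where
        bound : ∀ α β → count (λ μ → hit μ α β) ≤ b
        bound α β = ℕ.≤-trans (count-mono {q = λ μ → member basis μ α β} (λ μ t → proj₂ (∧-elim {ahead α β} (proj₁ (∧-elim t))))) edge
          where
          edge : count (λ μ → member basis μ α β) ≤ b
          edge with dichotomy (adjacent α β)
          ... | inj₁ t = proj₂ bn α β t
          ... | inj₂ f = ℕ.≤-trans (ℕ.≤-reflexive (count-zero _ (λ μ → not-true λ t → absurd (subset (basis-within μ) α β t) f))) z≤n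

    links⊆gens : ∀ α β {Z} → Z ∈ links (providers α β) → Z ∈ gens
    links⊆gens α β z = Any.++⁺ʳ gens₁ (Any-concatF (λ α → concatF (λ β → links (providers α β))) α
        (Any-concatF (λ β → links (providers α β)) β z))

    -- Equivalence, modulo the generators, to an edge set of `K`. It moves the question of spanning
    -- to `K`, where a basis is given.
    Reduces : Chain → Set
    Reduces z = ∃ λ M → Within adjacent M × Span gens (z ⊞ Θ M)

    reduces-resp : ∀ {z z′} → (∀ i a → z i a ≡ z′ i a) → Reduces z → Reduces z′
    reduces-resp h (M , W , σ) = M , W , span-resp (λ i a → cong (_xor Θ M i a) (h i a)) σ

    reduces-zero : Reduces 𝟎
    reduces-zero = (λ _ _ → false) , within (λ _ _ → refl) (λ _ _ ()) , span-zero (λ i a → Θ-zero (λ _ _ → refl) i a)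

    reduces-⊞ : ∀ {z z′} → Reduces z → Reduces z′ → Reduces (z ⊞ z′)
    reduces-⊞ {z} {z′} (M , W , σ) (M′ , W′ , σ′) = M ⊕ M′ , within-⊕ W W′ , span-resp (λ i a →
        trans (taut 4 (λ x y p q → (x xor p) xor (y xor q)) (λ x y p q → (x xor y) xor (p xor q)) (z i a) (z′ i a) (Θ M i a) (Θ M′ i a))
          (cong ((z ⊞ z′) i a xor_) (sym (Θ-⊕ M M′ i a)))) (span-⊕ σ σ′)

    reduces-par : ∀ {t} (f : Fin t → Chain) → (∀ j → Reduces (f j)) → Reduces (λ i a → par (λ j → f j i a))
    reduces-par {zero}  f h = reduces-zero
    reduces-par {suc t} f h = reduces-⊞ {f zero} {λ i a → par (λ j → f (suc j) i a)} (h zero) (reduces-par (f ∘ suc) (h ∘ suc))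

    edge : Fin l → Fin l → EdgeSet l
    edge α β γ η = (δ α γ ∧ δ β η) ∨ (δ β γ ∧ δ α η)

    edge-within : ∀ {α β} → adjacent α β ≡ true → Within adjacent (edge α β)
    edge-within {α} {β} adj = within (λ γ η → taut 4 (λ p q r s → (p ∧ q) ∨ (r ∧ s)) (λ p q r s → (s ∧ r) ∨ (q ∧ p)) (δ α γ) (δ β η)
        (δ β γ) (δ α η)) sub
      where
      sub : ∀ γ η → edge α β γ η ≡ true → adjacent γ η ≡ true
      sub γ η t with ∨-elim {δ α γ ∧ δ β η} t
      ... | inj₁ p = subst₂ (λ x y → adjacent x y ≡ true) (δ-true (proj₁ (∧-elim p))) (δ-true {i = β} (proj₂ (∧-elim {δ α γ} p))) adj
      ... | inj₂ p = subst₂ (λ x y → adjacent x y ≡ true) (δ-true (proj₁ (∧-elim p))) (δ-true {i = α} (proj₂ (∧-elim {δ β γ} p)))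
              (trans (adj-sym K β α) adj)

    edge-Θ : ∀ {α β} → ahead α β ≡ true → ∀ i a → Θ (edge α β) i a ≡ rep α β i a
    edge-Θ {α} {β} asc i a = trans (par-only _ α λ γ γ≢α → par-zero _ λ η → cong (_∧ rep γ η i a) (not-true λ t → γ≢α (proj₁ (at γ η t))))
      (trans (par-only _ β λ η η≢β → cong (_∧ rep α η i a) (not-true λ t → η≢β (proj₂ (at α η t))))
        (cong (_∧ rep α β i a) (∧-intro asc (∨-introˡ _ (∧-intro (δ-refl α) (δ-refl β))))))
      where
      at : ∀ γ η → ahead γ η ∧ edge α β γ η ≡ true → γ ≡ α × η ≡ β
      at γ η t with ∧-elim {ahead γ η} t
      ... | h , t′ with ∨-elim {δ α γ ∧ δ β η} t′
      ... | inj₁ p = sym (δ-true (proj₁ (∧-elim p))) , sym (δ-true (proj₂ (∧-elim {δ α γ} p)))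
      ... | inj₂ p with δ-true {i = β} (proj₁ (∧-elim p)) | δ-true {i = α} (proj₂ (∧-elim {δ β γ} p))
      ... | refl | refl with toℕ α ℕ.<? toℕ β | toℕ β ℕ.<? toℕ α
      ... | yes x | yes y = contradiction x (ℕ.<-asym y)
      ... | no _  | yes _ = case asc of λ ()
      ... | yes _ | no _  = case h of λ ()

    reduces-ahead : ∀ i {α β} → α ≢ β → both i α β ≡ true → ahead α β ≡ true → Reduces (hop i (e α) (e β))
    reduces-ahead i {α} {β} α≢β q h = edge α β , edge-within (∧-intro (cong not (δ-≢ α≢β)) (anyF-intro _ i q)) ,
      span-resp (λ j a → cong (hop i (e α) (e β) j a xor_) (sym (edge-Θ h j a)))
          (span-⊆ (links⊆gens α β) (links-span (providers α β) (provider∈ i q)))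

    reduces-hop : ∀ i {α β} → both i α β ≡ true → Reduces (hop i (e α) (e β))
    reduces-hop i {α} {β} q with α ≟ β
    ... | yes refl = reduces-resp (λ j a → sym (trans (cong (δ j i ∧_) (xor-same (δ (e α) a))) (∧-zeroʳ (δ j i)))) reduces-zero
    ... | no α≢β with dichotomy (ahead α β)
    ... | inj₁ h = reduces-ahead i α≢β q h
    ... | inj₂ h = reduces-resp (λ j a → cong (δ j i ∧_) (xor-comm (δ (e β) a) (δ (e α) a)))
            (reduces-ahead i (α≢β ∘ sym) (trans (both-comm i β α) q)
          (trans (cong (_xor ahead β α) (sym h)) (ahead-xor α≢β)))

    -- In each coordinate, an even set is the sum of the hops from its elements to one fixed element
    -- `root`; the copies of `root` cancel by evenness.
    reduces : ∀ {z} → IsChain z → Reduces z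
    reduces {z} Z = reduces-resp sums (reduces-par _ λ i → reduces-par _ λ a → reduces-term i a)
      where
      some : Fin s → Bool
      some i = anyF (z i)
      root : Fin s → Fin n → Fin n
      root i a with dichotomy (some i)
      ... | inj₁ t = proj₁ (anyF-elim (z i) t)
      ... | inj₂ _ = a
      term : Fin s → Fin n → Chain
      term i a j c = z i a ∧ hop i a (root i a) j c
      reduces-term : ∀ i a → Reduces (term i a)
      reduces-term i a with dichotomy (z i a)
      ... | inj₂ f = reduces-resp (λ j c → sym (cong (_∧ hop i a (root i a) j c) f)) reduces-zero
      ... | inj₁ t = reduces-resp (λ j c → sym (cong (_∧ hop i a (root i a) j c) t)) two
        where
        root-in : z i (root i a) ≡ true
        root-in with dichotomy (some i)
        ... | inj₁ t′ = proj₂ (anyF-elim (z i) t′)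
        ... | inj₂ _  = t
        two : Reduces (hop i a (root i a))
        two with A⊆e i a (inside Z i a t) | A⊆e i (root i a) (inside Z i _ root-in)
        ... | α , eα | β , eβ = subst₂ (λ x y → Reduces (hop i x y)) eα eβ
          (reduces-hop i (∧-intro (subst (λ x → A i x ≡ true) (sym eα) (inside Z i a t))
              (subst (λ x → A i x ≡ true) (sym eβ) (inside Z i _ root-in))))
      sums : ∀ j c → par (λ i → par (λ a → term i a j c)) ≡ z j c
      sums j c = trans (par-only _ j λ i i≢j → par-zero _ λ a → trans
          (cong (λ x → z i a ∧ (x ∧ (δ a c xor δ (root i a) c))) (δ-≢ (i≢j ∘ sym))) (∧-zeroʳ (z i a)))
        (trans (par-cong (λ a → trans (cong (λ x → z j a ∧ (x ∧ (δ a c xor δ (root j a) c))) (δ-refl j))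
            (∧-distribˡ-xor (z j a) (δ a c) (δ (root j a) c))))
          (trans (par-xor (λ a → z j a ∧ δ a c) (λ a → z j a ∧ δ (root j a) c))
              (trans (cong₂ _xor_ (trans (par-cong (λ a → ∧-comm (z j a) (δ a c))) (par-δ (z j) c)) roots) (xor-identityʳ (z j c)))))
        where
        roots : par (λ a → z j a ∧ δ (root j a) c) ≡ false
        roots with dichotomy (some j)
        ... | inj₁ t = trans (sym (par-∧ʳ (δ (proj₁ (anyF-elim (z j) t)) c) (z j))) (cong (_∧ δ (proj₁ (anyF-elim (z j) t)) c) (even Z j))
        ... | inj₂ f = par-zero _ (λ a → cong (_∧ δ a c) (anyF-none (z j) f a))

    span-∂ : ∀ {gs w} → All IsCycle gs → Span gs w → ∀ a → ∂ w a ≡ false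
    span-∂ C (span-zero z) a = par-zero _ (λ i → z i a)
    span-∂ {w = w} C (span-add {S′ = w′} {g} g∈ σ h) a = trans (par-cong (λ i → h i a))
        (trans (∂-⊞ g w′ a) (cong₂ _xor_ (proj₂ (All.lookup C g∈) a) (span-∂ C σ a)))

    -- Since `z` and the generators are cycles, so is `Θ M`, and injectivity of `e` makes `M` a
    -- cycle of `K`. Expanding `M` in the basis expresses `Θ M` by `gens₁`.
    gens-span : ∀ z → IsCycle z → Span gens z
    gens-span z (Z , ∂z) with reduces Z
    ... | M , W , σ = span-resp (λ i a → taut 2 (λ x y → (x xor y) xor y) (λ x y → x) (z i a) (Θ M i a)) (span-⊕ σ ΘM)
      where
      ∂Θ : ∀ a → ∂ (Θ M) a ≡ false
      ∂Θ a = trans (cong (_xor ∂ (Θ M) a) (sym (∂z a))) (trans (sym (∂-⊞ z (Θ M) a)) (span-∂ gens-cycle σ a))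
      M-deg : ∀ γ → deg M γ ≡ false
      M-deg γ = trans (sym (trans (par-cong (λ α → cong (_∧ deg M α)
          (same-truth (λ t → subst (λ x → δ x γ ≡ true) (sym (e-inj (δ-true t))) (δ-refl γ))
          (λ t → subst (λ x → δ (e α) (e x) ≡ true) (δ-true t) (δ-refl (e α)))))) (par-δ (deg M) γ))) (trans (sym (Θ-∂ W (e γ))) (∂Θ (e γ)))
      sel : Σ (Fin (r basis) → Bool) λ c → sumSel (member basis) c ≈E M
      sel = spanning basis M ((symmetric W , subset W) , λ γ → par⇒even (M γ) (M-deg γ))
      c : Fin (r basis) → Bool
      c = proj₁ sel
      ΘM : Span gens (Θ M)
      ΘM = span-resp expand (span-par (λ μ i a → c μ ∧ Θ (member basis μ) i a) part)
        where
        part : ∀ μ → Span gens (λ i a → c μ ∧ Θ (member basis μ) i a)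
        part μ with c μ
        ... | true  = span-member (Any.++⁺ˡ (Any-concatF (λ μ → Θ (member basis μ) ∷ []) μ (here refl)))
        ... | false = span-zero (λ _ _ → refl)
        Θ-par : ∀ {t} (c : Fin t → Bool) (f : Fin t → EdgeSet l) i a → par (λ μ → c μ ∧ Θ (f μ) i a) ≡ Θ (sumSel f c) i a
        Θ-par {zero}  c f i a = sym (Θ-zero (λ _ _ → refl) i a)
        Θ-par {suc t} c f i a = trans (cong₂ _xor_ (head (c zero)) (Θ-par (c ∘ suc) (f ∘ suc) i a))
            (sym (Θ-⊕ (λ α β → c zero ∧ f zero α β) (sumSel (f ∘ suc) (c ∘ suc)) i a))
          where
          head : ∀ b → b ∧ Θ (f zero) i a ≡ Θ (λ α β → b ∧ f zero α β) i a
          head true  = refl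
          head false = sym (Θ-zero (λ _ _ → refl) i a)
        expand : ∀ i a → par (λ μ → c μ ∧ Θ (member basis μ) i a) ≡ Θ M i a
        expand i a = trans (Θ-par c (member basis) i a) (Θ-cong (proj₂ sel) i a)

-- The pieces of a tree-decomposition

elems-injective : ∀ {n} (p : Sub n) {α β} → elems p α ≡ elems p β → α ≡ β
elems-injective {suc n} p {α} {β} e with p zero
elems-injective {suc n} p {zero}  {zero}  e | true  = refl
elems-injective {suc n} p {suc α} {suc β} e | true  = cong suc (elems-injective (p ∘ suc) (Fin.suc-injective e))
elems-injective {suc n} p {α}     {β}     e | false = elems-injective (p ∘ suc) (Fin.suc-injective e)

elems-onto : ∀ {n} (p : Sub n) a → p a ≡ true → ∃ λ α → elems p α ≡ a
elems-onto {suc n} p a e with p zero in eq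
elems-onto {suc n} p zero    e | true  = zero , refl
elems-onto {suc n} p (suc a) e | true  = let (α , h) = elems-onto (p ∘ suc) a e in suc α , cong suc h
elems-onto {suc n} p zero    e | false = absurd e eq
elems-onto {suc n} p (suc a) e | false = let (α , h) = elems-onto (p ∘ suc) a e in α , cong suc h

realizable-empty : ∀ {n} N (E : EdgeSet n) (D : Sub n) → (∀ u v → E u v ≡ false) → (∀ a → D a ≡ false) → Realizable N E D
realizable-empty {n} N E D noE noD {m} v v⊆D v-even v-load = record
  { route = λ _ _ _ → false ; route-within = λ _ → within (λ _ _ → refl) (λ _ _ ())
  ; route-deg = λ u a → trans (par-zero {n} (λ _ → false) (λ _ → refl)) (sym (not-true λ e → absurd (v⊆D u a e) (noD a)))
  ; cycles = [] ; cycles-cycle = [] ; cycles-span = λ S (W , _) → span-zero (λ u v → not-true λ e → absurd (subset W u v e) (noE u v))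
  ; congestion = λ a b → ℕ.≤-trans (ℕ.≤-reflexive (trans (ℕ.+-identityʳ _) (count-zero {m} (λ _ → false) (λ _ → refl)))) z≤n }

single : ∀ {n} → Fin n → Fin n → EdgeSet n
single p q u v = (δ p u ∧ δ q v) ∨ (δ q u ∧ δ p v)

single-sym : ∀ {n} (p q u v : Fin n) → single p q u v ≡ single p q v u
single-sym p q u v = taut 4 (λ a b c d → (a ∧ b) ∨ (c ∧ d)) (λ a b c d → (d ∧ c) ∨ (b ∧ a)) (δ p u) (δ q v) (δ q u) (δ p v)

single-self : ∀ {n} (p q : Fin n) → single p q p q ≡ true
single-self p q = ∨-introˡ _ (∧-intro (δ-refl p) (δ-refl q))

single-elim : ∀ {n} {p q u v : Fin n} → single p q u v ≡ true → (p ≡ u × q ≡ v) ⊎ (q ≡ u × p ≡ v)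
single-elim {p = p} {q} {u} {v} e with ∨-elim {δ p u ∧ δ q v} e
... | inj₁ h = inj₁ (δ-true (proj₁ (∧-elim h)) , δ-true (proj₂ (∧-elim {δ p u} h)))
... | inj₂ h = inj₂ (δ-true (proj₁ (∧-elim h)) , δ-true (proj₂ (∧-elim {δ q u} h)))

single-deg : ∀ {n} {p q : Fin n} → p ≢ q → ∀ u → deg (single p q) u ≡ δ p u xor δ q u
single-deg {p = p} {q} p≢q u = begin
  par (λ v → (δ p u ∧ δ q v) ∨ (δ q u ∧ δ p v))  ≡⟨ par-cong (λ v → exclusive v) ⟩
  par (λ v → (δ p u ∧ δ q v) xor (δ q u ∧ δ p v))  ≡⟨ par-xor (λ v → δ p u ∧ δ q v) (λ v → δ q u ∧ δ p v) ⟩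
  par (λ v → δ p u ∧ δ q v) xor par (λ v → δ q u ∧ δ p v) ≡⟨ cong₂ _xor_ (sum-to q (δ p u)) (sum-to p (δ q u)) ⟩
  δ p u xor δ q u  ∎
  where
  open ≡-Reasoning
  sum-to : ∀ x b → par (λ v → b ∧ δ x v) ≡ b
  sum-to x b = trans (sym (par-∧ˡ b (δ x))) (trans (cong (b ∧_) (par-δ₁ x)) (∧-identityʳ b))
  exclusive : ∀ v → (δ p u ∧ δ q v) ∨ (δ q u ∧ δ p v) ≡ (δ p u ∧ δ q v) xor (δ q u ∧ δ p v)
  exclusive v with p ≟ u | q ≟ u
  ... | no _     | _        = refl
  ... | yes refl | yes refl = contradiction refl p≢q
  ... | yes _    | no _     = taut 1 (λ x → x ∨ false) (λ x → x xor false) (δ q v)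

-- An even demand on two terminals is empty or both of them, so the edge is used exactly by the
-- demands that cross the cut around `p`. A single edge contains no nonzero cycle.
realizable-edge : ∀ {n} N {p q : Fin n} → p ≢ q → Realizable N (single p q) (λ a → δ p a ∨ δ q a)
realizable-edge {n} N {p} {q} p≢q {m} v v⊆D v-even v-load = record
  { route = λ u a b → v u p ∧ single p q a b
  ; route-within = λ u → within (λ a b → cong (v u p ∧_) (single-sym p q a b)) (λ a b e → proj₂ (∧-elim {v u p} e))
  ; route-deg = λ u a → trans (sym (par-∧ˡ (v u p) (single p q a))) (trans (cong (v u p ∧_) (single-deg p≢q a)) (sym (demand u a)))
  ; cycles = [] ; cycles-cycle = []
  ; cycles-span = λ S (W , z) → span-zero λ a b → not-true λ e → absurd (at-pq W a b e) (no-pq W z)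
  ; congestion = λ a b → ℕ.≤-trans (ℕ.≤-reflexive (ℕ.+-identityʳ _)) (ℕ.≤-trans (count-mono {q = λ u → dot (v u) (δ p)}
      (λ u e → trans (par-comm-δ u) (proj₁ (∧-elim {v u p} e)))) (v-load (δ p))) }
  where
  par-comm-δ : ∀ u → dot (v u) (δ p) ≡ v u p
  par-comm-δ u = trans (par-cong (λ a → ∧-comm (v u a) (δ p a))) (par-δ′ (v u) p)
  outside : ∀ u a → a ≢ p → a ≢ q → v u a ≡ false
  outside u a a≢p a≢q = not-true λ e → case ∨-elim {δ p a} (v⊆D u a e) of λ where
    (inj₁ h) → a≢p (sym (δ-true h))
    (inj₂ h) → a≢q (sym (δ-true h))
  balanced : ∀ u → v u p ≡ v u q
  balanced u = xor-cancel (trans (sym (trans (par-cong pointwise) (trans (par-xor (λ a → δ p a ∧ v u a) (λ a → δ q a ∧ v u a))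
      (cong₂ _xor_ (par-δ′ (v u) p) (par-δ′ (v u) q))))) (v-even u))
    where
    pointwise : ∀ a → v u a ≡ (δ p a ∧ v u a) xor (δ q a ∧ v u a)
    pointwise a with p ≟ a | q ≟ a
    ... | yes refl | yes refl = contradiction refl p≢q
    ... | yes refl | no _     = sym (xor-identityʳ _)
    ... | no _     | yes refl = refl
    ... | no p≢a   | no q≢a   = outside u a (p≢a ∘ sym) (q≢a ∘ sym)
  demand : ∀ u a → v u a ≡ v u p ∧ (δ p a xor δ q a)
  demand u a with p ≟ a | q ≟ a
  ... | yes refl | yes refl = contradiction refl p≢q
  ... | yes refl | no _     = sym (∧-identityʳ _)
  ... | no _     | yes refl = trans (sym (balanced u)) (sym (∧-identityʳ _))
  ... | no p≢a   | no q≢a   = trans (outside u a (p≢a ∘ sym) (q≢a ∘ sym)) (sym (∧-zeroʳ _))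
  no-pq : ∀ {S} → Within (single p q) S → (∀ a → deg S a ≡ false) → S p q ≡ false
  no-pq {S} W z = trans (sym (par-only (S p) q λ b b≢q → not-true λ e → case single-elim {p = p} {q} {p} {b} (subset W p b e) of λ where
    (inj₁ (_ , h)) → b≢q (sym h)
    (inj₂ (h , _)) → p≢q (sym h))) (z p)
  at-pq : ∀ {S} → Within (single p q) S → ∀ a b → S a b ≡ true → S p q ≡ true
  at-pq W a b e with single-elim {p = p} {q} {a} {b} (subset W a b e)
  ... | inj₁ (refl , refl) = e
  ... | inj₂ (refl , refl) = trans (symmetric W p q) e

-- Induction over the nodes of the tree

module Decomposition (G : Graph) (D : TreeDecomposition G) (isD : IsTreeDecomposition G D) (k : ℕ) (adh : AdhesionAtMost D k)
  (b : ℕ) (bn : ∀ t H → H ⊆G torso D t → BnAtMost H b) where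

  Vertex Node : Set
  Vertex = Fin (n G)
  Node   = Fin (suc (m D))

  data Below (c : Node) : Node → Set where
    self  : Below c c
    child : ∀ i → Below c (parent D i) → Below c (suc i)

  below-≤ : ∀ {c t} → Below c t → toℕ c ≤ toℕ t
  below-≤ self        = ℕ.≤-refl
  below-≤ (child i h) = ℕ.≤-trans (below-≤ h) (ℕ.m≤n⇒m≤1+n (parent< D i))

  below-antisym : ∀ {c t} → Below c t → Below t c → c ≡ t
  below-antisym p q = Fin.toℕ-injective (ℕ.≤-antisym (below-≤ p) (below-≤ q))

  below-trans : ∀ {a c t} → Below a c → Below c t → Below a t
  below-trans p self        = p
  below-trans p (child i q) = child i (below-trans p q)

  below? : ∀ c t → Dec (Below c t)
  below? c t = go (toℕ t) t ℕ.≤-refl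
    where
    go : ∀ d t → toℕ t ≤ d → Dec (Below c t)
    go d t le with c ≟ t
    go d t le | yes refl = yes self
    go d zero le | no c≢t = no λ { self → c≢t refl }
    go (suc d) (suc i) (s≤s le) | no c≢t with go d (parent D i) (ℕ.≤-trans (parent< D i) le)
    ... | yes h = yes (child i h)
    ... | no ¬h = no λ { self → c≢t refl ; (child .i h) → ¬h h }

  below-root : ∀ t → Below zero t
  below-root t = go (toℕ t) t ℕ.≤-refl
    where
    go : ∀ d t → toℕ t ≤ d → Below zero t
    go d zero le = self
    go (suc d) (suc i) (s≤s le) = child i (go d (parent D i) (ℕ.≤-trans (parent< D i) le))

  below-child : ∀ {c t} → Below c t → c ≡ t ⊎ ∃ λ i → parent D i ≡ c × Below (suc i) t
  below-child self = inj₁ refl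
  below-child (child i h) with below-child h
  ... | inj₁ refl          = inj₂ (i , refl , self)
  ... | inj₂ (j , e , h′) = inj₂ (j , e , child i h′)

  below-comparable : ∀ {c c′ t} → Below c t → Below c′ t → Below c c′ ⊎ Below c′ c
  below-comparable self        q           = inj₂ q
  below-comparable p           self        = inj₁ p
  below-comparable (child i p) (child .i q) = below-comparable p q

  not-below-child : ∀ {i c} → parent D i ≡ c → ¬ Below (suc i) c
  not-below-child {i} refl h = ℕ.<⇒≱ (s≤s (parent< D i)) (below-≤ h)

  siblings : ∀ {i j t} → parent D i ≡ parent D j → Below (suc i) t → Below (suc j) t → i ≡ j
  siblings {i} {j} e p q = [ descend e , sym ∘ descend (sym e) ]′ (below-comparable p q)
    where
    descend : ∀ {i j} → parent D i ≡ parent D j → Below (suc i) (suc j) → i ≡ j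
    descend e self        = refl
    descend e (child _ h) = ⊥-elim (not-below-child e h)

  connected-head : ∀ {P s t} → ConnectedIn D P s t → P s ≡ true
  connected-head (here s p)           = p
  connected-head (step s t u p _ _)   = p

  -- The only tree edge between the nodes below `c` and the others joins `c` to its parent.
  leave : ∀ {P c s t} → ConnectedIn D P s t → Below c s → ¬ Below c t → ∃ λ i → c ≡ suc i × P (suc i) ≡ true × P (parent D i) ≡ true
  leave (here s p) h ¬h = contradiction h ¬h
  leave {c = c} (step s t u p edge path) h ¬h with below? c t
  ... | yes h′ = leave path h′ ¬h
  leave (step .(suc i) .(parent D i) u p (up i) path) self ¬h | no _ = i , refl , p , connected-head path
  leave (step .(suc i) .(parent D i) u p (up i) path) (child .i h) ¬h | no ¬h′ = contradiction h ¬h′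
  leave (step .(parent D i) .(suc i) u p (down i) path) h ¬h | no ¬h′ = contradiction (child i h) ¬h′

  separated : ∀ {c s t v} → bag D s v ≡ true → bag D t v ≡ true → Below c s → ¬ Below c t → adhesion D c v ≡ true
  separated {v = v} p q h ¬h with leave (proj₂ (proj₂ isD) v _ _ p q) h ¬h
  ... | i , refl , a , a′ = ∧-intro a a′

  -- The home of an edge is the topmost node whose bag contains both ends.
  home : Node → Vertex → Vertex → Bool
  home t u v = (bag D t u ∧ bag D t v) ∧ not (adhesion D t u ∧ adhesion D t v)

  home-sym : ∀ t u v → home t u v ≡ home t v u
  home-sym t u v = cong₂ (λ x y → x ∧ not y) (∧-comm (bag D t u) (bag D t v)) (∧-comm (adhesion D t u) (adhesion D t v))

  home-bagˡ : ∀ {t u v} → home t u v ≡ true → bag D t u ≡ true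
  home-bagˡ e = proj₁ (∧-elim (proj₁ (∧-elim e)))

  -- Otherwise both ends would also occur outside the subtree of `t`, hence lie in the adhesion of
  -- `t`, which a home excludes.
  home-below : ∀ {t t′ u v} → home t u v ≡ true → bag D t′ u ≡ true → bag D t′ v ≡ true → Below t t′
  home-below {t} {t′} {u} {v} h p q with below? t t′
  ... | yes y = y
  ... | no ¬y = absurd (proj₂ (∧-elim {bag D t u ∧ bag D t v} h)) (cong not (∧-intro (separated (home-bagˡ {t} {u} {v} h) p self ¬y)
          (separated (home-bagˡ {t} {v} {u} (trans (home-sym t v u) h)) q self ¬y)))

  home-unique : ∀ {t t′ u v} → home t u v ≡ true → home t′ u v ≡ true → t ≡ t′
  home-unique {t} {t′} {u} {v} h h′ = below-antisym
    (home-below {t} h (home-bagˡ {t′} {u} {v} h′) (home-bagˡ {t′} {v} {u} (trans (home-sym t′ v u) h′)))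
    (home-below {t′} h′ (home-bagˡ {t} {u} {v} h) (home-bagˡ {t} {v} {u} (trans (home-sym t v u) h)))

  -- Climb to the parent as long as both ends lie in the adhesion; the adhesion of the root is
  -- empty.
  home-exists : ∀ {u v} → adj G u v ≡ true → ∃ λ t → home t u v ≡ true
  home-exists {u} {v} e = let (t , h) = proj₁ (proj₂ isD) u v e in go (toℕ t) t ℕ.≤-refl h
    where
    go : ∀ d t → toℕ t ≤ d → bag D t u ∧ bag D t v ≡ true → ∃ λ t → home t u v ≡ true
    go d t le h with dichotomy (adhesion D t u ∧ adhesion D t v)
    go d t le h | inj₂ f = t , ∧-intro h (cong not f)
    go (suc d) (suc i) (s≤s le) h | inj₁ a = let (p , q) = ∧-elim {adhesion D (suc i) u} a in
      go d (parent D i) (ℕ.≤-trans (parent< D i) le) (∧-intro (proj₂ (∧-elim {bag D (suc i) u} p)) (proj₂ (∧-elim {bag D (suc i) v} q)))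

  abstract
    E : Node → EdgeSet (n G)
    E c u v = adj G u v ∧ anyF (λ t → ⌊ below? c t ⌋ ∧ home t u v)

    E-intro : ∀ {c t u v} → adj G u v ≡ true → Below c t → home t u v ≡ true → E c u v ≡ true
    E-intro {c} {t} {u} {v} a h o = ∧-intro a (anyF-intro (λ t → ⌊ below? c t ⌋ ∧ home t u v) t (∧-intro yes-true o))
      where
      yes-true : ⌊ below? c t ⌋ ≡ true
      yes-true with below? c t
      ... | yes _ = refl
      ... | no ¬h = contradiction h ¬h

    E-adj : ∀ {c u v} → E c u v ≡ true → adj G u v ≡ true
    E-adj e = proj₁ (∧-elim e)

    E-home : ∀ {c u v} → E c u v ≡ true → ∃ λ t → Below c t × home t u v ≡ true
    E-home {c} {u} {v} e with anyF-elim (λ t → ⌊ below? c t ⌋ ∧ home t u v) (proj₂ (∧-elim {adj G u v} e))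
    ... | t , p with below? c t
    ... | yes h = t , h , p

  E-sym : ∀ c u v → E c u v ≡ E c v u
  E-sym c u v = same-truth (f u v) (f v u)
    where
    f : ∀ u v → E c u v ≡ true → E c v u ≡ true
    f u v e = let (t , h , o) = E-home {c} {u} {v} e in E-intro (trans (adj-sym G v u) (E-adj {c} e)) h (trans (home-sym t v u) o)

  E-mono : ∀ {c c′ u v} → Below c c′ → E c′ u v ≡ true → E c u v ≡ true
  E-mono {c} {c′} {u} {v} h e = let (t , h′ , o) = E-home {c′} {u} {v} e in E-intro (E-adj {c′} e) (below-trans h h′) o

  comps : ∀ c → Components (E c)
  comps c = components (E c) (E-sym c)

  ℓ : Node → Vertex → Vertex
  ℓ c = Components.label (comps c)

  ℓ-edge : ∀ {c u v} → E c u v ≡ true → ℓ c u ≡ ℓ c v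
  ℓ-edge {c} {u} {v} e = Components.closed (comps c) u v e

  ℓ-refines : ∀ {c c′} → Below c c′ → ∀ u → ℓ c (ℓ c′ u) ≡ ℓ c u
  ℓ-refines {c} {c′} h u = sym (Components.closed* (comps c) (mapStar (λ {x} {y} → E-mono {c} {c′} {x} {y} h)
      (Components.linked (comps c′) u)))

  -- Components are indexed by all vertices `x`; one that is not a label gives an empty piece.
  Eₓ : Node → Vertex → EdgeSet (n G)
  Eₓ c x u v = E c u v ∧ δ (ℓ c u) x

  Aₓ : Node → Vertex → Sub (n G)
  Aₓ c x a = adhesion D c a ∧ δ (ℓ c a) x

  Eₓ-sym : ∀ c x u v → Eₓ c x u v ≡ Eₓ c x v u
  Eₓ-sym c x u v = same-truth (f u v) (f v u)
    where
    f : ∀ u v → Eₓ c x u v ≡ true → Eₓ c x v u ≡ true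
    f u v e = let (p , q) = ∧-elim {E c u v} e in ∧-intro (trans (E-sym c v u) p) (subst (λ z → δ z x ≡ true) (ℓ-edge {c} {u} {v} p) q)

  adj-≢ : ∀ {u v} → adj G u v ≡ true → u ≢ v
  adj-≢ {u} e refl = absurd e (adj-irrefl G u)

  route-linked : ∀ {c a d x} → Linked (E c) a d → ℓ c a ≡ x → ∃ λ R → Within (Eₓ c x) R × (∀ u → deg R u ≡ δ a u xor δ d u)
  route-linked {a = a} ε _ = (λ _ _ → false) , within (λ _ _ → refl) (λ _ _ ()) , λ u → trans
      (par-zero {n G} (λ _ → false) (λ _ → refl)) (sym (xor-same (δ a u)))
  route-linked {c} {a} {d} {x} (_◅_ {j = a′} e es) ℓa with route-linked es (trans (sym (ℓ-edge {c} {a} {a′} e)) ℓa)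
  ... | R , W , R-deg = single a a′ ⊕ R , within-⊕ (within (single-sym a a′) sub) W , λ u →
      trans (par-xor (single a a′ u) (R u)) (trans (cong₂ _xor_ (single-deg (adj-≢ (E-adj {c} e)) u) (R-deg u))
        (taut 3 (λ x y z → (x xor y) xor (y xor z)) (λ x y z → x xor z) (δ a u) (δ a′ u) (δ d u)))
    where
    edge : Eₓ c x a a′ ≡ true
    edge = ∧-intro e (subst (λ z → δ (ℓ c a) z ≡ true) ℓa (δ-refl (ℓ c a)))
    sub : ∀ u v → single a a′ u v ≡ true → Eₓ c x u v ≡ true
    sub u v s with single-elim {p = a} {a′} {u} {v} s
    ... | inj₁ (refl , refl) = edge
    ... | inj₂ (refl , refl) = trans (Eₓ-sym c x a′ a) edge

  ahead-total : ∀ {p q : Vertex} → p ≢ q → ahead p q ≡ true ⊎ ahead q p ≡ true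
  ahead-total {p} {q} p≢q with dichotomy (ahead p q)
  ... | inj₁ t = inj₁ t
  ... | inj₂ f = inj₂ (trans (cong (_xor ahead q p) (sym f)) (ahead-xor p≢q))

  ahead-asym : ∀ {p q : Vertex} → ahead p q ≡ true → ¬ ahead q p ≡ true
  ahead-asym {p} {q} x y with toℕ p ℕ.<? toℕ q | toℕ q ℕ.<? toℕ p
  ... | yes h | yes h′ = ℕ.<-asym h h′

  -- The terminal bound is `k + 2` because single edges are pieces too: they have two terminals,
  -- which may exceed `k`.
  N : ℕ
  N = load (k + 2) (ownLoad (k + 2) b)

  Piece : Set
  Piece = (Vertex × Vertex) ⊎ (Fin (m D) × Vertex)

  size : ℕ
  size = n G * n G + m D * n G

  decode : Fin size → Piece
  decode t = [ inj₁ ∘ remQuot (n G) , inj₂ ∘ remQuot (n G) ]′ (splitAt (n G * n G) t)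

  position : Piece → Fin size
  position (inj₁ (p , q)) = combine p q ↑ˡ (m D * n G)
  position (inj₂ (i , x)) = (n G * n G) ↑ʳ combine i x

  decode-position : ∀ z → decode (position z) ≡ z
  decode-position (inj₁ (p , q)) rewrite Fin.splitAt-↑ˡ (n G * n G) (combine p q) (m D * n G) = cong inj₁ (Fin.remQuot-combine p q)
  decode-position (inj₂ (i , x)) rewrite Fin.splitAt-↑ʳ (n G * n G) (m D * n G) (combine i x) = cong inj₂ (Fin.remQuot-combine i x)

  position-decode : ∀ t → position (decode t) ≡ t
  position-decode t with splitAt (n G * n G) t in eq
  ... | inj₁ j = trans (cong (_↑ˡ (m D * n G)) (Fin.combine-remQuot {n G} (n G) j)) (Fin.splitAt⁻¹-↑ˡ eq)
  ... | inj₂ j = trans (cong ((n G * n G) ↑ʳ_) (Fin.combine-remQuot {m D} (n G) j)) (Fin.splitAt⁻¹-↑ʳ eq)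

  -- The pieces of component x at node c: the edges with home c, and the components at the children of c.
  -- Indices that do not name such a piece (active false) stand for empty pieces.
  module At (c : Node) (x : Vertex) where

    active : Piece → Bool
    -- Only one orientation of an edge is active, since otherwise the edge would belong to two
    -- pieces.
    active (inj₁ (p , q))  = ahead p q ∧ (adj G p q ∧ (home c p q ∧ δ (ℓ c p) x))
    active (inj₂ (i , x′)) = δ (parent D i) c ∧ δ (ℓ c x′) x

    edges : Piece → EdgeSet (n G)
    edges (inj₁ (p , q))  = single p q
    edges (inj₂ (i , x′)) = Eₓ (suc i) x′

    terminals : Piece → Sub (n G)
    terminals (inj₁ (p , q)) a  = δ p a ∨ δ q a
    terminals (inj₂ (i , x′)) a = Aₓ (suc i) x′ a

    Es : Fin size → EdgeSet (n G)
    Es t u v = active (decode t) ∧ edges (decode t) u v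

    A : Fin size → Sub (n G)
    A t a = active (decode t) ∧ terminals (decode t) a

    realize : (∀ i x′ → parent D i ≡ c → Realizable N (Eₓ (suc i) x′) (Aₓ (suc i) x′)) → ∀ t → Realizable N (Es t) (A t)
    realize ih t = go (decode t)
      where
      go : ∀ z → Realizable N (λ u v → active z ∧ edges z u v) (λ a → active z ∧ terminals z a)
      go z with active z in eq
      ... | false = realizable-empty N _ _ (λ _ _ → refl) (λ _ → refl)
      go (inj₁ (p , q))  | true = realizable-edge N (adj-≢ (proj₁ (∧-elim (proj₂ (∧-elim {ahead p q} eq)))))
      go (inj₂ (i , x′)) | true = ih i x′ (δ-true (proj₁ (∧-elim eq)))

    module Edge {p q} (e : active (inj₁ (p , q)) ≡ true) where
      isAhead : ahead p q ≡ true
      isAhead = proj₁ (∧-elim e)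
      isAdj : adj G p q ≡ true
      isAdj = proj₁ (∧-elim (proj₂ (∧-elim {ahead p q} e)))
      isHome : home c p q ≡ true
      isHome = proj₁ (∧-elim (proj₂ (∧-elim {adj G p q} (proj₂ (∧-elim {ahead p q} e)))))
      isLabel : ℓ c p ≡ x
      isLabel = δ-true (proj₂ (∧-elim {home c p q} (proj₂ (∧-elim {adj G p q} (proj₂ (∧-elim {ahead p q} e))))))
      inPiece : Eₓ c x p q ≡ true
      inPiece = ∧-intro (E-intro isAdj self isHome) (subst (λ z → δ (ℓ c p) z ≡ true) isLabel (δ-refl (ℓ c p)))

    module Part {i x′} (e : active (inj₂ (i , x′)) ≡ true) where
      isChildOf : parent D i ≡ c
      isChildOf = δ-true (proj₁ (∧-elim e))
      isLabel : ℓ c x′ ≡ x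
      isLabel = δ-true (proj₂ (∧-elim {δ (parent D i) c} e))
      below : Below c (suc i)
      below = child i (subst (Below c) (sym isChildOf) self)
      outside : ¬ Below (suc i) c
      outside = not-below-child isChildOf

    single-home : ∀ {p q u v} → active (inj₁ (p , q)) ≡ true → single p q u v ≡ true → home c u v ≡ true
    single-home {p} {q} {u} {v} e s with single-elim {p = p} {q} {u} {v} s
    ... | inj₁ (refl , refl) = Edge.isHome {p} {q} e
    ... | inj₂ (refl , refl) = trans (home-sym c q p) (Edge.isHome {p} {q} e)

    edges-sym : ∀ z u v → edges z u v ≡ edges z v u
    edges-sym (inj₁ (p , q))  u v = single-sym p q u v
    edges-sym (inj₂ (i , x′)) u v = Eₓ-sym (suc i) x′ u v

    edges⊆ : ∀ z → active z ≡ true → ∀ u v → edges z u v ≡ true → Eₓ c x u v ≡ true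
    edges⊆ (inj₁ (p , q)) a u v s with single-elim {p = p} {q} {u} {v} s
    ... | inj₁ (refl , refl) = Edge.inPiece {p} {q} a
    ... | inj₂ (refl , refl) = trans (Eₓ-sym c x q p) (Edge.inPiece {p} {q} a)
    edges⊆ (inj₂ (i , x′)) a u v s = let (e , l) = ∧-elim {E (suc i) u v} s in
      ∧-intro (E-mono {c} {suc i} {u} {v} below e) (subst (λ z → δ (ℓ c u) z ≡ true)
        (trans (sym (ℓ-refines below u)) (trans (cong (ℓ c) (δ-true l)) isLabel)) (δ-refl (ℓ c u)))
      where open Part {i} {x′} a

    owner : ∀ u v → Eₓ c x u v ≡ true → ∃ λ z → active z ∧ edges z u v ≡ true
    owner u v e with ∧-elim {E c u v} e
    ... | eᶜ , l with E-home {c} {u} {v} eᶜ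
    ... | t , h , o with below-child h
    ... | inj₂ (i , pi , h′) = inj₂ (i , ℓ (suc i) u) , ∧-intro
          (∧-intro (subst (λ z → δ (parent D i) z ≡ true) pi (δ-refl (parent D i)))
            (subst (λ z → δ z x ≡ true) (sym (ℓ-refines (child i (subst (Below c) (sym pi) self)) u)) l))
          (∧-intro (E-intro (E-adj {c} eᶜ) h′ o) (δ-refl (ℓ (suc i) u)))
    ... | inj₁ refl with ahead-total (adj-≢ (E-adj {c} eᶜ))
    ... | inj₁ asc = inj₁ (u , v) , ∧-intro (∧-intro asc (∧-intro (E-adj {c} eᶜ) (∧-intro o l))) (single-self u v)
    ... | inj₂ asc = inj₁ (v , u) , ∧-intro (∧-intro asc (∧-intro (trans (adj-sym G v u) (E-adj {c} eᶜ)) (∧-intro (trans (home-sym c v u) o)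
            (subst (λ z → δ z x ≡ true) (ℓ-edge {c} eᶜ) l)))) (trans (single-sym v u u v) (single-self v u))

    home-child : ∀ {i x′ u v} → Eₓ (suc i) x′ u v ≡ true → ∃ λ t → Below (suc i) t × home t u v ≡ true
    home-child {i} {x′} {u} {v} e = E-home {suc i} {u} {v} (proj₁ (∧-elim e))

    label-child : ∀ {i x′ u v} → Eₓ (suc i) x′ u v ≡ true → ℓ (suc i) u ≡ x′
    label-child {i} {x′} {u} {v} e = δ-true (proj₂ (∧-elim {E (suc i) u v} e))

    edge-child-disjoint : ∀ {p q i x′ u v} → active (inj₁ (p , q)) ≡ true → single p q u v ≡ true →
      active (inj₂ (i , x′)) ≡ true → Eₓ (suc i) x′ u v ≡ true → ⊥
    edge-child-disjoint {p} {q} {i} {x′} {u} {v} a s a′ e with home-child {i} {x′} {u} {v} e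
    ... | t , h , o = Part.outside {i} {x′} a′ (subst (Below (suc i)) (home-unique {t} {c} {u} {v} o (single-home {p} {q} {u} {v} a s)) h)

    disjoint : ∀ z z′ u v → active z ≡ true → edges z u v ≡ true → active z′ ≡ true → edges z′ u v ≡ true → z ≡ z′
    disjoint (inj₁ (p , q)) (inj₁ (p′ , q′)) u v a s a′ s′ with single-elim {p = p} {q} {u} {v} s | single-elim {p = p′} {q′} {u} {v} s′
    ... | inj₁ (refl , refl) | inj₁ (refl , refl) = refl
    ... | inj₂ (refl , refl) | inj₂ (refl , refl) = refl
    ... | inj₁ (refl , refl) | inj₂ (refl , refl) = contradiction (Edge.isAhead {p′} {q′} a′) (ahead-asym {p} {q} (Edge.isAhead {p} {q} a))
    ... | inj₂ (refl , refl) | inj₁ (refl , refl) = contradiction (Edge.isAhead {p′} {q′} a′) (ahead-asym {p} {q} (Edge.isAhead {p} {q} a))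
    disjoint (inj₁ (p , q)) (inj₂ (i , x′)) u v a s a′ e = ⊥-elim (edge-child-disjoint {p} {q} {i} {x′} {u} {v} a s a′ e)
    disjoint (inj₂ (i , x′)) (inj₁ (p , q)) u v a e a′ s = ⊥-elim (edge-child-disjoint {p} {q} {i} {x′} {u} {v} a′ s a e)
    disjoint (inj₂ (i , x′)) (inj₂ (j , y′)) u v a e a′ e′ with home-child {i} {x′} {u} {v} e | home-child {j} {y′} {u} {v} e′
    ... | t , h , o | t′ , h′ , o′ with home-unique {t} {t′} {u} {v} o o′
    ... | refl with siblings (trans (Part.isChildOf {i} {x′} a) (sym (Part.isChildOf {j} {y′} a′))) h h′
    ... | refl = cong (λ y → inj₂ (i , y)) (trans (sym (label-child {i} {x′} {u} {v} e)) (label-child {i} {y′} {u} {v} e′))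

    -- A vertex of a child's piece that also occurs in a bag outside the child's subtree lies in the
    -- child's adhesion by `separated`. Two pieces of the same child cannot share a vertex, as they
    -- are different components.
    attach : ∀ z u v → active z ≡ true → edges z u v ≡ true →
      Aₓ c x u ≡ true ⊎ (∃ λ z′ → ∃ λ w → z′ ≢ z × active z′ ≡ true × edges z′ u w ≡ true) → terminals z u ≡ true
    attach (inj₁ (p , q)) u v a s _ with single-elim {p = p} {q} {u} {v} s
    ... | inj₁ (refl , _) = ∨-introˡ _ (δ-refl p)
    ... | inj₂ (refl , _) = ∨-introʳ (δ p q) (δ-refl q)
    attach (inj₂ (i , x′)) u v a e other = ∧-intro (elsewhere other) (proj₂ (∧-elim {E (suc i) u v} e))
      where
      open Part {i} {x′} a
      here′ = home-child {i} {x′} {u} {v} e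
      leaves : ∀ {t} → bag D t u ≡ true → ¬ Below (suc i) t → adhesion D (suc i) u ≡ true
      leaves bt ¬h = separated (home-bagˡ {proj₁ here′} {u} {v} (proj₂ (proj₂ here′))) bt (proj₁ (proj₂ here′)) ¬h
      adhesion-bag : ∀ t {w} → adhesion D t w ≡ true → bag D t w ≡ true
      adhesion-bag (suc j) h = proj₁ (∧-elim h)
      elsewhere : Aₓ c x u ≡ true ⊎ (∃ λ z′ → ∃ λ w → z′ ≢ inj₂ (i , x′) × active z′ ≡ true × edges z′ u w ≡ true) → adhesion D
          (suc i) u ≡ true
      elsewhere (inj₁ d) = leaves {c} (adhesion-bag c (proj₁ (∧-elim d))) outside
      elsewhere (inj₂ (inj₁ (p , q) , w , _ , a′ , s)) = leaves {c} (home-bagˡ {c} {u} {w} (single-home {p} {q} {u} {w} a′ s)) outside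
      elsewhere (inj₂ (inj₂ (j , y′) , w , new , a′ , e′)) with home-child {j} {y′} {u} {w} e′
      ... | t′ , h′ , o′ = leaves {t′} (home-bagˡ {t′} {u} {w} o′) λ h → same
              (siblings (trans isChildOf (sym (Part.isChildOf {j} {y′} a′))) h h′)
        where
        same : i ≢ j
        same refl = new (cong (λ y → inj₂ (i , y)) (trans (sym (label-child {i} {y′} {u} {w} e′)) (label-child {i} {x′} {u} {v} e)))

    terminals-size : ∀ z → count (terminals z) ≤ k + 2
    terminals-size (inj₁ (p , q)) = ℕ.≤-trans (count-∪ {q = δ p} {r = δ q} (λ a e → ∨-elim e))
      (ℕ.≤-trans (ℕ.+-mono-≤ (count-only (δ p) p (λ a e → sym (δ-true e))) (count-only (δ q) q (λ a e → sym (δ-true e)))) (ℕ.m≤n+m 2 k))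
    terminals-size (inj₂ (i , x′)) = ℕ.≤-trans (count-mono {p = Aₓ (suc i) x′} {q = adhesion D (suc i)} (λ a e → proj₁ (∧-elim e)))
        (ℕ.≤-trans (adh (suc i)) (ℕ.m≤m+n k 2))

    sizes : ∀ t → count (A t) ≤ k + 2
    sizes t = ℕ.≤-trans (count-mono {p = A t} {q = terminals (decode t)} (λ a e → proj₂ (∧-elim {active (decode t)} e)))
        (terminals-size (decode t))

    terminals-bag : ∀ z → active z ≡ true → ∀ a → terminals z a ≡ true → bag D c a ≡ true
    terminals-bag (inj₁ (p , q)) act a e with ∨-elim {δ p a} e
    ... | inj₁ h = subst (λ z → bag D c z ≡ true) (δ-true h) (home-bagˡ {c} {p} {q} (Edge.isHome {p} {q} act))
    ... | inj₂ h = subst (λ z → bag D c z ≡ true) (δ-true h) (home-bagˡ {c} {q} {p} (trans (home-sym c q p) (Edge.isHome {p} {q} act)))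
    terminals-bag (inj₂ (i , x′)) act a e = subst (λ t → bag D t a ≡ true) (Part.isChildOf {i} {x′} act)
        (proj₂ (∧-elim {bag D (suc i) a} (proj₁ (∧-elim e))))

    A⊆bag : ∀ t a → A t a ≡ true → ∃ λ α → elems (bag D c) α ≡ a
    A⊆bag t a e = let (act , h) = ∧-elim {active (decode t)} e in elems-onto (bag D c) a (terminals-bag (decode t) act a h)

    module Own = Gens A (k + 2) sizes (elems (bag D c)) (elems-injective (bag D c)) A⊆bag

    -- Single edges are edges of `G`, and the terminals of a child's component lie in the adhesion
    -- of that child. The inclusion may be proper: a child does not join terminals in different
    -- components, and the adhesion of `c` itself provides no piece. This is where the closure of
    -- the class under subgraphs enters.
    K⊆torso : Own.K ⊆G torso D c
    K⊆torso = id , id , sub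
      where
      pair-related : ∀ z → active z ≡ true → ∀ {a d} → a ≢ d → terminals z a ≡ true → terminals z d ≡ true → torsoRel D c a d ≡ true
      pair-related (inj₂ (i , x′)) act {a} {d} _ ea ed = ∨-introʳ (adj G a d) (∨-introʳ (adhesion D c a ∧ adhesion D c d)
        (anyF-intro (λ t → isChild D t c ∧ (adhesion D t a ∧ adhesion D t d)) (suc i)
          (∧-intro (proj₁ (∧-elim {δ (parent D i) c} act)) (∧-intro (proj₁ (∧-elim {adhesion D (suc i) a} ea))
              (proj₁ (∧-elim {adhesion D (suc i) d} ed))))))
      pair-related (inj₁ (p , q)) act {a} {d} a≢d ea ed = ∨-introˡ _ (go (∨-elim {δ p a} ea) (∨-elim {δ p d} ed))
        where
        go : δ p a ≡ true ⊎ δ q a ≡ true → δ p d ≡ true ⊎ δ q d ≡ true → adj G a d ≡ true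
        go (inj₁ h) (inj₁ h′) = contradiction (trans (sym (δ-true h)) (δ-true h′)) a≢d
        go (inj₂ h) (inj₂ h′) = contradiction (trans (sym (δ-true h)) (δ-true h′)) a≢d
        go (inj₁ h) (inj₂ h′) = subst₂ (λ y z → adj G y z ≡ true) (δ-true h) (δ-true h′) (Edge.isAdj {p} {q} act)
        go (inj₂ h) (inj₁ h′) = subst₂ (λ y z → adj G y z ≡ true) (δ-true h) (δ-true h′) (trans (adj-sym G q p) (Edge.isAdj {p} {q} act))
      sub : ∀ α β → adj Own.K α β ≡ true → adj (torso D c) α β ≡ true
      sub α β e with ∧-elim {not (δ α β)} e
      ... | α≢β , any with anyF-elim (λ t → Own.both t α β) any
      ... | t , both with ∧-elim {A t (elems (bag D c) α)} both
      ... | e₁ , e₂ = ∧-intro (cong not (δ-≢ distinct)) (pair-related (decode t) (proj₁ (∧-elim e₁)) distinct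
              (proj₂ (∧-elim {active (decode t)} e₁)) (proj₂ (∧-elim {active (decode t)} e₂)))
        where
        distinct : elems (bag D c) α ≢ elems (bag D c) β
        distinct eq = absurd α≢β (cong not (subst (λ z → δ α z ≡ true) (elems-injective (bag D c) eq) (δ-refl α)))

    module OwnGens = Own.WithBasis b (bn c Own.K K⊆torso)

    pieces : Pieces (k + 2) (ownLoad (k + 2) b) (Eₓ c x) (Aₓ c x) Es A
    pieces = record
      { sizes       = sizes
      ; sizeD       = ℕ.≤-trans (count-mono {p = Aₓ c x} {q = adhesion D c} (λ a e → proj₁ (∧-elim e))) (ℕ.≤-trans (adh c) (ℕ.m≤m+n k 2))
      ; irreflexive = λ u → cong (_∧ δ (ℓ c u) x) (not-true λ e → adj-≢ (E-adj {c} {u} {u} e) refl)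
      ; Es-sym      = λ t u v → cong (active (decode t) ∧_) (edges-sym (decode t) u v)
      ; owner       = λ u v e → let (z , h) = owner u v e in position z , subst (λ y → active y ∧ edges y u v ≡ true) (sym (decode-position z)) h
      ; Es⊆E        = λ t u v e → let (a , h) = ∧-elim {active (decode t)} e in edges⊆ (decode t) a u v h
      ; disjoint    = λ t t′ u v e e′ → let (a , h) = ∧-elim {active (decode t)} e ; (a′ , h′) = ∧-elim {active (decode t′)} e′ in
                        decode-injective (disjoint (decode t) (decode t′) u v a h a′ h′)
      ; attach      = λ t u v e other → let (a , h) = ∧-elim {active (decode t)} e in ∧-intro a (attach (decode t) u v a h (case other of λ where
                        (inj₁ d) → inj₁ d
                        (inj₂ (t′ , w , t′≢t , e′)) → let (a′ , h′) = ∧-elim {active (decode t′)} e′ in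
                          inj₂ (decode t′ , w , (λ eq → t′≢t (decode-injective eq)) , a′ , h′)))
      ; linking     = linking
      ; gens        = OwnGens.gens
      ; gens-cycle  = OwnGens.gens-cycle
      ; gens-span   = OwnGens.gens-span
      ; gens-load   = OwnGens.gens-load }
      where
      decode-injective : ∀ {t t′} → decode t ≡ decode t′ → t ≡ t′
      decode-injective {t} {t′} eq = trans (sym (position-decode t)) (trans (cong position eq) (position-decode t′))
      -- Both terminals have the label `x`, so a walk in `E c` joins them, and it stays in the
      -- component; the sum of its edges is `R`.
      linking : ∀ {a d} → Aₓ c x a ≡ true → Aₓ c x d ≡ true → ∃ λ R → Within (Eₓ c x) R × (∀ u → deg R u ≡ δ a u xor δ d u)
      linking {a} {d} ea ed = route-linked (Components.linked (comps c) a ◅◅ subst (λ z → Linked (E c) z d) (trans ℓd (sym ℓa))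
          (Linked-sym (E-sym c) (Components.linked (comps c) d))) ℓa
        where
        ℓa : ℓ c a ≡ x
        ℓa = δ-true (proj₂ (∧-elim {adhesion D c a} ea))
        ℓd : ℓ c d ≡ x
        ℓd = δ-true (proj₂ (∧-elim {adhesion D c d} ed))

  -- A child has a larger index than its parent, so `d` can decrease from a node to its children; it
  -- cannot be `0`, as `c` is at most `m D`.
  realizable : ∀ d c x → suc (m D) ≤ toℕ c + d → Realizable N (Eₓ c x) (Aₓ c x)
  realizable zero c x le = contradiction (subst (suc (m D) ≤_) (ℕ.+-identityʳ (toℕ c)) le) (ℕ.<⇒≱ (Fin.toℕ<n c))
  realizable (suc d) c x le = assemble {k = k + 2} {β = ownLoad (k + 2) b} (At.pieces c x)
      (At.realize c x λ i x′ pi → realizable d (suc i) x′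
    (ℕ.≤-trans (subst (suc (m D) ≤_) (ℕ.+-suc (toℕ c) d) le) (ℕ.+-monoˡ-≤ d (s≤s (subst (λ t → toℕ t ≤ toℕ i) pi (parent< D i))))))

  -- The root has an empty adhesion, so the components of `G` are pieces without terminals. All
  -- chains on them vanish, hence the empty list of generators suffices and `assemble` only collects
  -- the components.
  whole : Realizable N (adj G) (λ _ → false)
  whole = assemble {k = k + 2} {β = ownLoad (k + 2) b} {Es = Eₓ zero} {A = Aₓ zero} record
    { sizes       = λ x → ℕ.≤-trans (ℕ.≤-reflexive (count-zero (Aₓ zero x) (λ _ → refl))) z≤n
    ; sizeD       = ℕ.≤-trans (ℕ.≤-reflexive (count-zero {n G} (λ _ → false) (λ _ → refl))) z≤n
    ; irreflexive = adj-irrefl G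
    ; Es-sym      = Eₓ-sym zero
    ; owner       = λ u v e → ℓ zero u , let (t , h) = home-exists e in ∧-intro (E-intro e (below-root t) h) (δ-refl (ℓ zero u))
    ; Es⊆E        = λ x u v e → E-adj {zero} (proj₁ (∧-elim e))
    ; disjoint    = λ x y u v e e′ → trans (sym (labelled e)) (labelled e′)
    ; attach      = λ { x u v e (inj₂ (y , w , y≢x , e′)) → contradiction (trans (sym (labelled e′)) (labelled e)) y≢x }
    ; linking     = λ ()
    ; gens        = []
    ; gens-cycle  = []
    ; gens-span   = λ w (W , _) → span-zero (λ x a → not-true (λ e → case Chains.IsChain.inside W x a e of λ ()))
    ; gens-load   = λ _ _ → z≤n } (λ x → realizable (suc (m D)) zero x ℕ.≤-refl)
    where
    labelled : ∀ {x u v} → Eₓ zero x u v ≡ true → ℓ zero u ≡ x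
    labelled {x} {u} {v} e = δ-true (proj₂ (∧-elim {E zero u v} e))

-- From spanning sets to bases

search : ∀ r (P : (Fin r → Bool) → Set) → (∀ {c c′} → (∀ i → c i ≡ c′ i) → P c → P c′) → (∀ c → Dec (P c)) → Dec (∃ P)
search zero P resp P? with P? (λ ())
... | yes p = yes (_ , p)
... | no ¬p = no λ (c , p) → ¬p (resp (λ ()) p)
search (suc r) P resp P? with extend-by true | extend-by false
  where
  prefix : Bool → (Fin r → Bool) → Fin (suc r) → Bool
  prefix b c zero    = b
  prefix b c (suc i) = c i
  extend-by : ∀ b → Dec (∃ λ c → P (prefix b c))
  extend-by b = search r (P ∘ prefix b) (λ h → resp λ { zero → refl ; (suc i) → h i }) (P? ∘ prefix b)
... | yes (c , p) | _           = yes (_ , p)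
... | no _        | yes (c , p) = yes (_ , p)
... | no ¬t       | no ¬f       = no λ (c , p) → case dichotomy (c zero) of λ where
  (inj₁ t) → ¬t (c ∘ suc , resp (λ { zero → t ; (suc i) → refl }) p)
  (inj₂ f) → ¬f (c ∘ suc , resp (λ { zero → f ; (suc i) → refl }) p)

module _ {n : ℕ} where

  sumSel-⊕ : ∀ {r} (B : Fin r → EdgeSet n) c c′ u v → sumSel B (λ i → c i xor c′ i) u v ≡ sumSel B c u v xor sumSel B c′ u v
  sumSel-⊕ B c c′ u v = trans (sumSel-par B _ u v) (trans (par-cong (λ i → ∧-distribʳ-xor (B i u v) (c i) (c′ i)))
    (trans (par-xor (λ i → c i ∧ B i u v) (λ i → c′ i ∧ B i u v)) (sym (cong₂ _xor_ (sumSel-par B c u v) (sumSel-par B c′ u v)))))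

  span⇒sumSel : ∀ (Zs : List (EdgeSet n)) {S} → Span Zs S → ∃ λ c → sumSel (lookup Zs) c ≈E S
  span⇒sumSel Zs (span-zero z) = (λ _ → false) , λ u v → trans (sumSel-par (lookup Zs) _ u v)
      (trans (par-zero {length Zs} (λ _ → false) (λ _ → refl)) (sym (z u v)))
  span⇒sumSel Zs {S} (span-add {S′ = S′} {Z} Z∈ σ h) with span⇒sumSel Zs σ
  ... | c , e = (λ i → δ i (Any.index Z∈) xor c i) , λ u v → trans (sumSel-⊕ (lookup Zs) (λ i → δ i (Any.index Z∈)) c u v)
      (trans (cong₂ _xor_ (trans (sumSel-par (lookup Zs) _ u v)
          (trans (par-δ (λ i → lookup Zs i u v) (Any.index Z∈)) (cong (λ M → M u v) (sym (Any.lookup-index Z∈))))) (e u v)) (sym (h u v)))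

  sumSel⇒span : ∀ (Zs : List (EdgeSet n)) c {S} → sumSel (lookup Zs) c ≈E S → Span Zs S
  sumSel⇒span Zs c e = span-resp (λ u v → trans (sym (sumSel-par (lookup Zs) c u v)) (e u v))
      (span-par (λ i u v → c i ∧ lookup Zs i u v) part)
    where
    part : ∀ i → Span Zs (λ u v → c i ∧ lookup Zs i u v)
    part i with c i
    ... | true  = span-member (Mem.∈-lookup i)
    ... | false = span-zero (λ _ _ → refl)

  span? : ∀ (Zs : List (EdgeSet n)) S → Dec (∃ λ c → sumSel (lookup Zs) c ≈E S)
  span? Zs S = search (length Zs) (λ c → sumSel (lookup Zs) c ≈E S)
    (λ {c} {c′} h e u v → trans (trans (sumSel-par (lookup Zs) c′ u v)
        (trans (par-cong (λ i → cong (_∧ lookup Zs i u v) (sym (h i)))) (sym (sumSel-par (lookup Zs) c u v)))) (e u v))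
    (λ c → Fin.all? λ u → Fin.all? λ v → sumSel (lookup Zs) c u v Bool.≟ S u v)

  Independent : List (EdgeSet n) → Set
  Independent Zs = ∀ (c : Fin (length Zs) → Bool) → sumSel (lookup Zs) c ≈E emptyE → ∀ i → c i ≡ false

  record Thinning {ℓ} (P : EdgeSet n → Set ℓ) (Zs : List (EdgeSet n)) : Set ℓ where
    field
      kept        : List (EdgeSet n)
      kept-all    : All P kept
      kept-indep  : Independent kept
      kept-span   : ∀ {Z} → Z ∈ Zs → Span kept Z
      kept-count  : ∀ φ → countL φ kept ≤ countL φ Zs

  -- An element is kept only if it is not spanned by those already kept. Dropping elements cannot
  -- raise the congestion.
  thin : ∀ {ℓ} {P : EdgeSet n → Set ℓ} Zs → All P Zs → Thinning P Zs
  thin [] [] = record { kept = [] ; kept-all = [] ; kept-indep = λ c e () ; kept-span = λ () ; kept-count = λ φ → z≤n }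
  thin (Z ∷ Zs) (p ∷ ps) with thin Zs ps
  ... | T with span? (Thinning.kept T) Z
  ... | yes (c , e) = record
    { kept = kept ; kept-all = kept-all ; kept-indep = kept-indep
    ; kept-span = λ { (here refl) → sumSel⇒span kept c e ; (there Z∈) → kept-span Z∈ }
    ; kept-count = λ φ → ℕ.≤-trans (kept-count φ) (ℕ.m≤n+m _ (ind (φ Z))) }
    where open Thinning T
  ... | no ∉span = record
    { kept = Z ∷ kept ; kept-all = p ∷ kept-all ; kept-indep = independent
    ; kept-span = λ { (here refl) → span-member (here refl) ; (there Z∈) → span-⊆ there (kept-span Z∈) }
    ; kept-count = λ φ → ℕ.+-monoʳ-≤ (ind (φ Z)) (kept-count φ) }
    where
    open Thinning T
    independent : Independent (Z ∷ kept)
    independent c e with dichotomy (c zero)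
    ... | inj₁ t = contradiction (c ∘ suc , λ u v → sym (xor-cancel
            (trans (cong (λ b → (b ∧ Z u v) xor sumSel (lookup kept) (c ∘ suc) u v) (sym t)) (e u v)))) ∉span
    ... | inj₂ f = λ where
      zero    → f
      (suc i) → kept-indep (c ∘ suc) (λ u v → trans (cong (λ b → (b ∧ Z u v) xor sumSel (lookup kept) (c ∘ suc) u v) (sym f)) (e u v)) i

spanned⇒bn : ∀ G N (Zs : List (EdgeSet (n G))) → All (Cycle (adj G)) Zs → (∀ S → Cycle (adj G) S → Span Zs S) →
  (∀ u v → countL (λ Z → Z u v) Zs ≤ N) → BnAtMost G N
spanned⇒bn G N Zs cyc spans bound = record
  { r        = length kept
  ; member   = lookup kept
  ; isCycle  = λ i → let (W , z) = All.lookup kept-all (Mem.∈-lookup i) in (symmetric W , subset W) , λ u → par⇒even (lookup kept i u) (z u)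
  ; indep    = kept-indep
  ; spanning = λ S ((s , sub) , ev) → span⇒sumSel kept (span-trans kept-span (spans S (within s sub , λ u → even⇒par (S u) (ev u)))) } ,
  λ u v _ → ℕ.≤-trans (ℕ.≤-reflexive (countL-lookup (λ Z → Z u v) kept)) (ℕ.≤-trans (kept-count (λ Z → Z u v)) (bound u v))
  where open Thinning (thin Zs cyc)

theorem1p6 : Σ (ℕ → ℕ → ℕ) λ f →
    ∀ (b k : ℕ) (𝒢 : Graph → Set) →
    SubgraphClosed 𝒢 →
    (∀ H → 𝒢 H → BnAtMost H b) →
    ∀ (G : Graph) (D : TreeDecomposition G) →
    IsTreeDecomposition G D →
    AdhesionAtMost D k →
    (∀ t → 𝒢 (torso D t)) →
    BnAtMost G (f b k)
theorem1p6 = (λ b k → load (k + 2) (ownLoad (k + 2) b)) , λ b k 𝒢 closed bn G D isD adh torsos →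
  let open Decomposition G D isD k adh b (λ t H H⊆ → bn H (closed (torso D t) H (torsos t) H⊆))
      -- For the empty family of demands, a realization is just a spanning list of cycles with
      -- congestion at most `N`.
      open Realization (whole {0} (λ ()) (λ ()) (λ ()) (λ _ → z≤n))
  in spanned⇒bn G _ cycles cycles-cycle cycles-span congestion
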